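{- Let $b_0,b_1$ be computable reals with $0<b_1\le b_0$ and $0<b_0+b_1<1$, let $b_2=1-b_0-b_1$, and let $d:\{0,1,2\}^*\to[0,1]$ be given by $d(\lambda)=1$ and $d(\sigma^\frown i)=b_i\cdot d(\sigma)$ for all $\sigma\in\{0,1,2\}^*$ and $i\in\{0,1,2\}$; write $\mathcal{T}=\mathcal{T}_d$. Let the real number $q\in[0,1]$ be upper semi-computable, i.e. there is a computable, decreasing sequence $\{q_n:n\in\mathbb{N}\}$ such that $\lim_n q_n=q$. Then there exists an effectively closed set $P\subseteq2^{\mathbb{N}}$ such that $\mathcal{T}(P)=q$. Moreover, $P$ can be written as $\bigcap_nP_n$, where $\{P_n:n\in\mathbb{N}\}$ is a computable sequence of clopen sets with $q_{n+1}\le\mathcal{T}(P_n)\le q_n$.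
   Context: A set $P\subseteq 2^{\mathbb{N}}$ is effectively closed (a $\Pi^0_1$ class) if it is the set $[T]$ of infinite paths through some computable tree $T\subseteq\{0,1\}^*$. Clopen subsets of $2^{\mathbb{N}}$ are finite unions of intervals $I(\sigma)=\{x\in2^{\mathbb{N}}:\sigma\sqsubset x\}$, $\sigma\in\{0,1\}^*$, and a sequence of clopen sets is computable if such finite representations are given computably in $n$. $\lambda$ is the empty string, $^\frown$ is concatenation. $\mathcal{C}$ is the space of nonempty closed subsets of $2^{\mathbb{N}}$. Codes of closed sets: for $Q\in\mathcal{C}$ let $T_Q=\{\sigma\in\{0,1\}^*: Q\cap I(\sigma)\ne\emptyset\}$, and let $\sigma_0,\sigma_1,\dots$ enumerate $T_Q$ first by length and then lexicographically. The code $x_Q\in\{0,1,2\}^{\mathbb{N}}$ is given by: $x_Q(n)=2$ if both $\sigma_n{}^\frown 0,\sigma_n{}^\frown 1\in T_Q$; $x_Q(n)=1$ if only $\sigma_n{}^\frown 1\in T_Q$; $x_Q(n)=0$ if only $\sigma_n{}^\frown 0\in T_Q$. The map $Q\mapsto x_Q$ is a bijection (indeed a homeomorphism for the hit-or-miss topology) from $\mathcal{C}$ onto $\{0,1,2\}^{\mathbb{N}}$. Measure and capacity: $\mu_d$ is the Borel probability measure on $\{0,1,2\}^{\mathbb{N}}$ giving the cylinder of $\sigma\in\{0,1,2\}^*$ measure $d(\sigma)$; $\mu_d^*(\mathcal{X})=\mu_d(\{x_Q:Q\in\mathcal{X}\})$ for Borel $\mathcal{X}\subseteq\mathcal{C}$;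 and $\mathcal{T}_d(Q)=\mu_d^*(\{K\in\mathcal{C}:K\cap Q\ne\emptyset\})$ for closed $Q\subseteq2^{\mathbb{N}}$.
   Formalization: The bounds q_{n+1} ≤ T(P_n) ≤ q_n are proved for strictly decreasing q_n with q_1 ≤ 1; they fail if q_1 > 1 (capacities are at most 1) and can fail for constant q_n (e.g. 1/3 with b_0 = b_1 = 1/4). The rest holds for every non-increasing q_n. -}

module Defs where

open import Level using (0ℓ) renaming (suc to lsuc)
open import Data.Fin using (Fin; zero; suc; toℕ)
import Data.Fin as Fin
open import Data.Integer using (+_; _⊖_)
open import Data.List using (List; []; _∷_; _++_; _∷ʳ_; applyUpTo; foldl; length; map)
open import Data.List.Properties using (foldl-∷ʳ)
open import Data.List.Relation.Binary.Lex.Strict using (Lex-<)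
open import Data.List.Relation.Unary.Any using (Any)
open import Data.Nat using (ℕ; zero; suc)
import Data.Nat as ℕ
import Data.Nat.Properties as ℕₚ
open import Data.Product using (Σ; ∃; _×_; _,_; proj₁; proj₂)
open import Data.Rational using (ℚ; 0ℚ; 1ℚ; ½; ∣_∣; _/_; 1/_; Positive; positive; nonNegative)
import Data.Rational as ℚ
import Data.Rational.Properties as ℚₚ
open import Data.Rational.Solver using (module +-*-Solver)
open import Data.Sum using (_⊎_)
open import Data.Vec using (Vec; []; _∷_; lookup)
open import Function using (_⇔_)
open import Relation.Binary.PropositionalEquality using (_≡_; refl; sym; trans; cong; subst)
open import Relation.Nullary using (¬_)
open import Relation.Unary using (Pred; _∈_; _≐_; _≬_; Satisfiable; ⋃; ∁)

------------------------------------------------------------------------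
-- Real numbers: Cauchy sequences of rationals, with the order and the
-- equality of the represented reals.  No eta: comparing two reals
-- definitionally should not compare their Cauchy proofs.

record ℝ : Set where
  no-eta-equality
  constructor mkℝ
  field
    seq    : ℕ → ℚ
    cauchy : ∀ ε → 0ℚ ℚ.< ε →
             ∃ λ N → ∀ m n → N ℕ.≤ m → N ℕ.≤ n → ∣ seq m ℚ.- seq n ∣ ℚ.≤ ε

open ℝ

infix  4 _≤_ _<_ _≈_
infixl 6 _+_ _-_
infixl 7 _*_
infix  8 -_

_≤_ _<_ _≈_ : ℝ → ℝ → Set
x ≤ y = ∀ ε → 0ℚ ℚ.< ε → ∃ λ N → ∀ n → N ℕ.≤ n → seq x n ℚ.≤ seq y n ℚ.+ ε
x < y = ∃ λ ε → 0ℚ ℚ.< ε × ∃ λ N → ∀ n → N ℕ.≤ n → seq x n ℚ.+ ε ℚ.≤ seq y n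
x ≈ y = x ≤ y × y ≤ x

fromℚ : ℚ → ℝ
fromℚ p = mkℝ (λ _ → p) λ ε 0<ε →
  0 , λ _ _ _ _ → subst (ℚ._≤ ε) (sym (cong ∣_∣ (ℚₚ.+-inverseʳ p))) (ℚₚ.<⇒≤ 0<ε)

0ℝ 1ℝ : ℝ
0ℝ = fromℚ 0ℚ
1ℝ = fromℚ 1ℚ

private
  open +-*-Solver using (solve; _:=_; _:+_; _:-_; _:*_; :-_)

  half-pos : ∀ ε → 0ℚ ℚ.< ε → 0ℚ ℚ.< ε ℚ.* ½
  half-pos ε 0<ε = ℚₚ.positive⁻¹ _ {{ℚₚ.pos*pos⇒pos ε {{positive 0<ε}} ½}}

  halves : ∀ ε → ε ℚ.* ½ ℚ.+ ε ℚ.* ½ ≡ ε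
  halves ε = trans (sym (ℚₚ.*-distribˡ-+ ε ½ ½)) (ℚₚ.*-identityʳ ε)

  -- With δ = ε / (a + c): a δ + δ c = ε.
  module _ (a c : ℚ) (pos : 0ℚ ℚ.< a ℚ.+ c) (ε : ℚ) (0<ε : 0ℚ ℚ.< ε) where
    private instance
      pos′ : Positive (a ℚ.+ c)
      pos′ = positive pos
      nz′ : ℚ.NonZero (a ℚ.+ c)
      nz′ = ℚₚ.pos⇒nonZero (a ℚ.+ c)

    share : ℚ
    share = ε ℚ.* (1/ (a ℚ.+ c))

    share-pos : 0ℚ ℚ.< share
    share-pos = ℚₚ.positive⁻¹ _
      {{ℚₚ.pos*pos⇒pos ε {{positive 0<ε}} (1/ (a ℚ.+ c)) {{ℚₚ.1/pos⇒pos (a ℚ.+ c)}}}}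

    share-sum : a ℚ.* share ℚ.+ share ℚ.* c ≡ ε
    share-sum = trans
      (solve 4 (λ x y e i → x :* (e :* i) :+ (e :* i) :* y := e :* (i :* (x :+ y))) refl
             a c ε (1/ (a ℚ.+ c)))
      (trans (cong (ε ℚ.*_) (ℚₚ.*-inverseˡ (a ℚ.+ c))) (ℚₚ.*-identityʳ ε))

  module EventualBound (x : ℝ) where
    from : ℕ
    from = proj₁ (cauchy x 1ℚ (ℚₚ.positive⁻¹ 1ℚ))

    bound : ℚ
    bound = 1ℚ ℚ.+ ∣ seq x from ∣

    bound-pos : 0ℚ ℚ.< bound
    bound-pos = ℚₚ.+-mono-<-≤ {0ℚ} {1ℚ} {0ℚ} (ℚₚ.positive⁻¹ 1ℚ) (ℚₚ.0≤∣p∣ (seq x from))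

    bounded : ∀ n → from ℕ.≤ n → ∣ seq x n ∣ ℚ.≤ bound
    bounded n le = begin
      ∣ seq x n ∣
        ≡⟨ cong ∣_∣ (solve 2 (λ u v → u := (u :- v) :+ v) refl (seq x n) (seq x from)) ⟩
      ∣ (seq x n ℚ.- seq x from) ℚ.+ seq x from ∣
        ≤⟨ ℚₚ.∣p+q∣≤∣p∣+∣q∣ (seq x n ℚ.- seq x from) (seq x from) ⟩
      ∣ seq x n ℚ.- seq x from ∣ ℚ.+ ∣ seq x from ∣
        ≤⟨ ℚₚ.+-monoˡ-≤ ∣ seq x from ∣
             (proj₂ (cauchy x 1ℚ (ℚₚ.positive⁻¹ 1ℚ)) n from le ℕₚ.≤-refl) ⟩
      bound ∎
      where open ℚₚ.≤-Reasoning

  *-mono-∣∣ : ∀ p q {r s} → ∣ p ∣ ℚ.≤ r → ∣ q ∣ ℚ.≤ s → ∣ p ℚ.* q ∣ ℚ.≤ r ℚ.* s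
  *-mono-∣∣ p q {r} {s} p≤r q≤s = begin
    ∣ p ℚ.* q ∣       ≡⟨ ℚₚ.∣p*q∣≡∣p∣*∣q∣ p q ⟩
    ∣ p ∣ ℚ.* ∣ q ∣   ≤⟨ ℚₚ.*-monoʳ-≤-nonNeg ∣ q ∣ {{ℚₚ.∣-∣-nonNeg q}} p≤r ⟩
    r ℚ.* ∣ q ∣       ≤⟨ ℚₚ.*-monoˡ-≤-nonNeg r
                           {{nonNegative (ℚₚ.≤-trans (ℚₚ.0≤∣p∣ p) p≤r)}} q≤s ⟩
    r ℚ.* s           ∎
    where open ℚₚ.≤-Reasoning

_+_ : ℝ → ℝ → ℝ
seq (x + y) n = seq x n ℚ.+ seq y n
cauchy (x + y) ε 0<ε = N ℕ.⊔ M , λ m n m≥ n≥ → begin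
    ∣ (seq x m ℚ.+ seq y m) ℚ.- (seq x n ℚ.+ seq y n) ∣
      ≡⟨ cong ∣_∣ (solve 4 (λ a b c d → (a :+ b) :- (c :+ d) := (a :- c) :+ (b :- d)) refl
                         (seq x m) (seq y m) (seq x n) (seq y n)) ⟩
    ∣ (seq x m ℚ.- seq x n) ℚ.+ (seq y m ℚ.- seq y n) ∣
      ≤⟨ ℚₚ.∣p+q∣≤∣p∣+∣q∣ (seq x m ℚ.- seq x n) (seq y m ℚ.- seq y n) ⟩
    ∣ seq x m ℚ.- seq x n ∣ ℚ.+ ∣ seq y m ℚ.- seq y n ∣
      ≤⟨ ℚₚ.+-mono-≤
           (proj₂ cx m n (ℕₚ.≤-trans (ℕₚ.m≤m⊔n N M) m≥) (ℕₚ.≤-trans (ℕₚ.m≤m⊔n N M) n≥))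
           (proj₂ cy m n (ℕₚ.≤-trans (ℕₚ.m≤n⊔m N M) m≥) (ℕₚ.≤-trans (ℕₚ.m≤n⊔m N M) n≥)) ⟩
    ε ℚ.* ½ ℚ.+ ε ℚ.* ½
      ≡⟨ halves ε ⟩
    ε ∎
  where
    open ℚₚ.≤-Reasoning
    cx = cauchy x (ε ℚ.* ½) (half-pos ε 0<ε)
    cy = cauchy y (ε ℚ.* ½) (half-pos ε 0<ε)
    N = proj₁ cx
    M = proj₁ cy

-_ : ℝ → ℝ
seq (- x) n = ℚ.- seq x n
cauchy (- x) ε 0<ε = proj₁ cx , λ m n m≥ n≥ →
    subst (ℚ._≤ ε)
      (trans (sym (ℚₚ.∣-p∣≡∣p∣ (seq x m ℚ.- seq x n)))
             (cong ∣_∣ (solve 2 (λ a b → :- (a :- b) := :- a :- (:- b)) refl (seq x m) (seq x n))))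
      (proj₂ cx m n m≥ n≥)
  where cx = cauchy x ε 0<ε

_-_ : ℝ → ℝ → ℝ
x - y = x + (- y)

_*_ : ℝ → ℝ → ℝ
seq (x * y) n = seq x n ℚ.* seq y n
cauchy (x * y) ε 0<ε = N , λ m n m≥ n≥ → begin
    ∣ seq x m ℚ.* seq y m ℚ.- seq x n ℚ.* seq y n ∣
      ≡⟨ cong ∣_∣ (solve 4 (λ a b c d → a :* b :- c :* d := a :* (b :- d) :+ (a :- c) :* d) refl
                         (seq x m) (seq y m) (seq x n) (seq y n)) ⟩
    ∣ seq x m ℚ.* (seq y m ℚ.- seq y n) ℚ.+ (seq x m ℚ.- seq x n) ℚ.* seq y n ∣
      ≤⟨ ℚₚ.∣p+q∣≤∣p∣+∣q∣ (seq x m ℚ.* (seq y m ℚ.- seq y n)) ((seq x m ℚ.- seq x n) ℚ.* seq y n) ⟩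
    ∣ seq x m ℚ.* (seq y m ℚ.- seq y n) ∣ ℚ.+ ∣ (seq x m ℚ.- seq x n) ℚ.* seq y n ∣
      ≤⟨ ℚₚ.+-mono-≤
           (*-mono-∣∣ (seq x m) (seq y m ℚ.- seq y n)
             (X.bounded m (≥X m≥)) (proj₂ cy m n (≥cy m≥) (≥cy n≥)))
           (*-mono-∣∣ (seq x m ℚ.- seq x n) (seq y n)
             (proj₂ cx m n (≥cx m≥) (≥cx n≥)) (Y.bounded n (≥Y n≥))) ⟩
    X.bound ℚ.* δ ℚ.+ δ ℚ.* Y.bound
      ≡⟨ share-sum X.bound Y.bound pos ε 0<ε ⟩
    ε ∎
  where
    open ℚₚ.≤-Reasoning
    module X = EventualBound x
    module Y = EventualBound y
    pos : 0ℚ ℚ.< X.bound ℚ.+ Y.bound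
    pos = ℚₚ.+-mono-< {0ℚ} {X.bound} {0ℚ} {Y.bound} X.bound-pos Y.bound-pos
    δ = share X.bound Y.bound pos ε 0<ε
    cx = cauchy x δ (share-pos X.bound Y.bound pos ε 0<ε)
    cy = cauchy y δ (share-pos X.bound Y.bound pos ε 0<ε)
    A = X.from ℕ.⊔ Y.from
    C = proj₁ cx ℕ.⊔ proj₁ cy
    N = A ℕ.⊔ C
    ≥X : ∀ {m} → N ℕ.≤ m → X.from ℕ.≤ m
    ≥X p = ℕₚ.≤-trans (ℕₚ.≤-trans (ℕₚ.m≤m⊔n X.from Y.from) (ℕₚ.m≤m⊔n A C)) p
    ≥Y : ∀ {m} → N ℕ.≤ m → Y.from ℕ.≤ m
    ≥Y p = ℕₚ.≤-trans (ℕₚ.≤-trans (ℕₚ.m≤n⊔m X.from Y.from) (ℕₚ.m≤m⊔n A C)) p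
    ≥cx : ∀ {m} → N ℕ.≤ m → proj₁ cx ℕ.≤ m
    ≥cx p = ℕₚ.≤-trans (ℕₚ.≤-trans (ℕₚ.m≤m⊔n (proj₁ cx) (proj₁ cy)) (ℕₚ.m≤n⊔m A C)) p
    ≥cy : ∀ {m} → N ℕ.≤ m → proj₁ cy ℕ.≤ m
    ≥cy p = ℕₚ.≤-trans (ℕₚ.≤-trans (ℕₚ.m≤n⊔m (proj₁ cx) (proj₁ cy)) (ℕₚ.m≤n⊔m A C)) p

∣_-_∣≤_ : ℝ → ℝ → ℚ → Set
∣ x - y ∣≤ ε = x ≤ y + fromℚ ε × y ≤ x + fromℚ ε

_⟶_ : (ℕ → ℝ) → ℝ → Set
x ⟶ l = ∀ ε → 0ℚ ℚ.< ε → ∃ λ N → ∀ n → N ℕ.≤ n → ∣ x n - l ∣≤ ε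

∑< : ℕ → (ℕ → ℝ) → ℝ
∑< zero    x = 0ℝ
∑< (suc n) x = ∑< n x + x n

------------------------------------------------------------------------
-- Computability: μ-recursive functions.  An Agda function need not be
-- computable (these notions are used under excluded middle), so
-- computability is always witnessed by a program e : Rec k.

data Rec : ℕ → Set where
  zer  : ∀ {k} → Rec k
  succ : Rec 1
  proj : ∀ {k} → Fin k → Rec k
  comp : ∀ {j k} → Rec j → Vec (Rec k) j → Rec k
  prec : ∀ {k} → Rec k → Rec (2 ℕ.+ k) → Rec (1 ℕ.+ k)
  min  : ∀ {k} → Rec (1 ℕ.+ k) → Rec k

infix 4 _⟨_⟩⇓_ _⟨_⟩⇓*_

data _⟨_⟩⇓_ : ∀ {k} → Rec k → Vec ℕ k → ℕ → Set
data _⟨_⟩⇓*_ : ∀ {j k} → Vec (Rec k) j → Vec ℕ k → Vec ℕ j → Set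

data _⟨_⟩⇓_ where
  ⇓zer      : ∀ {k} {xs : Vec ℕ k} → zer ⟨ xs ⟩⇓ 0
  ⇓succ     : ∀ {x} → succ ⟨ x ∷ [] ⟩⇓ suc x
  ⇓proj     : ∀ {k} {i : Fin k} {xs} → proj i ⟨ xs ⟩⇓ lookup xs i
  ⇓comp     : ∀ {j k} {f : Rec j} {gs : Vec (Rec k) j} {xs ys z} →
              gs ⟨ xs ⟩⇓* ys → f ⟨ ys ⟩⇓ z → comp f gs ⟨ xs ⟩⇓ z
  ⇓prec-zero : ∀ {k} {g : Rec k} {h xs z} →
              g ⟨ xs ⟩⇓ z → prec g h ⟨ 0 ∷ xs ⟩⇓ z
  ⇓prec-suc : ∀ {k} {g : Rec k} {h n xs y z} →
              prec g h ⟨ n ∷ xs ⟩⇓ y → h ⟨ n ∷ y ∷ xs ⟩⇓ z → prec g h ⟨ suc n ∷ xs ⟩⇓ z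
  ⇓min      : ∀ {k} {f : Rec (suc k)} {xs n} →
              f ⟨ n ∷ xs ⟩⇓ 0 →
              (∀ m → m ℕ.< n → ∃ λ y → f ⟨ m ∷ xs ⟩⇓ suc y) →
              min f ⟨ xs ⟩⇓ n

data _⟨_⟩⇓*_ where
  []  : ∀ {k} {xs : Vec ℕ k} → [] ⟨ xs ⟩⇓* []
  _∷_ : ∀ {j k} {g : Rec k} {gs : Vec (Rec k) j} {xs y ys} →
        g ⟨ xs ⟩⇓ y → gs ⟨ xs ⟩⇓* ys → (g ∷ gs) ⟨ xs ⟩⇓* (y ∷ ys)

Computable : ∀ {k} → (Vec ℕ k → ℕ) → Set
Computable {k} f = Σ (Rec k) λ e → ∀ xs → e ⟨ xs ⟩⇓ f xs

Computableℚ : ∀ {k} → (Vec ℕ k → ℚ) → Set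
Computableℚ {k} r = Σ (Vec ℕ k → ℕ) λ a → Σ (Vec ℕ k → ℕ) λ b → Σ (Vec ℕ k → ℕ) λ c →
  Computable a × Computable b × Computable c ×
  (∀ xs → r xs ≡ (a xs ⊖ b xs) / suc (c xs))

2⁻_ : ℕ → ℚ
2⁻ n = _/_ (+ 1) (2 ℕ.^ n) {{ℕₚ.m^n≢0 2 n}}

Computableℝ : ℝ → Set
Computableℝ x = Σ (Vec ℕ 1 → ℚ) λ r → Computableℚ r ×
  (∀ k → ∣ fromℚ (r (k ∷ [])) - x ∣≤ 2⁻ k)

ComputableSeqℝ : (ℕ → ℝ) → Set
ComputableSeqℝ x = Σ (Vec ℕ 2 → ℚ) λ r → Computableℚ r ×
  (∀ n k → ∣ fromℚ (r (n ∷ k ∷ [])) - x n ∣≤ 2⁻ k)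

------------------------------------------------------------------------
-- Strings, Cantor space, clopen sets and Π⁰₁ classes

String : Set
String = List (Fin 2)

Cantor : Set
Cantor = ℕ → Fin 2

infix 4 _⊏_

_⊏_ : ∀ {A : Set} → List A → (ℕ → A) → Set
σ ⊏ x = applyUpTo x (length σ) ≡ σ

I : String → Pred Cantor 0ℓ
I σ x = σ ⊏ x

-- Bijective base 2, hence a bijection between strings and ℕ.
codeString : String → ℕ
codeString []      = 0
codeString (i ∷ σ) = suc (toℕ i) ℕ.+ 2 ℕ.* codeString σ

-- A bijection between lists of naturals and ℕ: every positive number is
-- 2^a (1 + 2 c) for unique a and c.
codeList : List ℕ → ℕ
codeList []       = 0
codeList (a ∷ as) = 2 ℕ.^ a ℕ.* suc (2 ℕ.* codeList as)

ComputableSet : Pred String 0ℓ → Set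
ComputableSet T = Σ (Rec 1) λ e → ∀ σ →
    (σ ∈ T × e ⟨ codeString σ ∷ [] ⟩⇓ 1)
  ⊎ (¬ (σ ∈ T) × e ⟨ codeString σ ∷ [] ⟩⇓ 0)

IsTree : Pred String 0ℓ → Set
IsTree T = ∀ σ τ → σ ++ τ ∈ T → σ ∈ T

Paths : Pred String 0ℓ → Pred Cantor 0ℓ
Paths T x = ∀ n → applyUpTo x n ∈ T

EffectivelyClosed : Pred Cantor 0ℓ → Set₁
EffectivelyClosed P = Σ (Pred String 0ℓ) λ T → IsTree T × ComputableSet T × P ≐ Paths T

Clopen : Set
Clopen = List String

⟦_⟧ᶜ : Clopen → Pred Cantor 0ℓ
⟦ F ⟧ᶜ x = Any (λ σ → x ∈ I σ) F

ComputableClopenSeq : (ℕ → Clopen) → Set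
ComputableClopenSeq F = Σ (Rec 1) λ e →
  ∀ n → e ⟨ n ∷ [] ⟩⇓ codeList (map codeString (F n))

------------------------------------------------------------------------
-- Codes of nonempty closed sets

IsClosed : Pred Cantor 0ℓ → Set
IsClosed K = ∀ x → (∀ n → K ≬ I (applyUpTo x n)) → x ∈ K

Tree : Pred Cantor 0ℓ → Pred String 0ℓ
Tree K σ = K ≬ I σ

infix 4 _≺_

-- First by length, then lexicographically.
_≺_ : String → String → Set
σ ≺ τ = length σ ℕ.< length τ ⊎ (length σ ≡ length τ × Lex-< _≡_ Fin._<_ σ τ)

Branching : Pred String 0ℓ → String → Fin 3 → Set
Branching T σ zero             = σ ∷ʳ zero ∈ T × ¬ (σ ∷ʳ suc zero ∈ T)
Branching T σ (suc zero)       = ¬ (σ ∷ʳ zero ∈ T) × σ ∷ʳ suc zero ∈ T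
Branching T σ (suc (suc zero)) = σ ∷ʳ zero ∈ T × σ ∷ʳ suc zero ∈ T

Code : Set
Code = ℕ → Fin 3

-- x is the code of K.  A ≺-increasing sequence with range Tree K exists
-- and is unique when K is nonempty, so this is the graph of K ↦ x_K.
IsCode : Pred Cantor 0ℓ → Pred Code 0ℓ
IsCode K x = Σ (ℕ → String) λ σ →
    (∀ n → σ n ≺ σ (suc n))
  × (∀ τ → τ ∈ Tree K ⇔ (∃ λ n → σ n ≡ τ))
  × (∀ n → Branching (Tree K) (σ n) (x n))

-- { x_K : K nonempty closed, K ∩ Q ≠ ∅ }
CodesMeeting : Pred Cantor 0ℓ → Pred Code (lsuc 0ℓ)
CodesMeeting Q x = Σ (Pred Cantor 0ℓ) λ K →
  Satisfiable K × IsClosed K × K ≬ Q × IsCode K x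

------------------------------------------------------------------------
-- Borel probability measures on {0,1,2}^ℕ.  Borel sets are given by their
-- construction from cylinders; a measure depends only on the set denoted.

data Borel : Set where
  cyl    : List (Fin 3) → Borel
  compl  : Borel → Borel
  union  : (ℕ → Borel) → Borel

⟦_⟧ : Borel → Pred Code 0ℓ
⟦ cyl σ ⟧   x = σ ⊏ x
⟦ compl A ⟧ = ∁ ⟦ A ⟧
⟦ union A ⟧ = ⋃ ℕ (λ n → ⟦ A n ⟧)

record BorelProbabilityMeasure : Set where
  field
    measure     : Borel → ℝ
    extensional : ∀ A B → ⟦ A ⟧ ≐ ⟦ B ⟧ → measure A ≈ measure B
    nonneg      : ∀ A → 0ℝ ≤ measure A
    total       : measure (cyl []) ≈ 1ℝ
    σ-additive  : ∀ (A : ℕ → Borel) →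
                  (∀ m n → ¬ (m ≡ n) → ¬ (⟦ A m ⟧ ≬ ⟦ A n ⟧)) →
                  (λ n → ∑< n (λ i → measure (A i))) ⟶ measure (union A)

open BorelProbabilityMeasure

weights : ℝ → ℝ → Fin 3 → ℝ
weights b₀ b₁ zero             = b₀
weights b₀ b₁ (suc zero)       = b₁
weights b₀ b₁ (suc (suc zero)) = 1ℝ - b₀ - b₁

d : ℝ → ℝ → List (Fin 3) → ℝ
d b₀ b₁ = foldl (λ r i → weights b₀ b₁ i * r) 1ℝ

d-∷ʳ : ∀ b₀ b₁ σ i → d b₀ b₁ (σ ∷ʳ i) ≡ weights b₀ b₁ i * d b₀ b₁ σ
d-∷ʳ b₀ b₁ σ i = foldl-∷ʳ (λ r i → weights b₀ b₁ i * r) 1ℝ i σ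

-- μ is the (unique) Borel probability measure μ_d.
IsMeasureOf : (List (Fin 3) → ℝ) → BorelProbabilityMeasure → Set
IsMeasureOf w μ = ∀ σ → measure μ (cyl σ) ≈ w σ

-- 𝒯(Q) = r for the capacity 𝒯 induced by μ, i.e. the set of codes of the
-- closed sets meeting Q is Borel and has measure r.
HasCapacity : BorelProbabilityMeasure → Pred Cantor 0ℓ → ℝ → Set₁
HasCapacity μ Q r = Σ Borel λ B → ⟦ B ⟧ ≐ CodesMeeting Q × measure μ B ≈ r

{-# OPTIONS --safe #-}

-- The leftmost path of the closed set with code x branches right exactly where
-- the code says 1, so under μ_d it is a sequence of independent digits that are
-- 1 with probability b₁.  A closed set meets a lexicographic initial segment of
-- Cantor space iff its leftmost path lies in it, hence the capacity of
-- {y : y < σ} is the distribution function of this Bernoulli process at σ.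
-- Since 0 < b₁ < 1, its values are dense in [0,1], and they are computable from
-- b₁; a search therefore finds σₙ with qₙ₊₁ ≤ 𝒯({y : y < σₙ}) ≤ qₙ.  Initial
-- segments are linearly ordered by inclusion, so the intersection P contains
-- every {y : y < σ} of capacity less than q, which gives 𝒯(P) ≥ q by density.

module Submission where

open import Level using (0ℓ)
open import Axiom.ExcludedMiddle using (ExcludedMiddle)
open import Data.Empty using (⊥; ⊥-elim)
open import Data.Fin using (Fin; zero; suc; toℕ)
import Data.Fin as Fin
open import Data.Fin.Patterns using (0F; 1F; 2F; 3F; 4F)
import Data.Fin.Properties as Finₚ
open import Data.Integer using (ℤ; +_; _⊖_)
import Data.Integer as ℤ
import Data.Integer.Properties as ℤₚ
open import Data.List using (List; []; _∷_; [_]; _++_; _∷ʳ_; applyUpTo; length; map; replicate; initLast; _∷ʳ′_)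
import Data.List.Properties as Listₚ
open import Data.List.Membership.Propositional.Properties using (∈-∃++)
import Data.List.Relation.Binary.Lex.Strict as Lex
open import Data.List.Relation.Binary.Lex.Strict using (Lex-<; this; next)
import Data.List.Relation.Binary.Pointwise as Pointwise
open import Data.List.Relation.Unary.All using (All; []; _∷_)
import Data.List.Relation.Unary.All as All
import Data.List.Relation.Unary.All.Properties as Allₚ
open import Data.List.Relation.Unary.AllPairs using (AllPairs; []; _∷_)
import Data.List.Relation.Unary.AllPairs.Properties as AllPairsₚ
open import Data.List.Relation.Unary.Any using (Any; here; there)
import Data.List.Relation.Unary.Any.Properties as Anyₚ
open import Data.Nat using (ℕ; zero; suc; z≤n; s≤s)
import Data.Nat as ℕ
import Data.Nat.Properties as ℕₚ
open import Data.Nat.Solver using () renaming (module +-*-Solver to ℕ-Solver)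
open import Data.Product using (Σ; ∃; _×_; _,_; proj₁; proj₂)
open import Data.Rational using (ℚ; 0ℚ; 1ℚ; ½; ∣_∣; positive; nonNegative; _/_; mkℚ; ↥_; ↧ₙ_; toℚᵘ)
import Data.Rational as ℚ
import Data.Rational.Properties as ℚₚ
open import Data.Rational.Solver using () renaming (module +-*-Solver to ℚ-Solver)
open import Data.Rational.Unnormalised using (mkℚᵘ; *≡*)
import Data.Rational.Unnormalised as ℚᵘ
import Data.Rational.Unnormalised.Properties as ℚᵘₚ
open import Data.Sum using (_⊎_; inj₁; inj₂)
import Data.Sum as Sum
open import Data.Unit using (⊤; tt)
open import Data.Vec using (Vec; []; _∷_; lookup)
import Data.Vec as Vec
open import Data.Vec.Relation.Unary.All using ([]; _∷_) renaming (All to Allⱽ)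
open import Function using (_⇔_; _∋_; _∘_; mk⇔; Equivalence)
open import Relation.Binary.Definitions using (tri<; tri≈; tri>)
open import Relation.Binary.PropositionalEquality
  using (_≡_; refl; sym; trans; cong; cong₂; subst; subst₂; isEquivalence; resp₂; module ≡-Reasoning)
open import Relation.Nullary using (¬_; Dec; yes; no; contradiction)
open import Relation.Unary using (Pred; _∈_; _≐_; _≬_; _⊆_; ⋂; Satisfiable)
open import Defs

-- The digits of the leftmost path sit at positions of the code that depend on earlier letters,
-- since every 2 adds a node to the later levels. The letters in between only move these positions,
-- and their weights sum to 1, so they drop out of the capacity; 0 and 2 both send the path left, so
-- `b₀` drops out too. That every code belongs to a closed set needs a construction, and that the
-- leftmost path depends on the code alone needs uniqueness of the enumeration of a tree. Capacities
-- and `qs` are reals known by approximation and cannot be compared exactly. The search therefore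
-- needs a genuine gap `lo n < hi n` with `lo n < 1`, and tests rational approximations with a
-- margin. If two consecutive `qs` coincide, the sandwich prescribes a capacity exactly, although
-- clopen sets have only countably many capacities; if `qs 1 > 1`, no capacity is large enough.
-- Hence the conditions on the sandwich. Where they fail and `q < 1`, the window is instead widened
-- upwards by `2⁻ n`. Excluded middle settles which case holds, and each case has its own program.

open Equivalence using (to; from)

-- Strings and sequences

length-∷ʳ : ∀ {A : Set} (σ : List A) i → length (σ ∷ʳ i) ≡ suc (length σ)
length-∷ʳ σ i = trans (Listₚ.length-++ σ) (ℕₚ.+-comm (length σ) 1)

⊏-++ˡ : ∀ {A : Set} (σ : List A) {τ} {x : ℕ → A} → σ ++ τ ⊏ x → σ ⊏ x
⊏-++ˡ []      _ = refl
⊏-++ˡ (i ∷ σ) p = cong₂ _∷_ (Listₚ.∷-injectiveˡ p) (⊏-++ˡ σ (Listₚ.∷-injectiveʳ p))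

⊏-∷ʳ : ∀ {A : Set} (σ : List A) {i} {x : ℕ → A} → σ ∷ʳ i ⊏ x ⇔ (σ ⊏ x × x (length σ) ≡ i)
⊏-∷ʳ σ {i} {x} = mk⇔
  (λ p → Listₚ.∷ʳ-injective _ σ (trans (Listₚ.applyUpTo-∷ʳ x (length σ)) (subst (λ n → applyUpTo x n ≡ σ ∷ʳ i) (length-∷ʳ σ i) p)))
  (λ (p , q) → trans (cong (applyUpTo x) (length-∷ʳ σ i))
     (trans (sym (Listₚ.applyUpTo-∷ʳ x (length σ))) (cong₂ _∷ʳ_ p q)))

applyUpTo-⊏ : ∀ {A : Set} (x : ℕ → A) n → applyUpTo x n ⊏ x
applyUpTo-⊏ x n = cong (applyUpTo x) (Listₚ.length-applyUpTo x n)

applyUpTo-+ : ∀ {A : Set} (x : ℕ → A) m n → applyUpTo x (m ℕ.+ n) ≡ applyUpTo x m ++ applyUpTo (λ i → x (m ℕ.+ i)) n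
applyUpTo-+ x zero    n = refl
applyUpTo-+ x (suc m) n = cong (x 0 ∷_) (applyUpTo-+ (x ∘ suc) m n)

infixr 5 _▹_

_▹_ : String → Cantor → Cantor
([]    ▹ y) n       = y n
((i ∷ σ) ▹ y) zero    = i
((i ∷ σ) ▹ y) (suc n) = (σ ▹ y) n

applyUpTo-▹ : ∀ σ y n → applyUpTo (σ ▹ y) (length σ ℕ.+ n) ≡ σ ++ applyUpTo y n
applyUpTo-▹ []      y n = refl
applyUpTo-▹ (i ∷ σ) y n = cong (i ∷_) (applyUpTo-▹ σ y n)

≺-irrefl : ∀ {σ} → ¬ σ ≺ σ
≺-irrefl (inj₁ l)       = ℕₚ.<-irrefl refl l
≺-irrefl (inj₂ (_ , l)) = Lex.<-irreflexive Finₚ.<-irrefl (Pointwise.refl refl) l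

≺⇒≢ : ∀ {σ τ} → σ ≺ τ → ¬ σ ≡ τ
≺⇒≢ {σ} l refl = ≺-irrefl {σ} l

≺-trans : ∀ {σ τ ρ} → σ ≺ τ → τ ≺ ρ → σ ≺ ρ
≺-trans (inj₁ l)       (inj₁ m)       = inj₁ (ℕₚ.<-trans l m)
≺-trans (inj₁ l)       (inj₂ (e , _)) = inj₁ (subst (_ ℕ.<_) e l)
≺-trans (inj₂ (e , _)) (inj₁ m)       = inj₁ (subst (ℕ._< _) (sym e) m)
≺-trans (inj₂ (e , l)) (inj₂ (f , m)) =
  inj₂ (trans e f , Lex.<-transitive isEquivalence (resp₂ Fin._<_) Finₚ.<-trans l m)

≺-∷ʳ : ∀ {σ τ} i j → σ ≺ τ → σ ∷ʳ i ≺ τ ∷ʳ j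
≺-∷ʳ {σ} {τ} i j (inj₁ l) =
  inj₁ (subst₂ ℕ._<_ (sym (length-∷ʳ σ i)) (sym (length-∷ʳ τ j)) (s≤s l))
≺-∷ʳ {σ} {τ} i j (inj₂ (e , l)) =
  inj₂ (trans (length-∷ʳ σ i) (trans (cong suc e) (sym (length-∷ʳ τ j))) , extend e l)
  where
  extend : ∀ {σ τ} → length σ ≡ length τ → Lex-< _≡_ Fin._<_ σ τ → Lex-< _≡_ Fin._<_ (σ ∷ʳ i) (τ ∷ʳ j)
  extend e (this l)   = this l
  extend e (next p l) = next p (extend (ℕₚ.suc-injective e) l)
  extend () Lex.halt
  extend e (Lex.base ())

≺-child : ∀ σ i → σ ≺ σ ∷ʳ i
≺-child σ i = inj₁ (ℕₚ.≤-reflexive (sym (length-∷ʳ σ i)))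

≺-siblings : ∀ σ → σ ∷ʳ 0F ≺ σ ∷ʳ 1F
≺-siblings σ = inj₂ (trans (length-∷ʳ σ 0F) (sym (length-∷ʳ σ 1F)) , go σ)
  where
  go : ∀ σ → Lex-< _≡_ Fin._<_ (σ ∷ʳ 0F) (σ ∷ʳ 1F)
  go []      = this (s≤s z≤n)
  go (i ∷ σ) = next refl (go σ)

⊀[] : ∀ {σ} → ¬ σ ≺ []
⊀[] (inj₂ (_ , l)) = Lex.xs≮[] l

-- Enumerations of trees

Allows : Fin 3 → Fin 2 → Set
Allows 0F 0F = ⊤
Allows 0F 1F = ⊥
Allows 1F 0F = ⊥
Allows 1F 1F = ⊤
Allows 2F i  = ⊤

Branching⇒Allows : ∀ {T σ} c i → Branching T σ c → σ ∷ʳ i ∈ T ⇔ Allows c i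
Branching⇒Allows 0F 0F (p , q) = mk⇔ _ (λ _ → p)
Branching⇒Allows 0F 1F (p , q) = mk⇔ q ⊥-elim
Branching⇒Allows 1F 0F (p , q) = mk⇔ p ⊥-elim
Branching⇒Allows 1F 1F (p , q) = mk⇔ _ (λ _ → q)
Branching⇒Allows 2F 0F (p , q) = mk⇔ _ (λ _ → p)
Branching⇒Allows 2F 1F (p , q) = mk⇔ _ (λ _ → q)

Allows⇒Branching : ∀ {T σ} c → (∀ i → σ ∷ʳ i ∈ T ⇔ Allows c i) → Branching T σ c
Allows⇒Branching 0F f = from (f 0F) tt , to (f 1F)
Allows⇒Branching 1F f = to (f 0F) , from (f 1F) tt
Allows⇒Branching 2F f = from (f 0F) tt , from (f 1F) tt

Increasing : (ℕ → String) → Set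
Increasing σ = ∀ n → σ n ≺ σ (suc n)

module _ {σ : ℕ → String} (inc : Increasing σ) where

  increasing-< : ∀ {m n} → m ℕ.< n → σ m ≺ σ n
  increasing-< {m} {suc n} (s≤s m≤n) with ℕₚ.m≤n⇒m<n∨m≡n m≤n
  ... | inj₁ m<n  = ≺-trans (increasing-< m<n) (inc n)
  ... | inj₂ refl = inc n

  increasing-≤ : ∀ {m n} → m ℕ.≤ n → σ m ≡ σ n ⊎ σ m ≺ σ n
  increasing-≤ m≤n with ℕₚ.m≤n⇒m<n∨m≡n m≤n
  ... | inj₁ m<n  = inj₂ (increasing-< m<n)
  ... | inj₂ refl = inj₁ refl

  increasing-reflects-< : ∀ {m n} → σ m ≺ σ n → m ℕ.< n
  increasing-reflects-< {m} {n} l with ℕₚ.<-≤-connex m n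
  ... | inj₁ m<n = m<n
  ... | inj₂ n≤m with increasing-≤ n≤m
  ...   | inj₁ e = contradiction (sym e) (≺⇒≢ l)
  ...   | inj₂ g = contradiction refl (≺⇒≢ (≺-trans {σ m} {σ n} l g))

  increasing-injective : ∀ {m n} → σ m ≡ σ n → m ≡ n
  increasing-injective {m} {n} e with ℕₚ.<-cmp m n
  ... | tri< l _ _ = contradiction e (≺⇒≢ (increasing-< l))
  ... | tri≈ _ p _ = p
  ... | tri> _ _ l = contradiction (sym e) (≺⇒≢ (increasing-< l))

record Enumeration (T : Pred String 0ℓ) (x : Code) : Set where
  field
    string     : ℕ → String
    increasing : Increasing string
    range      : ∀ τ → τ ∈ T ⇔ (∃ λ n → string n ≡ τ)
    branching  : ∀ n → Branching T (string n) (x n)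
    root       : [] ∈ T
    parent     : ∀ τ i → τ ∷ʳ i ∈ T → τ ∈ T

  string-∈ : ∀ n → string n ∈ T
  string-∈ n = from (range (string n)) (n , refl)

  first : string 0 ≡ []
  first with to (range []) root
  ... | zero  , e = e
  ... | suc l , e = contradiction (subst (string l ≺_) e (increasing l)) ⊀[]

  -- The parent lies in `T`, so it is listed, and being shorter it is listed earlier. Hence what can
  -- come next is governed by the strings and letters up to index `n`.
  origin : ∀ n → ∃ λ m → ∃ λ i → m ℕ.≤ n × string (suc n) ≡ string m ∷ʳ i × Allows (x m) i
  origin n with string (suc n) in eq | initLast (string (suc n))
  ... | .[]       | []      = contradiction (subst (string n ≺_) eq (increasing n)) ⊀[]
  ... | .(τ ∷ʳ i) | τ ∷ʳ′ i with to (range τ) (parent τ i (subst T eq (string-∈ (suc n))))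
  ...   | m , refl = m , i
    , ℕ.s≤s⁻¹ (increasing-reflects-< increasing (subst (string m ≺_) (sym eq) (≺-child (string m) i)))
    , refl
    , to (Branching⇒Allows (x m) i (branching m)) (subst T eq (string-∈ (suc n)))

open Enumeration

module _ {x : Code} where

  private
    -- The next string of `E′` is a permitted child of a string common to both, so `E` lists it as
    -- well, at an index beyond `n`. As `E` is increasing, its own next string cannot be larger.
    next-≼ : ∀ {T T′} (E : Enumeration T x) (E′ : Enumeration T′ x) n →
             (∀ m → m ℕ.≤ n → string E m ≡ string E′ m) →
             string E (suc n) ≡ string E′ (suc n) ⊎ string E (suc n) ≺ string E′ (suc n)
    next-≼ {T} E E′ n agree with origin E′ n
    ... | m , i , m≤n , e , a
        with to (range E (string E′ (suc n)))
               (subst T (trans (cong (_∷ʳ i) (agree m m≤n)) (sym e))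
                 (from (Branching⇒Allows (x m) i (branching E m)) a))
    ... | l , f with ℕₚ.≤-<-connex l n
    ...   | inj₁ l≤n = contradiction (trans (sym (agree l l≤n)) f)
              (≺⇒≢ (increasing-< (increasing E′) (s≤s l≤n)))
    ...   | inj₂ n<l = subst (λ τ → _ ≡ τ ⊎ _ ≺ τ) f (increasing-≤ (increasing E) n<l)

  -- Antisymmetry, from `next-≼` in both directions. Agreement is carried for all `m ≤ n` because
  -- the parent of the next string may be any earlier one.
  enumeration-unique : ∀ {T T′} (E : Enumeration T x) (E′ : Enumeration T′ x) →
                       ∀ n m → m ℕ.≤ n → string E m ≡ string E′ m
  enumeration-unique E E′ zero .zero z≤n = trans (first E) (sym (first E′))
  enumeration-unique E E′ (suc n) m m≤n with ℕₚ.m≤n⇒m<n∨m≡n m≤n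
  ... | inj₁ (s≤s m≤n′) = enumeration-unique E E′ n m m≤n′
  ... | inj₂ refl
      with next-≼ E E′ n (enumeration-unique E E′ n)
         | next-≼ E′ E n (λ m l → sym (enumeration-unique E E′ n m l))
  ...   | inj₁ e | _      = e
  ...   | inj₂ _ | inj₁ e = sym e
  ...   | inj₂ l | inj₂ g = contradiction refl (≺⇒≢ (≺-trans {string E (suc n)} l g))

  enumerated-⊆ : ∀ {T T′} → Enumeration T x → Enumeration T′ x → T ⊆ T′
  enumerated-⊆ E E′ {τ} t with to (range E τ) t
  ... | n , e = from (range E′ τ) (n , trans (sym (enumeration-unique E E′ n n ℕₚ.≤-refl)) e)

IsCode⇒Enumeration : ∀ {K x} → Satisfiable K → IsCode K x → Enumeration (Tree K) x
IsCode⇒Enumeration (y , y∈K) (σ , inc , ran , br) = record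
  { string     = σ
  ; increasing = inc
  ; range      = ran
  ; branching  = br
  ; root       = y , y∈K , refl
  ; parent     = λ { τ i (z , z∈K , p) → z , z∈K , ⊏-++ˡ τ p }
  }

-- The closed set with a given code, by breadth first search

bit : Fin 3 → Fin 2
bit 0F = 0F
bit 1F = 1F
bit 2F = 0F

bump : Fin 3 → ℕ → ℕ
bump 0F n = n
bump 1F n = n
bump 2F n = suc n

more : Fin 3 → String → List String
more 0F σ = []
more 1F σ = []
more 2F σ = [ σ ∷ʳ 1F ]

-- The state is the current node together with the nodes found but not yet visited, first in first
-- out. Every node has a child, so there always is a current node, which is kept apart from the
-- possibly empty list.
step : Fin 3 → String × List String → String × List String
step c (σ , [])     = σ ∷ʳ bit c , more c σ
step c (σ , ρ ∷ ρs) = ρ , ρs ++ σ ∷ʳ bit c ∷ more c σ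

module _ (x : Code) where

  -- The number of nodes waiting behind node `n`, as `length-rest` shows: a step removes one node
  -- and adds one or two, so only the letter 2 increases it.
  count : ℕ → ℕ
  count zero    = 0
  count (suc n) = bump (x n) (count n)

  -- The index of the first child of node `n`: it queues up behind the `count n` waiting nodes.
  next-level : ℕ → ℕ
  next-level n = suc (count n ℕ.+ n)

  -- The digits read off when descending from node `m` to the first child again and again; `path 0`
  -- is the leftmost path.
  path : ℕ → Cantor
  path m zero    = bit (x m)
  path m (suc n) = path (next-level m) n

  queue : ℕ → String × List String
  queue zero    = [] , []
  queue (suc n) = step (x n) (queue n)

  node : ℕ → String
  node n = proj₁ (queue n)

  rest : ℕ → List String
  rest n = proj₂ (queue n)

  node-visited : ∀ n pre {τ post} → rest n ≡ pre ++ τ ∷ post → node (suc (length pre ℕ.+ n)) ≡ τ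
  node-visited n pre e with queue n in eq
  node-visited n []        refl | σ , _ = cong (proj₁ ∘ step (x n)) eq
  node-visited n (ρ ∷ pre) {τ} {post} refl | σ , _ =
    trans (cong (node ∘ suc) (sym (ℕₚ.+-suc (length pre) n)))
      (node-visited (suc n) pre (trans (cong (proj₂ ∘ step (x n)) eq)
        (Listₚ.++-assoc pre (τ ∷ post) _)))

  length-rest : ∀ n → length (rest n) ≡ count n
  length-rest zero    = refl
  length-rest (suc n) = trans (grow (x n) (queue n)) (cong (bump (x n)) (length-rest n))
    where
    grow : ∀ c q → length (proj₂ (step c q)) ≡ bump c (length (proj₂ q))
    grow 0F (σ , [])     = refl
    grow 1F (σ , [])     = refl
    grow 2F (σ , [])     = refl
    grow 0F (σ , ρ ∷ ρs) = length-∷ʳ ρs _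
    grow 1F (σ , ρ ∷ ρs) = length-∷ʳ ρs _
    grow 2F (σ , ρ ∷ ρs) = trans (Listₚ.length-++ ρs) (ℕₚ.+-comm (length ρs) 2)

  node-next-level : ∀ n → node (next-level n) ≡ node n ∷ʳ bit (x n)
  node-next-level n = trans (cong (λ k → node (suc (k ℕ.+ n))) (sym (length-rest n))) go
    where
    go : node (suc (length (rest n) ℕ.+ n)) ≡ node n ∷ʳ bit (x n)
    go with queue n in eq
    ... | σ , []     = cong (proj₁ ∘ step (x n)) eq
    ... | σ , ρ ∷ ρs = trans (cong (node ∘ suc) (sym (ℕₚ.+-suc (length ρs) n)))
            (node-visited (suc n) ρs (cong (proj₂ ∘ step (x n)) eq))

  queue-children : ∀ n i → Allows (x n) i → Any (node n ∷ʳ i ≡_) (node (suc n) ∷ rest (suc n))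
  queue-children n i = go (x n) i (queue n)
    where
    member : ∀ c i σ → Allows c i → Any (σ ∷ʳ i ≡_) (σ ∷ʳ bit c ∷ more c σ)
    member 0F 0F σ _  = here refl
    member 0F 1F σ ()
    member 1F 0F σ ()
    member 1F 1F σ _  = here refl
    member 2F 0F σ _  = here refl
    member 2F 1F σ _  = there (here refl)
    go : ∀ c i q → Allows c i →
         Any (proj₁ q ∷ʳ i ≡_) (proj₁ (step c q) ∷ proj₂ (step c q))
    go c i (σ , [])     a = member c i σ a
    go c i (σ , ρ ∷ ρs) a = there (Anyₚ.++⁺ʳ ρs (member c i σ a))

  queue-visited : ∀ n {τ} → Any (τ ≡_) (node n ∷ rest n) → ∃ λ m → node m ≡ τ
  queue-visited n (here e)  = n , sym e
  queue-visited n (there p) with ∈-∃++ p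
  ... | pre , post , e = suc (length pre ℕ.+ n) , node-visited n pre e

  private
    -- The second component says that children of the current node may be appended at the end.
    -- Sortedness alone would not be preserved by `step`.
    Ordered : String × List String → Set
    Ordered (σ , ρs) = AllPairs _≺_ (σ ∷ ρs) × All (λ τ → ∀ i → τ ≺ σ ∷ʳ i) ρs

    children-sorted : ∀ c σ → AllPairs _≺_ (σ ∷ʳ bit c ∷ more c σ)
    children-sorted 0F σ = [] ∷ []
    children-sorted 1F σ = [] ∷ []
    children-sorted 2F σ = (≺-siblings σ ∷ []) ∷ [] ∷ []

    children-All : ∀ {P : String → Set} c σ → (∀ i → P (σ ∷ʳ i)) → All P (σ ∷ʳ bit c ∷ more c σ)
    children-All 0F σ p = p 0F ∷ []
    children-All 1F σ p = p 1F ∷ []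
    children-All 2F σ p = p 0F ∷ p 1F ∷ []

    step-ordered : ∀ c q → Ordered q → Ordered (step c q)
    step-ordered c (σ , [])     _ =
      children-sorted c σ , All.tail (children-All c σ λ i j → inj₁ (child-level i j))
      where
      child-level : ∀ i j → length (σ ∷ʳ i) ℕ.< length ((σ ∷ʳ bit c) ∷ʳ j)
      child-level i j = ℕₚ.≤-reflexive (trans (cong suc (trans (length-∷ʳ σ i) (sym (length-∷ʳ σ (bit c)))))
        (sym (length-∷ʳ (σ ∷ʳ bit c) j)))
    step-ordered c (σ , ρ ∷ ρs) ((σ≺ρ ∷ _) ∷ ρ≺ρs ∷ sorted , ρ≺ ∷ ρs≺) =
        AllPairsₚ.++⁺ (ρ≺ρs ∷ sorted) (children-sorted c σ)
          (All.map (children-All c σ) (ρ≺ ∷ ρs≺))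
      -- As `σ ≺ ρ`, the children of `σ` precede those of `ρ`. So both the old entries and the ones
      -- just appended precede the children of the new current node.
      , Allₚ.++⁺ (All.map (λ l i → ≺-trans (l i) (≺-∷ʳ i i σ≺ρ)) ρs≺)
          (children-All c σ λ i j → ≺-∷ʳ i j σ≺ρ)

    queue-ordered : ∀ n → Ordered (queue n)
    queue-ordered zero    = ([] ∷ []) , []
    queue-ordered (suc n) = step-ordered (x n) (queue n) (queue-ordered n)

  node-increasing : Increasing node
  node-increasing n with queue n | queue-ordered n
  ... | σ , []     | _                  = ≺-child σ (bit (x n))
  ... | σ , ρ ∷ ρs | (σ≺ρ ∷ _) ∷ _ , _ = σ≺ρ

  private
    Born : String → Set
    Born τ = τ ≡ [] ⊎ ∃ λ m → ∃ λ i → Allows (x m) i × τ ≡ node m ∷ʳ i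

    queue-born : ∀ n → All Born (node n ∷ rest n)
    queue-born zero    = inj₁ refl ∷ []
    queue-born (suc n) = go (queue n) (queue-born n) (λ i a → inj₂ (n , i , a , refl))
      where
      born-children : ∀ c σ → (∀ i → Allows c i → Born (σ ∷ʳ i)) → All Born (σ ∷ʳ bit c ∷ more c σ)
      born-children 0F σ f = f 0F tt ∷ []
      born-children 1F σ f = f 1F tt ∷ []
      born-children 2F σ f = f 0F tt ∷ f 1F tt ∷ []
      go : ∀ q → All Born (proj₁ q ∷ proj₂ q) → (∀ i → Allows (x n) i → Born (proj₁ q ∷ʳ i)) →
           All Born (proj₁ (step (x n) q) ∷ proj₂ (step (x n) q))
      go (σ , [])     _            f = born-children (x n) σ f
      go (σ , ρ ∷ ρs) (_ ∷ b ∷ bs) f = b ∷ Allₚ.++⁺ bs (born-children (x n) σ f)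

  Nodes : Pred String 0ℓ
  Nodes τ = ∃ λ n → node n ≡ τ

  private
    nodes-origin : ∀ τ i → τ ∷ʳ i ∈ Nodes → ∃ λ m → Allows (x m) i × node m ≡ τ
    nodes-origin τ i (n , e) with queue-born n
    ... | inj₁ e′ ∷ _ = contradiction (trans (sym e) e′) (++-∷≢[] τ)
      where
      ++-∷≢[] : ∀ τ → ¬ τ ∷ʳ i ≡ []
      ++-∷≢[] []      ()
      ++-∷≢[] (_ ∷ _) ()
    ... | inj₂ (m , j , a , e′) ∷ _ with Listₚ.∷ʳ-injective τ (node m) (trans (sym e) e′)
    ...   | refl , refl = m , a , refl

  -- A string enters the queue only as a permitted child of some node. Nodes do not repeat, so that
  -- node is the one with index `n`, and the letter that permitted the child is `x n`.
  nodes-branching : ∀ n i → node n ∷ʳ i ∈ Nodes ⇔ Allows (x n) i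
  nodes-branching n i = mk⇔
    (λ t → let m , a , e = nodes-origin (node n) i t in
           subst (λ k → Allows (x k) i) (increasing-injective node-increasing e) a)
    (λ a → queue-visited (suc n) (queue-children n i a))

  nodes-enumeration : Enumeration Nodes x
  nodes-enumeration = record
    { string     = node
    ; increasing = node-increasing
    ; range      = λ τ → mk⇔ (λ t → t) (λ t → t)
    ; branching  = λ n → Allows⇒Branching (x n) (nodes-branching n)
    ; root       = 0 , refl
    ; parent     = λ τ i t → let m , _ , e = nodes-origin τ i t in m , e
    }

  nodes-isTree : IsTree Nodes
  nodes-isTree σ []      t = subst Nodes (Listₚ.++-identityʳ σ) t
  nodes-isTree σ (i ∷ τ) t =
    parent nodes-enumeration σ i (nodes-isTree (σ ∷ʳ i) τ (subst Nodes (sym (Listₚ.∷ʳ-++ σ i τ)) t))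

  path-node : ∀ m n → ∃ λ k → node k ≡ node m ++ applyUpTo (path m) n × path m n ≡ bit (x k)
  path-node m zero    = m , sym (Listₚ.++-identityʳ (node m)) , refl
  path-node m (suc n) with path-node (next-level m) n
  ... | k , e , f = k , trans e (trans (cong (_++ applyUpTo (path (next-level m)) n) (node-next-level m))
                         (Listₚ.∷ʳ-++ (node m) (bit (x m)) _)) , f

  closedSet : Pred Cantor 0ℓ
  closedSet = Paths Nodes

  -- There are no dead ends: a node is continued by first children. The prefix of length `n` is a
  -- prefix of a node that lies `n` levels below node `m`, and `Nodes` is a tree.
  closedSet-▹ : ∀ m → (node m ▹ path m) ∈ closedSet
  closedSet-▹ m n = nodes-isTree _ _ (subst Nodes
    (trans (sym (applyUpTo-▹ (node m) (path m) n))
      (trans (cong (applyUpTo (node m ▹ path m)) (ℕₚ.+-comm (length (node m)) n))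
             (applyUpTo-+ (node m ▹ path m) n (length (node m)))))
    (let k , e , _ = path-node m n in k , e))

  path-∈ : path 0 ∈ closedSet
  path-∈ n = let k , e , _ = path-node 0 n in k , e

  Tree-closedSet : ∀ τ → τ ∈ Tree closedSet ⇔ τ ∈ Nodes
  Tree-closedSet τ = mk⇔
    (λ { (y , y∈ , p) → subst Nodes p (y∈ (length τ)) })
    (λ { (m , refl) → node m ▹ path m , closedSet-▹ m ,
         (trans (cong (applyUpTo (node m ▹ path m)) (sym (ℕₚ.+-identityʳ (length (node m)))))
           (trans (applyUpTo-▹ (node m) (path m) 0) (Listₚ.++-identityʳ (node m)))) })

  closedSet-isClosed : IsClosed closedSet
  closedSet-isClosed y meets n = to (Tree-closedSet _) (meets n)

  closedSet-isCode : IsCode closedSet x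
  closedSet-isCode = node , node-increasing
    , (λ τ → Tree-closedSet τ)
    , (λ n → Allows⇒Branching (x n) λ i → mk⇔
        (λ t → to (nodes-branching n i) (to (Tree-closedSet _) t))
        (λ a → from (Tree-closedSet _) (from (nodes-branching n i) a)))

-- Lexicographic order and leftmost paths

infix 4 _≤ₗₑₓ_

-- Phrased without a first point of difference, so that no decision whether two sequences are equal
-- is called for.
_≤ₗₑₓ_ : Cantor → Cantor → Set
y ≤ₗₑₓ z = ∀ n → applyUpTo y n ≡ applyUpTo z n → y n Fin.≤ z n

path-least : ∀ x {y} → y ∈ closedSet x → path x 0 ≤ₗₑₓ y
path-least x {y} y∈ n e with path-node x 0 n
... | k , f , g = subst (Fin._≤ y n) (sym g) (bit-least (x k) (y n)
    (to (nodes-branching x k (y n)) (subst (Nodes x)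
      (trans (sym (Listₚ.applyUpTo-∷ʳ y n)) (cong (_∷ʳ y n) (trans (sym e) (sym f)))) (y∈ (suc n)))))
  where
  bit-least : ∀ c i → Allows c i → bit c Fin.≤ i
  bit-least 0F i  _ = z≤n
  bit-least 1F 1F _ = s≤s z≤n
  bit-least 2F i  _ = z≤n

-- Left to right, `closedSet x` is a set with code `x` that contains its own leftmost path.
-- Conversely, if `K` has code `x`, uniqueness of enumerations puts all prefixes of its points among
-- the nodes of `x`. The leftmost path is then below any point of `K` in `Q`, and `Q` is closed
-- downwards.
CodesMeeting-initial : ∀ (Q : Pred Cantor 0ℓ) → (∀ {y z} → y ≤ₗₑₓ z → z ∈ Q → y ∈ Q) →
                       (λ x → path x 0 ∈ Q) ≐ CodesMeeting Q
CodesMeeting-initial Q down =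
    (λ {x} p → closedSet x , (path x 0 , path-∈ x) , closedSet-isClosed x
             , (path x 0 , path-∈ x , p) , closedSet-isCode x)
  , (λ { {x} (K , sat , closed , (y , y∈K , y∈Q) , code) → down
       (path-least x λ n → enumerated-⊆ (IsCode⇒Enumeration sat code) (nodes-enumeration x)
                             (y , y∈K , applyUpTo-⊏ y n))
       y∈Q })

-- Lexicographic initial segments

-- Sequences extending the string are not below it, so the all-ones sequence is never in such a
-- segment; appending zeros to the string changes nothing.
Below : String → Pred Cantor 0ℓ
Below []      y = ⊥
Below (c ∷ σ) y = y 0 Fin.< c ⊎ (y 0 ≡ c × Below σ (y ∘ suc))

Below-initial : ∀ σ {y z} → y ≤ₗₑₓ z → z ∈ Below σ → y ∈ Below σ
Below-initial (c ∷ σ) y≤z (inj₁ l) = inj₁ (ℕₚ.≤-<-trans (y≤z 0 refl) l)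
Below-initial (c ∷ σ) {y} {z} y≤z (inj₂ (refl , b)) with ℕₚ.m≤n⇒m<n∨m≡n (y≤z 0 refl)
... | inj₁ l = inj₁ l
... | inj₂ e = inj₂ (Finₚ.toℕ-injective e ,
        Below-initial σ (λ n p → y≤z (suc n) (cong₂ _∷_ (Finₚ.toℕ-injective e) p)) b)

Below-total : ∀ σ τ → Below σ ⊆ Below τ ⊎ Below τ ⊆ Below σ
Below-total []       τ        = inj₁ λ ()
Below-total (_ ∷ _)  []       = inj₂ λ ()
Below-total (c ∷ σ)  (e ∷ τ)  with Finₚ.<-cmp c e
... | tri< l _ _ = inj₁ λ { (inj₁ m) → inj₁ (Finₚ.<-trans m l) ; (inj₂ (refl , _)) → inj₁ l }
... | tri> _ _ l = inj₂ λ { (inj₁ m) → inj₁ (Finₚ.<-trans m l) ; (inj₂ (refl , _)) → inj₁ l }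
... | tri≈ _ refl _ with Below-total σ τ
...   | inj₁ f = inj₁ λ { (inj₁ m) → inj₁ m ; (inj₂ (p , b)) → inj₂ (p , f b) }
...   | inj₂ f = inj₂ λ { (inj₁ m) → inj₁ m ; (inj₂ (p , b)) → inj₂ (p , f b) }

-- Closure properties of the computable functions

Fun : ℕ → Set
Fun k = Vec ℕ k → ℕ

varᶜ : ∀ {k} (i : Fin k) → Computable (λ xs → lookup xs i)
varᶜ i = proj i , λ _ → ⇓proj

compᶜ : ∀ {j k} {f : Fun j} {gs : Vec (Fun k) j} → Computable f → Allⱽ Computable gs →
        Computable (λ xs → f (Vec.map (λ g → g xs) gs))
compᶜ {k = k} (p , h) hs = comp p (programs hs) , λ xs → ⇓comp (runs hs xs) (h _)
  where
  programs : ∀ {j} {gs : Vec (Fun k) j} → Allⱽ Computable gs → Vec (Rec k) j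
  programs []             = []
  programs ((p , _) ∷ hs) = p ∷ programs hs
  runs : ∀ {j} {gs : Vec (Fun k) j} (hs : Allⱽ Computable gs) xs → programs hs ⟨ xs ⟩⇓* Vec.map (λ g → g xs) gs
  runs []             xs = []
  runs ((_ , h) ∷ hs) xs = h xs ∷ runs hs xs

recᶜ : ∀ {k} (f : Fun (suc k)) {g : Fun k} {h : Fun (2 ℕ.+ k)} → Computable g → Computable h →
       (∀ xs → f (0 ∷ xs) ≡ g xs) → (∀ n xs → f (suc n ∷ xs) ≡ h (n ∷ f (n ∷ xs) ∷ xs)) → Computable f
recᶜ f (p , hg) (r , hh) f-zero f-suc = prec p r , λ { (n ∷ xs) → run n xs }
  where
  run : ∀ n xs → prec p r ⟨ n ∷ xs ⟩⇓ f (n ∷ xs)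
  run zero    xs = ⇓prec-zero (subst (p ⟨ xs ⟩⇓_) (sym (f-zero xs)) (hg xs))
  run (suc n) xs = ⇓prec-suc (run n xs) (subst (r ⟨ n ∷ f (n ∷ xs) ∷ xs ⟩⇓_) (sym (f-suc n xs)) (hh _))

least-zero : ∀ (f : ℕ → ℕ) n → f n ≡ 0 → ∃ λ m → f m ≡ 0 × (∀ i → i ℕ.< m → ∃ λ y → f i ≡ suc y)
least-zero f zero    e = zero , e , λ _ ()
least-zero f (suc n) e with f 0 in eq
... | zero  = 0 , eq , λ _ ()
... | suc y with least-zero (f ∘ suc) n e
...   | m , z , nz = suc m , z , λ { zero _ → y , eq ; (suc i) (s≤s l) → nz i l }

-- The given zeros need not be computable. They only bound the search for the least zero, which is
-- what `min` returns.
searchᶜ : ∀ {k} {f : Fun (suc k)} → Computable f → (∀ xs → ∃ λ n → f (n ∷ xs) ≡ 0) →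
          ∃ λ (m : Fun k) → Computable m × (∀ xs → f (m xs ∷ xs) ≡ 0)
searchᶜ {f = f} (p , h) total = (λ xs → proj₁ (found xs))
  , (min p , λ xs → let m , z , nz = found xs in
      ⇓min (subst (p ⟨ m ∷ xs ⟩⇓_) z (h (m ∷ xs)))
           (λ i i<m → proj₁ (nz i i<m) , subst (p ⟨ i ∷ xs ⟩⇓_) (proj₂ (nz i i<m)) (h (i ∷ xs))))
  , (λ xs → proj₁ (proj₂ (found xs)))
  where
  found : ∀ xs → _
  found xs = least-zero (λ n → f (n ∷ xs)) (proj₁ (total xs)) (proj₂ (total xs))

constᶜ : ∀ {k} n → Computable {k} (λ _ → n)
constᶜ zero    = zer , λ _ → ⇓zer
constᶜ (suc n) = comp succ (proj₁ (constᶜ n) ∷ []) , λ xs → ⇓comp (proj₂ (constᶜ n) xs ∷ []) ⇓succ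

module _ {k : ℕ} {f : Fun k} (fᶜ : Computable f) where

  sucᶜ : Computable (λ xs → suc (f xs))
  sucᶜ = comp succ (proj₁ fᶜ ∷ []) , λ xs → ⇓comp (proj₂ fᶜ xs ∷ []) ⇓succ

  predᶜ : Computable (λ xs → ℕ.pred (f xs))
  predᶜ = compᶜ {f = λ xs → ℕ.pred (lookup xs 0F)}
    (recᶜ _ (constᶜ 0) (varᶜ 0F) (λ _ → refl) (λ _ _ → refl)) (fᶜ ∷ [])

module _ {k : ℕ} {f g : Fun k} (fᶜ : Computable f) (gᶜ : Computable g) where

  infixl 6 _+ᶜ_ _∸ᶜ_

  _+ᶜ_ : Computable (λ xs → f xs ℕ.+ g xs)
  _+ᶜ_ = compᶜ {f = λ xs → lookup xs 0F ℕ.+ lookup xs 1F}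
    (recᶜ _ (varᶜ 0F) (sucᶜ (varᶜ 1F)) (λ _ → refl) (λ _ _ → refl)) (fᶜ ∷ gᶜ ∷ [])

  _∸ᶜ_ : Computable (λ xs → f xs ℕ.∸ g xs)
  _∸ᶜ_ = compᶜ {f = λ xs → lookup xs 1F ℕ.∸ lookup xs 0F}
    (recᶜ _ (varᶜ 0F) (predᶜ (varᶜ 1F)) (λ _ → refl) (λ n xs → sym (ℕₚ.pred[m∸n]≡m∸[1+n] (lookup xs 0F) n)))
    (gᶜ ∷ fᶜ ∷ [])

infixl 7 _*ᶜ_

_*ᶜ_ : ∀ {k} {f g : Fun k} → Computable f → Computable g → Computable (λ xs → f xs ℕ.* g xs)
fᶜ *ᶜ gᶜ = compᶜ {f = λ xs → lookup xs 0F ℕ.* lookup xs 1F}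
  (recᶜ _ (constᶜ 0) (varᶜ 2F +ᶜ varᶜ 1F) (λ _ → refl) (λ _ _ → refl)) (fᶜ ∷ gᶜ ∷ [])

infixr 8 _^ᶜ_

_^ᶜ_ : ∀ {k} {f g : Fun k} → Computable f → Computable g → Computable (λ xs → f xs ℕ.^ g xs)
fᶜ ^ᶜ gᶜ = compᶜ {f = λ xs → lookup xs 1F ℕ.^ lookup xs 0F}
  (recᶜ _ (constᶜ 1) (varᶜ 2F *ᶜ varᶜ 1F) (λ _ → refl) (λ _ _ → refl)) (gᶜ ∷ fᶜ ∷ [])

-- Strings as numbers

flip : Fin 2 → Fin 2
flip 0F = 1F
flip 1F = 0F

parity : ℕ → Fin 2
parity zero    = 0F
parity (suc n) = flip (parity n)

half : ℕ → ℕ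
half zero    = 0
half (suc n) = half n ℕ.+ toℕ (parity n)

parityᶜ : ∀ {k} {f : Fun k} → Computable f → Computable (λ xs → toℕ (parity (f xs)))
parityᶜ fᶜ = compᶜ {f = λ xs → toℕ (parity (lookup xs 0F))}
  (recᶜ _ (constᶜ 0) (constᶜ 1 ∸ᶜ varᶜ 1F) (λ _ → refl) (λ n _ → toℕ-flip (parity n))) (fᶜ ∷ [])
  where
  toℕ-flip : ∀ i → toℕ (flip i) ≡ 1 ℕ.∸ toℕ i
  toℕ-flip 0F = refl
  toℕ-flip 1F = refl

halfᶜ : ∀ {k} {f : Fun k} → Computable f → Computable (λ xs → half (f xs))
halfᶜ fᶜ = compᶜ {f = λ xs → half (lookup xs 0F)}
  (recᶜ _ (constᶜ 0) (varᶜ 1F +ᶜ parityᶜ (varᶜ 0F)) (λ _ → refl) (λ _ _ → refl)) (fᶜ ∷ [])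

parity-+2* : ∀ (i : Fin 2) n → parity (toℕ i ℕ.+ 2 ℕ.* n) ≡ i
parity-+2* 0F zero    = refl
parity-+2* 1F zero    = refl
parity-+2* i  (suc n) = trans (cong parity (shift (toℕ i) n)) (trans (flip-flip _) (parity-+2* i n))
  where
  flip-flip : ∀ j → flip (flip j) ≡ j
  flip-flip 0F = refl
  flip-flip 1F = refl
  shift : ∀ m n → m ℕ.+ 2 ℕ.* suc n ≡ suc (suc (m ℕ.+ 2 ℕ.* n))
  shift = solve 2 (λ m n → m :+ con 2 :* (con 1 :+ n) := con 2 :+ (m :+ con 2 :* n)) refl
    where open ℕ-Solver

half-+2* : ∀ (i : Fin 2) n → half (toℕ i ℕ.+ 2 ℕ.* n) ≡ n
half-+2* 0F zero    = refl
half-+2* 1F zero    = refl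
half-+2* i  (suc n) = trans (cong half (shift (toℕ i) n))
  (trans (two (toℕ i ℕ.+ 2 ℕ.* n)) (cong suc (half-+2* i n)))
  where
  shift : ∀ m n → m ℕ.+ 2 ℕ.* suc n ≡ suc (suc (m ℕ.+ 2 ℕ.* n))
  shift = solve 2 (λ m n → m :+ con 2 :* (con 1 :+ n) := con 2 :+ (m :+ con 2 :* n)) refl
    where open ℕ-Solver
  opposite : ∀ j → toℕ j ℕ.+ toℕ (flip j) ≡ 1
  opposite 0F = refl
  opposite 1F = refl
  two : ∀ m → half (suc (suc m)) ≡ suc (half m)
  two m = trans (ℕₚ.+-assoc (half m) _ _) (trans (cong (half m ℕ.+_) (opposite (parity m))) (ℕₚ.+-comm (half m) 1))

-- Bijective base 2: the first digit of the string with code t is the parity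
-- of t - 1.  Codes that are exhausted keep producing the digit 0.
drop-digits : ℕ → ℕ → ℕ
drop-digits zero    t = t
drop-digits (suc j) t = half (ℕ.pred (drop-digits j t))

digit : ℕ → Cantor
digit t j = parity (ℕ.pred (drop-digits j t))

digitᶜ : ∀ {k} {f g : Fun k} → Computable f → Computable g → Computable (λ xs → toℕ (digit (f xs) (g xs)))
digitᶜ fᶜ gᶜ = parityᶜ (predᶜ (compᶜ {f = λ xs → drop-digits (lookup xs 0F) (lookup xs 1F)}
  (recᶜ _ (varᶜ 0F) (halfᶜ (predᶜ (varᶜ 1F))) (λ _ → refl) (λ _ _ → refl)) (gᶜ ∷ fᶜ ∷ [])))

zeros : Cantor
zeros _ = 0F

digit-codeString : ∀ σ j → digit (codeString σ) j ≡ (σ ▹ zeros) j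
digit-codeString []      j       = cong (parity ∘ ℕ.pred) (drop-zero j)
  where
  drop-zero : ∀ j → drop-digits j 0 ≡ 0
  drop-zero zero    = refl
  drop-zero (suc j) = cong (half ∘ ℕ.pred) (drop-zero j)
digit-codeString (i ∷ σ) zero    = parity-+2* i (codeString σ)
digit-codeString (i ∷ σ) (suc j) =
  trans (cong (parity ∘ ℕ.pred) (drop-one j)) (digit-codeString σ j)
  where
  drop-one : ∀ j → drop-digits (suc j) (codeString (i ∷ σ)) ≡ drop-digits j (codeString σ)
  drop-one zero    = half-+2* i (codeString σ)
  drop-one (suc j) = cong (half ∘ ℕ.pred) (drop-one j)

codeString-∷ʳ : ∀ σ i → codeString (σ ∷ʳ i) ≡ codeString σ ℕ.+ 2 ℕ.^ length σ ℕ.* suc (toℕ i)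
codeString-∷ʳ []      i = refl
codeString-∷ʳ (j ∷ σ) i = trans (cong (λ c → suc (toℕ j) ℕ.+ 2 ℕ.* c) (codeString-∷ʳ σ i))
  (solve 4 (λ j c p i → con 1 :+ j :+ con 2 :* (c :+ p :* (con 1 :+ i)) :=
                      con 1 :+ j :+ con 2 :* c :+ (con 2 :* p) :* (con 1 :+ i)) refl
     (toℕ j) (codeString σ) (2 ℕ.^ length σ) (toℕ i))
  where open ℕ-Solver

codeString-++-≤ : ∀ σ τ → codeString σ ℕ.≤ codeString (σ ++ τ)
codeString-++-≤ []      τ = z≤n
codeString-++-≤ (i ∷ σ) τ = ℕₚ.+-monoʳ-≤ (suc (toℕ i)) (ℕₚ.*-monoʳ-≤ 2 (codeString-++-≤ σ τ))

length≤codeString : ∀ σ → length σ ℕ.≤ codeString σ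
length≤codeString []      = z≤n
length≤codeString (i ∷ σ) = s≤s (ℕₚ.≤-trans (length≤codeString σ)
  (ℕₚ.≤-trans (ℕₚ.m≤m+n (codeString σ) (codeString σ ℕ.+ 0)) (ℕₚ.m≤n+m (2 ℕ.* codeString σ) (toℕ i))))

-- A conditional on a bit `b`, in arithmetic form so that its computability follows from that of
-- sums and products.
choose : ℕ → ℕ → ℕ → ℕ
choose b m n = b ℕ.* m ℕ.+ (1 ℕ.∸ b) ℕ.* n

choose-0 : ∀ m n → choose 0 m n ≡ n
choose-0 m n = ℕₚ.*-identityˡ n

choose-1 : ∀ m n → choose 1 m n ≡ m
choose-1 m n = trans (ℕₚ.+-identityʳ (1 ℕ.* m)) (ℕₚ.*-identityˡ m)

chooseᶜ : ∀ {k} {f g h : Fun k} → Computable f → Computable g → Computable h →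
          Computable (λ xs → choose (f xs) (g xs) (h xs))
chooseᶜ fᶜ gᶜ hᶜ = fᶜ *ᶜ gᶜ +ᶜ (constᶜ 1 ∸ᶜ fᶜ) *ᶜ hᶜ

-- Initial segments as clopen sets

Below-∷ʳ-0 : ∀ σ {x} → x ∈ Below (σ ∷ʳ 0F) ⇔ x ∈ Below σ
Below-∷ʳ-0 []      = mk⇔ (λ { (inj₁ ()) ; (inj₂ (_ , ())) }) λ ()
Below-∷ʳ-0 (i ∷ σ) = mk⇔
  (λ { (inj₁ l) → inj₁ l ; (inj₂ (e , b)) → inj₂ (e , to (Below-∷ʳ-0 σ) b) })
  (λ { (inj₁ l) → inj₁ l ; (inj₂ (e , b)) → inj₂ (e , from (Below-∷ʳ-0 σ) b) })

Below-∷ʳ-1 : ∀ σ {x} → x ∈ Below (σ ∷ʳ 1F) ⇔ (σ ∷ʳ 0F ⊏ x ⊎ x ∈ Below σ)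
Below-∷ʳ-1 [] {x} = mk⇔
  (λ { (inj₁ l) → inj₁ (cong (_∷ []) (Finₚ.toℕ-injective (ℕₚ.n<1⇒n≡0 l))) ; (inj₂ (_ , ())) })
  (λ { (inj₁ e) → inj₁ (subst (λ (i : Fin 2) → i Fin.< (Fin 2 ∋ 1F)) (sym (Listₚ.∷-injectiveˡ e)) (s≤s z≤n)) ; (inj₂ ()) })
Below-∷ʳ-1 (i ∷ σ) = mk⇔
  (λ { (inj₁ l) → inj₂ (inj₁ l)
     ; (inj₂ (e , b)) → Sum.map (cong₂ _∷_ e) (λ b′ → inj₂ (e , b′)) (to (Below-∷ʳ-1 σ) b) })
  (λ { (inj₁ p) → inj₂ (Listₚ.∷-injectiveˡ p , from (Below-∷ʳ-1 σ) (inj₁ (Listₚ.∷-injectiveʳ p)))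
     ; (inj₂ (inj₁ l)) → inj₁ l
     ; (inj₂ (inj₂ (e , b))) → inj₂ (e , from (Below-∷ʳ-1 σ) (inj₂ b)) })

module _ (s : Cantor) where

  -- A sequence below a prefix of `s` leaves it to the left at a position where `s` has the digit 1;
  -- each such position contributes one cylinder.
  segment : ℕ → Clopen
  segment zero    = []
  segment (suc i) with s i
  ... | 0F = segment i
  ... | 1F = (applyUpTo s i ∷ʳ 0F) ∷ segment i

  segment-⇔ : ∀ i {x} → x ∈ ⟦ segment i ⟧ᶜ ⇔ x ∈ Below (applyUpTo s i)
  segment-⇔ zero    = mk⇔ (λ ()) (λ ())
  segment-⇔ (suc i) {x} with s i in eq
  ... | 0F = subst (λ σ → x ∈ ⟦ segment i ⟧ᶜ ⇔ x ∈ Below σ) (trans (cong (applyUpTo s i ∷ʳ_) (sym eq)) (Listₚ.applyUpTo-∷ʳ s i)) (mk⇔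
    (λ a → from (Below-∷ʳ-0 (applyUpTo s i)) (to (segment-⇔ i) a))
    (λ b → from (segment-⇔ i) (to (Below-∷ʳ-0 (applyUpTo s i)) b)))
  ... | 1F = subst (λ σ → x ∈ ⟦ (applyUpTo s i ∷ʳ 0F) ∷ segment i ⟧ᶜ ⇔ x ∈ Below σ) (trans (cong (applyUpTo s i ∷ʳ_) (sym eq)) (Listₚ.applyUpTo-∷ʳ s i)) (mk⇔
    (λ { (here p)  → from (Below-∷ʳ-1 (applyUpTo s i)) (inj₁ p)
       ; (there a) → from (Below-∷ʳ-1 (applyUpTo s i)) (inj₂ (to (segment-⇔ i) a)) })
    (λ b → join (to (Below-∷ʳ-1 (applyUpTo s i)) b)))
    where
    join : applyUpTo s i ∷ʳ 0F ⊏ x ⊎ x ∈ Below (applyUpTo s i) →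
           Any (λ σ → x ∈ I σ) ((applyUpTo s i ∷ʳ 0F) ∷ segment i)
    join (inj₁ p) = here p
    join (inj₂ b) = there (from (segment-⇔ i) b)

  -- `codeString` recurses from the front of a string. Building the code by appending, where the
  -- digit at position `i` has weight `2 ^ i`, yields a primitive recursion in the length for fixed
  -- `s`.
  prefixCode : ℕ → ℕ
  prefixCode zero    = 0
  prefixCode (suc i) = prefixCode i ℕ.+ 2 ℕ.^ i ℕ.* suc (toℕ (s i))

  prefixCode-applyUpTo : ∀ i → prefixCode i ≡ codeString (applyUpTo s i)
  prefixCode-applyUpTo zero    = refl
  prefixCode-applyUpTo (suc i) = trans
    (cong₂ (λ c l → c ℕ.+ 2 ℕ.^ l ℕ.* suc (toℕ (s i))) (prefixCode-applyUpTo i) (sym (Listₚ.length-applyUpTo s i)))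
    (trans (sym (codeString-∷ʳ (applyUpTo s i) (s i))) (cong codeString (Listₚ.applyUpTo-∷ʳ s i)))

  segmentCode : ℕ → ℕ
  segmentCode i = codeList (map codeString (segment i))

  -- The exponent is the code of the new cylinder: the prefix of length `i` followed by 0, a digit
  -- that adds `2 ^ i`.
  segmentCode-suc : ∀ i → segmentCode (suc i) ≡
    choose (toℕ (s i)) (2 ℕ.^ (prefixCode i ℕ.+ 2 ℕ.^ i) ℕ.* suc (2 ℕ.* segmentCode i)) (segmentCode i)
  segmentCode-suc i with s i
  ... | 0F = sym (choose-0 (2 ℕ.^ (prefixCode i ℕ.+ 2 ℕ.^ i) ℕ.* suc (2 ℕ.* segmentCode i)) (segmentCode i))
  ... | 1F = trans
    (cong (λ c → 2 ℕ.^ c ℕ.* suc (2 ℕ.* segmentCode i))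
      (trans (codeString-∷ʳ (applyUpTo s i) 0F)
        (cong₂ ℕ._+_ (sym (prefixCode-applyUpTo i))
          (trans (ℕₚ.*-identityʳ _) (cong (2 ℕ.^_) (Listₚ.length-applyUpTo s i))))))
    (sym (choose-1 (2 ℕ.^ (prefixCode i ℕ.+ 2 ℕ.^ i) ℕ.* suc (2 ℕ.* segmentCode i)) (segmentCode i)))

segmentCodeᶜ : ∀ {k} {f g : Fun k} → Computable f → Computable g → Computable (λ xs → segmentCode (digit (f xs)) (g xs))
segmentCodeᶜ fᶜ gᶜ = compᶜ {f = λ xs → segmentCode (digit (lookup xs 1F)) (lookup xs 0F)}
  (recᶜ _ (constᶜ 0)
    (chooseᶜ (digitᶜ (varᶜ 2F) (varᶜ 0F))
      (constᶜ 2 ^ᶜ (prefixCodeᶜ +ᶜ constᶜ 2 ^ᶜ varᶜ 0F) *ᶜ sucᶜ (constᶜ 2 *ᶜ varᶜ 1F))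
      (varᶜ 1F))
    (λ _ → refl) (λ n xs → segmentCode-suc (digit (lookup xs 0F)) n))
  (gᶜ ∷ fᶜ ∷ [])
  where
  prefixCodeᶜ : Computable {3} (λ xs → prefixCode (digit (lookup xs 2F)) (lookup xs 0F))
  prefixCodeᶜ = compᶜ {f = λ xs → prefixCode (digit (lookup xs 1F)) (lookup xs 0F)}
    (recᶜ _ (constᶜ 0) (varᶜ 1F +ᶜ constᶜ 2 ^ᶜ varᶜ 0F *ᶜ sucᶜ (digitᶜ (varᶜ 2F) (varᶜ 0F)))
      (λ _ → refl) (λ _ _ → refl))
    (varᶜ 0F ∷ varᶜ 2F ∷ [])

-- Lexicographic comparison as comparison of binary numerals

value : ℕ → Cantor → ℕ
value zero    y = 0
value (suc m) y = 2 ℕ.* value m y ℕ.+ toℕ (y m)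

valueᶜ : ∀ {k} {f g : Fun k} → Computable f → Computable g → Computable (λ xs → value (f xs) (digit (g xs)))
valueᶜ fᶜ gᶜ = compᶜ {f = λ xs → value (lookup xs 0F) (digit (lookup xs 1F))}
  (recᶜ _ (constᶜ 0) (constᶜ 2 *ᶜ varᶜ 1F +ᶜ digitᶜ (varᶜ 2F) (varᶜ 0F)) (λ _ → refl) (λ _ _ → refl))
  (fᶜ ∷ gᶜ ∷ [])

value-head : ∀ m y → value (suc m) y ≡ toℕ (y 0) ℕ.* 2 ℕ.^ m ℕ.+ value m (y ∘ suc)
value-head zero    y = sym (trans (ℕₚ.+-identityʳ _) (ℕₚ.*-identityʳ _))
value-head (suc m) y = trans (cong (λ v → 2 ℕ.* v ℕ.+ toℕ (y (suc m))) (value-head m y))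
  (solve 4 (λ i p v j → con 2 :* (i :* p :+ v) :+ j := i :* (con 2 :* p) :+ (con 2 :* v :+ j)) refl
    (toℕ (y 0)) (2 ℕ.^ m) (value m (y ∘ suc)) (toℕ (y (suc m))))
  where open ℕ-Solver

value< : ∀ m y → value m y ℕ.< 2 ℕ.^ m
value< zero    y = s≤s z≤n
value< (suc m) y = ℕₚ.≤-trans
  (ℕₚ.≤-trans (s≤s (ℕₚ.+-monoʳ-≤ (2 ℕ.* value m y) (ℕ.s≤s⁻¹ (Finₚ.toℕ<n (y m)))))
    (ℕₚ.≤-reflexive (solve 1 (λ v → con 1 :+ (con 2 :* v :+ con 1) := con 2 :* (con 1 :+ v)) refl (value m y))))
  (ℕₚ.*-monoʳ-≤ 2 (value< m y))
  where open ℕ-Solver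

value-mono : ∀ m {y z} → (∀ j → j ℕ.< m → y j Fin.≤ z j) → value m y ℕ.≤ value m z
value-mono zero    le = z≤n
value-mono (suc m) le = ℕₚ.+-mono-≤ (ℕₚ.*-monoʳ-≤ 2 (value-mono m λ j l → le j (ℕₚ.m<n⇒m<1+n l))) (le m ℕₚ.≤-refl)

-- Numerals of equal length are ordered lexicographically: a difference in the leading digit
-- outweighs all later digits by `value<`.
Below-value : ∀ m s y → y ∈ Below (applyUpTo s m) ⇔ value m y ℕ.< value m s
Below-value zero    s y = mk⇔ (λ ()) (λ ())
Below-value (suc m) s y = subst₂ (λ a b → y ∈ Below (applyUpTo s (suc m)) ⇔ a ℕ.< b) (sym (value-head m y)) (sym (value-head m s))
  (go (y 0) (s 0) (Below-value m (s ∘ suc) (y ∘ suc)))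
  where
  p v w : ℕ
  p = 2 ℕ.^ m
  v = value m (y ∘ suc)
  w = value m (s ∘ suc)
  go : ∀ {B : Set} i j → B ⇔ v ℕ.< w →
       (i Fin.< j ⊎ (i ≡ j × B)) ⇔ toℕ i ℕ.* p ℕ.+ v ℕ.< toℕ j ℕ.* p ℕ.+ w
  go 0F 0F e = mk⇔ (λ { (inj₁ ()) ; (inj₂ (_ , b)) → to e b }) (λ l → inj₂ (refl , from e l))
  go 0F 1F e = mk⇔
    (λ _ → ℕₚ.<-≤-trans (value< m (y ∘ suc)) (ℕₚ.≤-trans (ℕₚ.m≤m+n p 0) (ℕₚ.m≤m+n (p ℕ.+ 0) w)))
    (λ _ → inj₁ (s≤s z≤n))
  go 1F 0F e = mk⇔ (λ { (inj₁ ()) ; (inj₂ (() , _)) })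
    (λ l → contradiction (ℕₚ.<-trans l (ℕₚ.<-≤-trans (value< m (s ∘ suc))
             (ℕₚ.≤-trans (ℕₚ.m≤m+n p 0) (ℕₚ.m≤m+n (p ℕ.+ 0) v)))) (ℕₚ.<-irrefl refl))
  go 1F 1F e = mk⇔
    (λ { (inj₁ (s≤s ())) ; (inj₂ (_ , b)) → ℕₚ.+-monoʳ-< (p ℕ.+ 0) (to e b) })
    (λ l → inj₂ (refl , from e (ℕₚ.+-cancelˡ-< (p ℕ.+ 0) v w l)))

▹-≤ : ∀ σ τ j → (σ ▹ zeros) j Fin.≤ ((σ ++ τ) ▹ zeros) j
▹-≤ []      τ j       = z≤n
▹-≤ (i ∷ σ) τ zero    = ℕₚ.≤-refl
▹-≤ (i ∷ σ) τ (suc j) = ▹-≤ σ τ j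

applyUpTo-▹-≤ : ∀ x m j → (applyUpTo x m ▹ zeros) j Fin.≤ x j
applyUpTo-▹-≤ x zero    j       = z≤n
applyUpTo-▹-≤ x (suc m) zero    = ℕₚ.≤-refl
applyUpTo-▹-≤ x (suc m) (suc j) = applyUpTo-▹-≤ (x ∘ suc) m j

applyUpTo-▹-< : ∀ x m j → j ℕ.< m → (applyUpTo x m ▹ zeros) j ≡ x j
applyUpTo-▹-< x (suc m) zero    _       = refl
applyUpTo-▹-< x (suc m) (suc j) (s≤s l) = applyUpTo-▹-< (x ∘ suc) m j l

-- Intersections of computable sequences of initial segments

-- The string with code `w`, filled up with zeros to length `w`, which suffices because no string is
-- longer than its code.
bits : ℕ → String
bits w = applyUpTo (digit w) w

module _ (w : ℕ → ℕ) (wᶜ : Computable {1} λ xs → w (lookup xs 0F)) where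

  -- Counts the indices below `n` whose segment misses the string with code `t` continued by zeros:
  -- `1 ∸ (a ∸ b)` is 1 if `a ≤ b` and 0 otherwise.
  violations : ℕ → ℕ → ℕ
  violations zero    t = 0
  violations (suc n) t = violations n t ℕ.+ (1 ℕ.∸ (value (w n) (digit (w n)) ℕ.∸ value (w n) (digit t)))

  private
    violations-zero : ∀ n t → violations n t ≡ 0 ⇔ (∀ i → i ℕ.< n → value (w i) (digit t) ℕ.< value (w i) (digit (w i)))
    violations-zero zero    t = mk⇔ (λ _ _ ()) (λ _ → refl)
    violations-zero (suc n) t = mk⇔
      (λ e i l → all e i (ℕₚ.m≤n⇒m<n∨m≡n (ℕ.s≤s⁻¹ l)))
      (λ f → cong₂ ℕ._+_ (from (violations-zero n t) (λ i l → f i (ℕₚ.m<n⇒m<1+n l)))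
               (ℕₚ.m≤n⇒m∸n≡0 (ℕₚ.m<n⇒0<n∸m (f n ℕₚ.≤-refl))))
      where
      all : violations (suc n) t ≡ 0 → ∀ i → i ℕ.< n ⊎ i ≡ n → value (w i) (digit t) ℕ.< value (w i) (digit (w i))
      all e i (inj₁ l)    = to (violations-zero n t) (ℕₚ.m+n≡0⇒m≡0 (violations n t) e) i l
      all e i (inj₂ refl) = ℕₚ.m∸n≢0⇒n<m (λ z → ℕₚ.<-irrefl (sym z)
        (ℕₚ.m∸n≡0⇒m≤n {1} (ℕₚ.m+n≡0⇒n≡0 (violations n t) e)))

  -- The digits missing from τ count as 0, so that extending τ can only
  -- destroy the condition.
  segmentsTree : Pred String 0ℓ
  segmentsTree τ = violations (codeString τ) (codeString τ) ≡ 0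

  private
    value-digit : ∀ m τ → value m (digit (codeString τ)) ≡ value m (τ ▹ zeros)
    value-digit m τ = ℕₚ.≤-antisym
      (value-mono m λ j _ → Finₚ.≤-reflexive (digit-codeString τ j))
      (value-mono m λ j _ → Finₚ.≤-reflexive (sym (digit-codeString τ j)))

    segmentsTree-⇔ : ∀ τ → τ ∈ segmentsTree ⇔
      (∀ i → i ℕ.< codeString τ → value (w i) (τ ▹ zeros) ℕ.< value (w i) (digit (w i)))
    segmentsTree-⇔ τ = mk⇔
      (λ e i l → subst (ℕ._< _) (value-digit (w i) τ) (to (violations-zero _ _) e i l))
      (λ f → from (violations-zero _ _) λ i l → subst (ℕ._< _) (sym (value-digit (w i) τ)) (f i l))

  -- A string `τ` is tested only against segments of index below `codeString τ`. This bound is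
  -- computable, grows with extension, so that the result is a tree, and is unbounded along every
  -- path, so that no segment is forgotten.
  segments-effectivelyClosed : EffectivelyClosed (λ x → ∀ n → x ∈ Below (bits (w n)))
  segments-effectivelyClosed = segmentsTree , isTree , computable , (λ {x} → inside x) , (λ {x} → outside x)
    where
    isTree : IsTree segmentsTree
    isTree σ τ t = from (segmentsTree-⇔ σ) λ i l → ℕₚ.≤-<-trans
      (value-mono (w i) λ j _ → ▹-≤ σ τ j)
      (to (segmentsTree-⇔ (σ ++ τ)) t i (ℕₚ.<-≤-trans l (codeString-++-≤ σ τ)))

    violationsᶜ : Computable {2} (λ xs → violations (lookup xs 0F) (lookup xs 1F))
    violationsᶜ = recᶜ _ (constᶜ 0)
      (varᶜ 1F +ᶜ (constᶜ 1 ∸ᶜ (valueᶜ wᶜ₀ wᶜ₀ ∸ᶜ valueᶜ wᶜ₀ (varᶜ 2F)))) (λ _ → refl) (λ _ _ → refl)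
      where
      wᶜ₀ : Computable {3} (λ xs → w (lookup xs 0F))
      wᶜ₀ = compᶜ wᶜ (varᶜ 0F ∷ [])

    test : Fun 1
    test xs = 1 ℕ.∸ violations (lookup xs 0F) (lookup xs 0F)

    testᶜ : Computable test
    testᶜ = constᶜ 1 ∸ᶜ compᶜ violationsᶜ (varᶜ 0F ∷ varᶜ 0F ∷ [])

    computable : ComputableSet segmentsTree
    computable = proj₁ testᶜ , λ σ → decide σ (violations (codeString σ) (codeString σ)) refl
      where
      decide : ∀ σ n → violations (codeString σ) (codeString σ) ≡ n →
        (σ ∈ segmentsTree × proj₁ testᶜ ⟨ codeString σ ∷ [] ⟩⇓ 1) ⊎
        (¬ σ ∈ segmentsTree × proj₁ testᶜ ⟨ codeString σ ∷ [] ⟩⇓ 0)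
      decide σ zero    e = inj₁ (e , subst (proj₁ testᶜ ⟨ codeString σ ∷ [] ⟩⇓_) (cong (1 ℕ.∸_) e) (proj₂ testᶜ (codeString σ ∷ [])))
      decide σ (suc n) e = inj₂ ((λ z → contradiction (trans (sym z) e) λ ())
        , subst (proj₁ testᶜ ⟨ codeString σ ∷ [] ⟩⇓_) (trans (cong (1 ℕ.∸_) e) (ℕₚ.0∸n≡0 n)) (proj₂ testᶜ (codeString σ ∷ [])))

    inside : ∀ x → (∀ n → x ∈ Below (bits (w n))) → x ∈ Paths segmentsTree
    inside x b m = from (segmentsTree-⇔ (applyUpTo x m)) λ i _ → ℕₚ.≤-<-trans
      (value-mono (w i) λ j _ → applyUpTo-▹-≤ x m j)
      (to (Below-value (w i) (digit (w i)) x) (b i))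

    outside : ∀ x → x ∈ Paths segmentsTree → ∀ n → x ∈ Below (bits (w n))
    outside x p n = from (Below-value (w n) (digit (w n)) x) (ℕₚ.≤-<-trans
      (value-mono (w n) λ j l → Finₚ.≤-reflexive (sym (applyUpTo-▹-< x m j (ℕₚ.<-≤-trans l (ℕₚ.m≤n+m (w n) (suc n))))))
      (to (segmentsTree-⇔ (applyUpTo x m)) (p m) n
        (ℕₚ.<-≤-trans (ℕₚ.m≤m+n (suc n) (w n)) (subst (ℕ._≤ codeString (applyUpTo x m))
          (Listₚ.length-applyUpTo x m) (length≤codeString (applyUpTo x m))))))
      where
      -- A prefix this long has a code above `n`, so segment `n` is tested, and it covers all `w n`
      -- digits, so the test sees `x` itself and no padding.
      m : ℕ
      m = suc n ℕ.+ w n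

  segments : ℕ → Clopen
  segments n = segment (digit (w n)) (w n)

  segments-computable : ComputableClopenSeq segments
  segments-computable = proj₁ codeᶜ , λ n → proj₂ codeᶜ (n ∷ [])
    where
    codeᶜ : Computable {1} (λ xs → segmentCode (digit (w (lookup xs 0F))) (w (lookup xs 0F)))
    codeᶜ = segmentCodeᶜ wᶜ wᶜ

  segments-≐ : ∀ n → ⟦ segments n ⟧ᶜ ≐ Below (bits (w n))
  segments-≐ n = to (segment-⇔ (digit (w n)) (w n)) , from (segment-⇔ (digit (w n)) (w n))

open ℝ
open BorelProbabilityMeasure
open ℚ-Solver using (solve; con; _:=_; _:+_; _:-_; _:*_)

-- Rational inequalities

≤-by : ∀ {p q} s → 0ℚ ℚ.≤ s → q ℚ.- p ≡ s → p ℚ.≤ q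
≤-by {p} {q} s 0≤s e = begin
  p                ≡⟨ sym (ℚₚ.+-identityʳ p) ⟩
  p ℚ.+ 0ℚ         ≤⟨ ℚₚ.+-monoʳ-≤ p 0≤s ⟩
  p ℚ.+ s          ≡⟨ cong (p ℚ.+_) (sym e) ⟩
  p ℚ.+ (q ℚ.- p)  ≡⟨ solve 2 (λ p q → p :+ (q :- p) := q) refl p q ⟩
  q                ∎
  where open ℚₚ.≤-Reasoning

0≤- : ∀ {p q} → p ℚ.≤ q → 0ℚ ℚ.≤ q ℚ.- p
0≤- {p} {q} p≤q = subst (ℚ._≤ q ℚ.- p) (ℚₚ.+-inverseʳ p) (ℚₚ.+-monoˡ-≤ (ℚ.- p) p≤q)

0≤+ : ∀ {p q} → 0ℚ ℚ.≤ p → 0ℚ ℚ.≤ q → 0ℚ ℚ.≤ p ℚ.+ q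
0≤+ {p} {q} = ℚₚ.+-mono-≤ {0ℚ} {p} {0ℚ} {q}

0≤* : ∀ {p q} → 0ℚ ℚ.≤ p → 0ℚ ℚ.≤ q → 0ℚ ℚ.≤ p ℚ.* q
0≤* {p} {q} 0≤p 0≤q = subst (ℚ._≤ p ℚ.* q) (ℚₚ.*-zeroʳ p)
  (ℚₚ.*-monoˡ-≤-nonNeg p {{nonNegative 0≤p}} 0≤q)

0<* : ∀ {p q} → 0ℚ ℚ.< p → 0ℚ ℚ.< q → 0ℚ ℚ.< p ℚ.* q
0<* {p} {q} 0<p 0<q = ℚₚ.positive⁻¹ _ {{ℚₚ.pos*pos⇒pos p {{positive 0<p}} q {{positive 0<q}}}}

0<½ : 0ℚ ℚ.< ½
0<½ = ℚₚ.positive⁻¹ ½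

halve : ∀ {ε} → 0ℚ ℚ.< ε → 0ℚ ℚ.< ε ℚ.* ½
halve 0<ε = 0<* 0<ε 0<½

p≤∣p∣ : ∀ p → p ℚ.≤ ∣ p ∣
p≤∣p∣ p with ℚₚ.≤-total 0ℚ p
... | inj₁ 0≤p = ℚₚ.≤-reflexive (sym (ℚₚ.0≤p⇒∣p∣≡p 0≤p))
... | inj₂ p≤0 = ℚₚ.≤-trans p≤0 (ℚₚ.0≤∣p∣ p)

-- Statements that hold from some index on

Eventually : (ℕ → Set) → Set
Eventually P = ∃ λ N → ∀ n → N ℕ.≤ n → P n

always : ∀ {P} → (∀ n → P n) → Eventually P
always f = 0 , λ n _ → f n

map₁ᵉ : ∀ {P Q} → (∀ n → P n → Q n) → Eventually P → Eventually Q
map₁ᵉ f (N , p) = N , λ n N≤n → f n (p n N≤n)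

map₂ᵉ : ∀ {P Q R} → (∀ n → P n → Q n → R n) → Eventually P → Eventually Q → Eventually R
map₂ᵉ f (N , p) (M , q) = N ℕ.⊔ M , λ n le →
  f n (p n (ℕₚ.≤-trans (ℕₚ.m≤m⊔n N M) le)) (q n (ℕₚ.≤-trans (ℕₚ.m≤n⊔m N M) le))

map₃ᵉ : ∀ {P Q R S} → (∀ n → P n → Q n → R n → S n) →
        Eventually P → Eventually Q → Eventually R → Eventually S
map₃ᵉ f p q r = map₂ᵉ (λ n (a , b) c → f n a b c) (map₂ᵉ (λ n → _,_) p q) r

witness : ∀ {P} → Eventually P → ∃ P
witness (N , p) = N , p N ℕₚ.≤-refl

-- Order on the reals

≤-pointwise : ∀ {x y} → Eventually (λ n → seq x n ℚ.≤ seq y n) → x ≤ y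
≤-pointwise {x} {y} (N , p) ε 0<ε = N , λ n N≤n → ≤-by {seq x n} {seq y n ℚ.+ ε}
  ((seq y n ℚ.- seq x n) ℚ.+ ε) (0≤+ (0≤- (p n N≤n)) (ℚₚ.<⇒≤ 0<ε))
  (solve 3 (λ x y e → (y :+ e) :- x := (y :- x) :+ e) refl (seq x n) (seq y n) ε)

≈-pointwise : ∀ {x y} → (∀ n → seq x n ≡ seq y n) → x ≈ y
≈-pointwise {x} {y} e = ≤-pointwise {x} {y} (always λ n → ℚₚ.≤-reflexive (e n))
                      , ≤-pointwise {y} {x} (always λ n → ℚₚ.≤-reflexive (sym (e n)))

≤-refl : ∀ {x} → x ≤ x
≤-refl {x} = ≤-pointwise {x} {x} (always λ _ → ℚₚ.≤-refl)

≤-trans : ∀ {x y z} → x ≤ y → y ≤ z → x ≤ z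
≤-trans {x} {y} {z} x≤y y≤z ε 0<ε = map₂ᵉ
  (λ n p q → ≤-by ((seq y n ℚ.+ ε ℚ.* ½ ℚ.- seq x n) ℚ.+ (seq z n ℚ.+ ε ℚ.* ½ ℚ.- seq y n))
    (0≤+ (0≤- p) (0≤- q))
    (solve 4 (λ x y z e → (z :+ e) :- x := (y :+ e :* con ½ :- x) :+ (z :+ e :* con ½ :- y)) refl
      (seq x n) (seq y n) (seq z n) ε))
  (x≤y (ε ℚ.* ½) (halve 0<ε)) (y≤z (ε ℚ.* ½) (halve 0<ε))

≈-refl : ∀ {x} → x ≈ x
≈-refl {x} = ≤-refl {x} , ≤-refl {x}

≈-sym : ∀ {x y} → x ≈ y → y ≈ x
≈-sym (p , q) = q , p

≈-trans : ∀ {x y z} → x ≈ y → y ≈ z → x ≈ z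
≈-trans {x} {y} {z} (p , q) (r , s) = ≤-trans {x} {y} {z} p r , ≤-trans {z} {y} {x} s q

+-mono-≤ : ∀ {x y u v} → x ≤ y → u ≤ v → x + u ≤ y + v
+-mono-≤ {x} {y} {u} {v} x≤y u≤v ε 0<ε = map₂ᵉ
  (λ n p q → ≤-by ((seq y n ℚ.+ ε ℚ.* ½ ℚ.- seq x n) ℚ.+ (seq v n ℚ.+ ε ℚ.* ½ ℚ.- seq u n))
    (0≤+ (0≤- p) (0≤- q))
    (solve 5 (λ x y u v e → (y :+ v :+ e) :- (x :+ u) :=
                            (y :+ e :* con ½ :- x) :+ (v :+ e :* con ½ :- u)) refl
      (seq x n) (seq y n) (seq u n) (seq v n) ε))
  (x≤y (ε ℚ.* ½) (halve 0<ε)) (u≤v (ε ℚ.* ½) (halve 0<ε))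

+-cong : ∀ {x y u v} → x ≈ y → u ≈ v → x + u ≈ y + v
+-cong {x} {y} {u} {v} (p , q) (r , s) = +-mono-≤ {x} {y} {u} {v} p r , +-mono-≤ {y} {x} {v} {u} q s

+-cancelˡ-≤ : ∀ z {x y} → z + x ≤ z + y → x ≤ y
+-cancelˡ-≤ z {x} {y} le ε 0<ε = map₁ᵉ
  (λ n p → ≤-by (seq z n ℚ.+ seq y n ℚ.+ ε ℚ.- (seq z n ℚ.+ seq x n)) (0≤- p)
    (solve 4 (λ x y z e → (y :+ e) :- x := (z :+ y :+ e) :- (z :+ x)) refl
      (seq x n) (seq y n) (seq z n) ε))
  (le ε 0<ε)

≤-slack : ∀ {x y} → (∀ ε → 0ℚ ℚ.< ε → x ≤ y + fromℚ ε) → x ≤ y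
≤-slack {x} {y} f ε 0<ε = map₁ᵉ
  (λ n p → subst (seq x n ℚ.≤_)
    (solve 2 (λ y e → (y :+ e :* con ½) :+ e :* con ½ := y :+ e) refl (seq y n) ε) p)
  (f (ε ℚ.* ½) (halve 0<ε) (ε ℚ.* ½) (halve 0<ε))

<⇒≤ : ∀ {x y} → x < y → x ≤ y
<⇒≤ {x} {y} (ε , 0<ε , ev) = ≤-pointwise {x} {y} (map₁ᵉ
  (λ n p → ℚₚ.≤-trans (≤-by {seq x n} ε (ℚₚ.<⇒≤ 0<ε)
    (solve 2 (λ x e → (x :+ e) :- x := e) refl (seq x n) ε)) p) ev)

half< : ∀ {ε} → 0ℚ ℚ.< ε → ε ℚ.* ½ ℚ.< ε
half< {ε} 0<ε = subst (ε ℚ.* ½ ℚ.<_)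
  (solve 1 (λ e → e :* con ½ :+ e :* con ½ := e) refl ε)
  (subst (ℚ._< ε ℚ.* ½ ℚ.+ ε ℚ.* ½) (ℚₚ.+-identityʳ (ε ℚ.* ½))
    (ℚₚ.+-monoʳ-< (ε ℚ.* ½) {0ℚ} {ε ℚ.* ½} (halve 0<ε)))

≤⇒≯ : ∀ {x y} → x ≤ y → ¬ y < x
≤⇒≯ {x} {y} x≤y (ε , 0<ε , M , q) = ℚₚ.<-irrefl refl (ℚₚ.<-≤-trans (half< 0<ε) (≤-by {ε} {ε ℚ.* ½}
    ((seq y n ℚ.+ ε ℚ.* ½ ℚ.- seq x n) ℚ.+ (seq x n ℚ.- (seq y n ℚ.+ ε)))
    (0≤+ (0≤- (proj₂ (x≤y (ε ℚ.* ½) (halve 0<ε)) n (ℕₚ.m≤m⊔n N M)))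
         (0≤- (q n (ℕₚ.m≤n⊔m N M))))
    (solve 3 (λ x y e → e :* con ½ :- e := (y :+ e :* con ½ :- x) :+ (x :- (y :+ e))) refl
      (seq x n) (seq y n) ε)))
  where
  N = proj₁ (x≤y (ε ℚ.* ½) (halve 0<ε))
  n = N ℕ.⊔ M

<-≤-trans : ∀ {x y z} → x < y → y ≤ z → x < z
<-≤-trans {x} {y} {z} (ε , 0<ε , ev) y≤z = ε ℚ.* ½ , halve 0<ε , map₂ᵉ
  (λ n p q → ≤-by ((seq y n ℚ.- (seq x n ℚ.+ ε)) ℚ.+ (seq z n ℚ.+ ε ℚ.* ½ ℚ.- seq y n))
    (0≤+ (0≤- p) (0≤- q))
    (solve 4 (λ x y z e → z :- (x :+ e :* con ½) :=
      (y :- (x :+ e)) :+ (z :+ e :* con ½ :- y)) refl (seq x n) (seq y n) (seq z n) ε))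
  ev (y≤z (ε ℚ.* ½) (halve 0<ε))

≤-<-trans : ∀ {x y z} → x ≤ y → y < z → x < z
≤-<-trans {x} {y} {z} x≤y (ε , 0<ε , ev) = ε ℚ.* ½ , halve 0<ε , map₂ᵉ
  (λ n p q → ≤-by ((seq y n ℚ.+ ε ℚ.* ½ ℚ.- seq x n) ℚ.+ (seq z n ℚ.- (seq y n ℚ.+ ε)))
    (0≤+ (0≤- p) (0≤- q))
    (solve 4 (λ x y z e → z :- (x :+ e :* con ½) :=
      (y :+ e :* con ½ :- x) :+ (z :- (y :+ e))) refl (seq x n) (seq y n) (seq z n) ε))
  (x≤y (ε ℚ.* ½) (halve 0<ε)) ev

close : ∀ x ε → 0ℚ ℚ.< ε →
        ∃ λ N → ∀ m n → N ℕ.≤ m → N ℕ.≤ n → seq x m ℚ.≤ seq x n ℚ.+ ε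
close x ε 0<ε with cauchy x ε 0<ε
... | N , p = N , λ m n N≤m N≤n → ≤-by (ε ℚ.- (seq x m ℚ.- seq x n))
    (0≤- (ℚₚ.≤-trans (p≤∣p∣ (seq x m ℚ.- seq x n)) (p m n N≤m N≤n)))
    (solve 3 (λ a b e → (b :+ e) :- a := e :- (a :- b)) refl (seq x m) (seq x n) ε)

≰⇒> : ExcludedMiddle 0ℓ → ∀ {x y} → ¬ x ≤ y → y < x
≰⇒> em {x} {y} x≰y with em {y < x}
... | yes y<x = y<x
... | no  y≮x = contradiction x≤y x≰y
  where
  x≤y : x ≤ y
  x≤y ε 0<ε = N ℕ.⊔ M , bound
    where
    δ : ℚ
    -- A gap of more than `ε` at one late index shrinks by at most `δ` for each of `x` and `y` at
    -- any other late index, so half of it persists and witnesses `y < x`.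
    δ = ε ℚ.* ½ ℚ.* ½
    N = proj₁ (close x δ (halve (halve 0<ε)))
    M = proj₁ (close y δ (halve (halve 0<ε)))
    cx = proj₂ (close x δ (halve (halve 0<ε)))
    cy = proj₂ (close y δ (halve (halve 0<ε)))
    bound : ∀ n → N ℕ.⊔ M ℕ.≤ n → seq x n ℚ.≤ seq y n ℚ.+ ε
    bound n N≤n with seq x n ℚₚ.≤? seq y n ℚ.+ ε
    ... | yes p = p
    ... | no ¬p = contradiction (ε ℚ.* ½ , halve 0<ε , N ℕ.⊔ M , far) y≮x
      where
      far : ∀ k → N ℕ.⊔ M ℕ.≤ k → seq y k ℚ.+ ε ℚ.* ½ ℚ.≤ seq x k
      far k N≤k = ≤-by
        ((seq x n ℚ.- (seq y n ℚ.+ ε)) ℚ.+ ((seq x k ℚ.+ δ ℚ.- seq x n) ℚ.+ (seq y n ℚ.+ δ ℚ.- seq y k)))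
        (0≤+ (0≤- (ℚₚ.<⇒≤ (ℚₚ.≰⇒> ¬p)))
          (0≤+ (0≤- (cx n k (ℕₚ.m⊔n≤o⇒m≤o N M N≤n) (ℕₚ.m⊔n≤o⇒m≤o N M N≤k)))
               (0≤- (cy k n (ℕₚ.m⊔n≤o⇒n≤o N M N≤k) (ℕₚ.m⊔n≤o⇒n≤o N M N≤n)))))
        (solve 5 (λ xk yk xn yn e →
            xk :- (yk :+ e :* con ½) :=
            (xn :- (yn :+ e)) :+ ((xk :+ e :* con ½ :* con ½ :- xn) :+ (yn :+ e :* con ½ :* con ½ :- yk)))
          refl (seq x k) (seq y k) (seq x n) (seq y n) ε)

-- Borel sets and measures

∅ᴮ : Borel
∅ᴮ = compl (cyl [])

∉∅ᴮ : ∀ x → ¬ x ∈ ⟦ ∅ᴮ ⟧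
∉∅ᴮ _ ¬p = ¬p refl

pair : Borel → Borel → ℕ → Borel
pair A B 0             = A
pair A B 1             = B
pair A B (suc (suc _)) = ∅ᴮ

infixr 6 _∪ᴮ_

_∪ᴮ_ : Borel → Borel → Borel
A ∪ᴮ B = union (pair A B)

∪ᴮ-⇔ : ∀ A B {x} → x ∈ ⟦ A ∪ᴮ B ⟧ ⇔ (x ∈ ⟦ A ⟧ ⊎ x ∈ ⟦ B ⟧)
∪ᴮ-⇔ A B {x} = mk⇔ split (λ { (inj₁ a) → 0 , a ; (inj₂ b) → 1 , b })
  where
  split : x ∈ ⟦ A ∪ᴮ B ⟧ → x ∈ ⟦ A ⟧ ⊎ x ∈ ⟦ B ⟧
  split (0 , a)           = inj₁ a
  split (1 , b)           = inj₂ b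
  split (suc (suc _) , e) = contradiction e (∉∅ᴮ x)

module _ (μ : BorelProbabilityMeasure) where

  -- Two consecutive partial sums for the constant sequence of empty sets are both within `ε/2` of
  -- the same limit, and they differ by the measure of the empty set.
  measure-∅ : measure μ ∅ᴮ ≈ 0ℝ
  measure-∅ = ≤-slack {measure μ ∅ᴮ} {0ℝ} small , nonneg μ ∅ᴮ
    where
    s : ℕ → ℝ
    s n = ∑< n (λ _ → measure μ ∅ᴮ)
    l : ℝ
    l = measure μ (union (λ _ → ∅ᴮ))
    small : ∀ ε → 0ℚ ℚ.< ε → measure μ ∅ᴮ ≤ 0ℝ + fromℚ ε
    small ε 0<ε with σ-additive μ (λ _ → ∅ᴮ) (λ _ _ _ (x , p , _) → ∉∅ᴮ x p) (ε ℚ.* ½) (halve 0<ε)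
    ... | N , near = +-cancelˡ-≤ (s N) {measure μ ∅ᴮ} {0ℝ + fromℚ ε}
        (≤-trans {s (suc N)} {l + fromℚ (ε ℚ.* ½)} {s N + (0ℝ + fromℚ ε)}
          (proj₁ (near (suc N) (ℕₚ.n≤1+n N)))
          (≤-trans {l + fromℚ (ε ℚ.* ½)} {(s N + fromℚ (ε ℚ.* ½)) + fromℚ (ε ℚ.* ½)} {s N + (0ℝ + fromℚ ε)}
            (+-mono-≤ {l} {s N + fromℚ (ε ℚ.* ½)} {fromℚ (ε ℚ.* ½)} {fromℚ (ε ℚ.* ½)}
              (proj₂ (near N ℕₚ.≤-refl)) (≤-refl {fromℚ (ε ℚ.* ½)}))
            (proj₁ (≈-pointwise {(s N + fromℚ (ε ℚ.* ½)) + fromℚ (ε ℚ.* ½)} {s N + (0ℝ + fromℚ ε)} λ n →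
              solve 2 (λ s e → (s :+ e :* con ½) :+ e :* con ½ := s :+ (con 0ℚ :+ e)) refl (seq (s N) n) ε))))

  -- Countable additivity for `A`, `B` and then empty sets: from the second partial sum on, all
  -- equal the sum of the two measures.
  measure-∪ : ∀ A B → ¬ (⟦ A ⟧ ≬ ⟦ B ⟧) → measure μ (A ∪ᴮ B) ≈ measure μ A + measure μ B
  measure-∪ A B A∥B =
      ≤-slack {m} {a + b} (λ ε 0<ε → let N , near = limit ε 0<ε in
        ≤-trans {m} {s N + fromℚ ε} {a + b + fromℚ ε} (proj₂ (near (2 ℕ.+ N) (ℕₚ.m≤n+m N 2)))
          (+-mono-≤ {s N} {a + b} {fromℚ ε} {fromℚ ε} (proj₁ (sums N)) (≤-refl {fromℚ ε})))
    , ≤-slack {a + b} {m} (λ ε 0<ε → let N , near = limit ε 0<ε in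
        ≤-trans {a + b} {s N} {m + fromℚ ε} (proj₂ (sums N)) (proj₁ (near (2 ℕ.+ N) (ℕₚ.m≤n+m N 2))))
    where
    a b m : ℝ
    a = measure μ A
    b = measure μ B
    m = measure μ (A ∪ᴮ B)
    s : ℕ → ℝ
    s n = ∑< (2 ℕ.+ n) (λ i → measure μ (pair A B i))
    disjoint : ∀ i j → ¬ i ≡ j → ¬ (⟦ pair A B i ⟧ ≬ ⟦ pair A B j ⟧)
    disjoint 0 0 i≢j _ = i≢j refl
    disjoint 1 1 i≢j _ = i≢j refl
    disjoint 0 1 i≢j p = A∥B p
    disjoint 1 0 i≢j (x , p , q) = A∥B (x , q , p)
    disjoint (suc (suc i)) j i≢j (x , p , q) = ∉∅ᴮ x p
    disjoint i (suc (suc j)) i≢j (x , p , q) = ∉∅ᴮ x q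
    limit : (λ n → ∑< n (λ i → measure μ (pair A B i))) ⟶ m
    limit = σ-additive μ (pair A B) disjoint
    sums : ∀ n → s n ≈ a + b
    sums zero    = ≈-pointwise {s 0} {a + b} λ n →
      solve 2 (λ a b → (con 0ℚ :+ a) :+ b := a :+ b) refl (seq a n) (seq b n)
    sums (suc n) = ≈-trans {s (suc n)} {a + b + 0ℝ} {a + b}
      (+-cong {s n} {a + b} {measure μ ∅ᴮ} {0ℝ} (sums n) measure-∅)
      (≈-pointwise {a + b + 0ℝ} {a + b} λ k → ℚₚ.+-identityʳ (seq a k ℚ.+ seq b k))

  measure-mono : ExcludedMiddle 0ℓ → ∀ A B → ⟦ A ⟧ ⊆ ⟦ B ⟧ → measure μ A ≤ measure μ B
  measure-mono em A B A⊆B =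
    ≤-trans {measure μ A} {measure μ A + 0ℝ} {measure μ B}
      (proj₂ (≈-pointwise {measure μ A + 0ℝ} {measure μ A} λ k → ℚₚ.+-identityʳ (seq (measure μ A) k)))
    (≤-trans {measure μ A + 0ℝ} {measure μ A + measure μ B∖A} {measure μ B}
      (+-mono-≤ {measure μ A} {measure μ A} {0ℝ} {measure μ B∖A} (≤-refl {measure μ A}) (nonneg μ B∖A))
    (≤-trans {measure μ A + measure μ B∖A} {measure μ (A ∪ᴮ B∖A)} {measure μ B}
      (proj₂ (measure-∪ A B∖A λ { (x , a , ¬c) → ¬c (from (∪ᴮ-⇔ A (compl B)) (inj₁ a)) }))
      (proj₁ (extensional μ (A ∪ᴮ B∖A) B (union⊆B , B⊆union)))))
    where
    B∖A : Borel
    B∖A = compl (A ∪ᴮ compl B)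
    union⊆B : ⟦ A ∪ᴮ B∖A ⟧ ⊆ ⟦ B ⟧
    union⊆B {x} u with to (∪ᴮ-⇔ A B∖A) u
    ... | inj₁ a = A⊆B a
    ... | inj₂ ¬c with em {x ∈ ⟦ B ⟧}
    ...   | yes b = b
    ...   | no ¬b = contradiction (from (∪ᴮ-⇔ A (compl B)) (inj₂ ¬b)) ¬c
    B⊆union : ⟦ B ⟧ ⊆ ⟦ A ∪ᴮ B∖A ⟧
    B⊆union {x} b with em {x ∈ ⟦ A ⟧}
    ... | yes a = from (∪ᴮ-⇔ A B∖A) (inj₁ a)
    ... | no ¬a = from (∪ᴮ-⇔ A B∖A) (inj₂ λ c → outside (to (∪ᴮ-⇔ A (compl B)) c))
      where
      outside : ¬ (x ∈ ⟦ A ⟧ ⊎ ¬ x ∈ ⟦ B ⟧)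
      outside (inj₁ a)  = ¬a a
      outside (inj₂ ¬b) = ¬b b

-- Decision trees on codes

-- A bounded test that reads consecutive letters of a code, each at most once. Acceptance is a
-- finite union of cylinders, and the probability factors along the branches.
data Decision : Set where
  accept reject : Decision
  query         : (Fin 3 → Decision) → Decision

Accepts : Decision → Code → ℕ → Set
Accepts accept    x j = ⊤
Accepts reject    x j = ⊥
Accepts (query f) x j = Accepts (f (x j)) x (suc j)

event : Decision → List (Fin 3) → Borel
event accept    π = cyl π
event reject    π = ∅ᴮ
event (query f) π = event (f 0F) (π ∷ʳ 0F) ∪ᴮ event (f 1F) (π ∷ʳ 1F) ∪ᴮ event (f 2F) (π ∷ʳ 2F)

event-⇔ : ∀ D π {x} → x ∈ ⟦ event D π ⟧ ⇔ (π ⊏ x × Accepts D x (length π))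
event-⇔ accept    π {x} = mk⇔ (λ p → p , tt) proj₁
event-⇔ reject    π {x} = mk⇔ (λ e → contradiction e (∉∅ᴮ x)) λ ()
event-⇔ (query f) π {x} = mk⇔ split (λ (p , a) → join (x (length π)) refl p a)
  where
  E : Fin 3 → Borel
  E i = event (f i) (π ∷ʳ i)
  branch : ∀ i → x ∈ ⟦ E i ⟧ → π ⊏ x × Accepts (query f) x (length π)
  branch i e with to (event-⇔ (f i) (π ∷ʳ i)) e
  ... | p , a with to (⊏-∷ʳ π) p
  ...   | q , refl = q , subst (Accepts (f i) x) (length-∷ʳ π i) a
  split : x ∈ ⟦ event (query f) π ⟧ → π ⊏ x × Accepts (query f) x (length π)
  split e with to (∪ᴮ-⇔ (E 0F) (E 1F ∪ᴮ E 2F)) e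
  ... | inj₁ e₀ = branch 0F e₀
  ... | inj₂ e′ with to (∪ᴮ-⇔ (E 1F) (E 2F)) e′
  ...   | inj₁ e₁ = branch 1F e₁
  ...   | inj₂ e₂ = branch 2F e₂
  join : ∀ i → x (length π) ≡ i → π ⊏ x → Accepts (f i) x (suc (length π)) → x ∈ ⟦ event (query f) π ⟧
  join i e p a with from (event-⇔ (f i) (π ∷ʳ i))
                      (from (⊏-∷ʳ π) (p , e) , subst (Accepts (f i) x) (sym (length-∷ʳ π i)) a)
  join 0F e p a | e₀ = from (∪ᴮ-⇔ (E 0F) (E 1F ∪ᴮ E 2F)) (inj₁ e₀)
  join 1F e p a | e₁ = from (∪ᴮ-⇔ (E 0F) (E 1F ∪ᴮ E 2F)) (inj₂ (from (∪ᴮ-⇔ (E 1F) (E 2F)) (inj₁ e₁)))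
  join 2F e p a | e₂ = from (∪ᴮ-⇔ (E 0F) (E 1F ∪ᴮ E 2F)) (inj₂ (from (∪ᴮ-⇔ (E 1F) (E 2F)) (inj₂ e₂)))

probability : ℝ → ℝ → Decision → ℝ
probability b₀ b₁ accept    = 1ℝ
probability b₀ b₁ reject    = 0ℝ
probability b₀ b₁ (query f) =
  weights b₀ b₁ 0F * probability b₀ b₁ (f 0F) +
  (weights b₀ b₁ 1F * probability b₀ b₁ (f 1F) + weights b₀ b₁ 2F * probability b₀ b₁ (f 2F))

module _ {b₀ b₁ : ℝ} (μ : BorelProbabilityMeasure) (μ-d : IsMeasureOf (d b₀ b₁) μ) where

  -- The three branches of a query fix different letters at position `length π` and are therefore
  -- disjoint; the weight of that letter splits off by `d-∷ʳ`.
  measure-event : ∀ D π → measure μ (event D π) ≈ d b₀ b₁ π * probability b₀ b₁ D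
  measure-event accept π = ≈-trans {measure μ (cyl π)} {d b₀ b₁ π} {d b₀ b₁ π * 1ℝ} (μ-d π)
    (≈-pointwise {d b₀ b₁ π} {d b₀ b₁ π * 1ℝ} λ n → sym (ℚₚ.*-identityʳ (seq (d b₀ b₁ π) n)))
  measure-event reject π = ≈-trans {measure μ ∅ᴮ} {0ℝ} {d b₀ b₁ π * 0ℝ} (measure-∅ μ)
    (≈-pointwise {0ℝ} {d b₀ b₁ π * 0ℝ} λ n → sym (ℚₚ.*-zeroʳ (seq (d b₀ b₁ π) n)))
  measure-event (query f) π =
    ≈-trans {measure μ (E 0F ∪ᴮ E 1F ∪ᴮ E 2F)} {m 0F + measure μ (E 1F ∪ᴮ E 2F)} {d b₀ b₁ π * probability b₀ b₁ (query f)}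
      (measure-∪ μ (E 0F) (E 1F ∪ᴮ E 2F) λ { (x , p , q) → disjoint₁₂ x p (to (∪ᴮ-⇔ (E 1F) (E 2F)) q) })
    (≈-trans {m 0F + measure μ (E 1F ∪ᴮ E 2F)} {v 0F + (v 1F + v 2F)} {d b₀ b₁ π * probability b₀ b₁ (query f)}
      (+-cong {m 0F} {v 0F} {measure μ (E 1F ∪ᴮ E 2F)} {v 1F + v 2F} (summand 0F)
        (≈-trans {measure μ (E 1F ∪ᴮ E 2F)} {m 1F + m 2F} {v 1F + v 2F}
          (measure-∪ μ (E 1F) (E 2F) λ { (x , p , q) → disjoint 1F 2F (λ ()) x p q })
          (+-cong {m 1F} {v 1F} {m 2F} {v 2F} (summand 1F) (summand 2F))))
      (≈-pointwise {v 0F + (v 1F + v 2F)} {d b₀ b₁ π * probability b₀ b₁ (query f)} λ n →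
        solve 7 (λ w₀ w₁ w₂ e p₀ p₁ p₂ →
          ((w₀ :* e) :* p₀) :+ (((w₁ :* e) :* p₁) :+ ((w₂ :* e) :* p₂)) :=
          e :* (w₀ :* p₀ :+ (w₁ :* p₁ :+ w₂ :* p₂))) refl
          (seq (weights b₀ b₁ 0F) n) (seq (weights b₀ b₁ 1F) n) (seq (weights b₀ b₁ 2F) n) (seq (d b₀ b₁ π) n)
          (seq (probability b₀ b₁ (f 0F)) n) (seq (probability b₀ b₁ (f 1F)) n) (seq (probability b₀ b₁ (f 2F)) n)))
    where
    E : Fin 3 → Borel
    E i = event (f i) (π ∷ʳ i)
    m v : Fin 3 → ℝ
    m i = measure μ (E i)
    v i = (weights b₀ b₁ i * d b₀ b₁ π) * probability b₀ b₁ (f i)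
    summand : ∀ i → m i ≈ v i
    summand i = subst (λ r → m i ≈ r * probability b₀ b₁ (f i)) (d-∷ʳ b₀ b₁ π i) (measure-event (f i) (π ∷ʳ i))
    queried : ∀ i {x} → x ∈ ⟦ E i ⟧ → x (length π) ≡ i
    queried i e = proj₂ (to (⊏-∷ʳ π) (proj₁ (to (event-⇔ (f i) (π ∷ʳ i)) e)))
    disjoint : ∀ i j → ¬ i ≡ j → ∀ x → x ∈ ⟦ E i ⟧ → ¬ x ∈ ⟦ E j ⟧
    disjoint i j i≢j x p q = i≢j (trans (sym (queried i p)) (queried j q))
    disjoint₁₂ : ∀ x → x ∈ ⟦ E 0F ⟧ → ¬ (x ∈ ⟦ E 1F ⟧ ⊎ x ∈ ⟦ E 2F ⟧)
    disjoint₁₂ x p (inj₁ q) = disjoint 0F 1F (λ ()) x p q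
    disjoint₁₂ x p (inj₂ q) = disjoint 0F 2F (λ ()) x p q

-- The event that the leftmost path is below a string

compare : Fin 2 → Fin 2 → Decision → Decision
compare 0F 0F D = D
compare 0F 1F D = accept
compare 1F 0F D = reject
compare 1F 1F D = D

skip : ℕ → ℕ → (ℕ → Decision) → Decision
skip zero    r D = D r
skip (suc m) r D = query λ i → skip m (bump i r) D

-- The current level has r + 1 nodes: the first of their digits determines the
-- leftmost path, the others only the number of nodes on the next level.
below : String → ℕ → Decision
below []      r = reject
below (c ∷ σ) r = query λ i → compare (bit i) c (skip r (bump i r) (below σ))

Accepts-skip : ∀ m D x j → Accepts (skip m (count x j) D) x j ≡ Accepts (D (count x (m ℕ.+ j))) x (m ℕ.+ j)
Accepts-skip zero    D x j = refl
Accepts-skip (suc m) D x j = trans (Accepts-skip m D x (suc j))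
  (cong (λ k → Accepts (D (count x k)) x k) (ℕₚ.+-suc m j))

-- The letter at `j` and the `count x j` letters skipped after it lead to position `next-level x j`.
-- The running count kept by `skip` is by then the true count at that position.
Accepts-below : ∀ σ x j → Accepts (below σ (count x j)) x j ⇔ path x j ∈ Below σ
Accepts-below []      x j = mk⇔ (λ a → a) (λ a → a)
Accepts-below (c ∷ σ) x j = go (bit (x j)) c (Accepts-below σ x (next-level x j))
  (trans (Accepts-skip (count x j) (below σ) x (suc j))
         (cong (λ k → Accepts (below σ (count x k)) x k) (ℕₚ.+-suc (count x j) j)))
  where
  go : ∀ i c {D A} {B : Set} → A ⇔ B → Accepts D x (suc j) ≡ A →
       Accepts (compare i c D) x (suc j) ⇔ (i Fin.< c ⊎ (i ≡ c × B))
  go 0F 0F e refl = mk⇔ (λ a → inj₂ (refl , to e a)) λ { (inj₁ ()) ; (inj₂ (_ , b)) → from e b }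
  go 0F 1F e refl = mk⇔ (λ _ → inj₁ (s≤s z≤n)) (λ _ → tt)
  go 1F 0F e refl = mk⇔ (λ ()) λ { (inj₁ ()) ; (inj₂ (() , _)) }
  go 1F 1F e refl = mk⇔ (λ a → inj₂ (refl , to e a)) λ { (inj₁ (s≤s ())) ; (inj₂ (_ , b)) → from e b }

event-below : ∀ σ → ⟦ event (below σ 0) [] ⟧ ≐ (λ x → path x 0 ∈ Below σ)
event-below σ = (λ {x} e → to (Accepts-below σ x 0) (proj₂ (to (event-⇔ (below σ 0) []) e)))
              , (λ {x} b → from (event-⇔ (below σ 0) []) (refl , from (Accepts-below σ x 0) b))

-- The distribution function of a sequence of independent digits, each of
-- which is 1 with probability b.
distribution : ℚ → String → ℚ
distribution b []       = 0ℚ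
distribution b (0F ∷ σ) = (1ℚ ℚ.- b) ℚ.* distribution b σ
distribution b (1F ∷ σ) = (1ℚ ℚ.- b) ℚ.+ b ℚ.* distribution b σ

capacity : ℝ → ℝ → String → ℝ
capacity b₀ b₁ σ = probability b₀ b₁ (below σ 0)

module _ (b₀ b₁ : ℝ) where

  -- The three weights sum to 1, so letters that influence only the argument of `D` do not matter as
  -- long as all the `D k` have the same probability.
  probability-skip : ∀ m r D n p → (∀ k → seq (probability b₀ b₁ (D k)) n ≡ p) →
                     seq (probability b₀ b₁ (skip m r D)) n ≡ p
  probability-skip zero    r D n p e = e r
  probability-skip (suc m) r D n p e
    rewrite probability-skip m r D n p e | probability-skip m (suc r) D n p e =
    solve 3 (λ a b p → a :* p :+ (b :* p :+ (con 1ℚ :- a :- b) :* p) := p) refl (seq b₀ n) (seq b₁ n) p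

  -- Letters 0 and 2 take the same turn, with weights summing to `1 - b₁`. The equality holds term
  -- by term of the Cauchy sequences, which reduces later estimates to a rational parameter.
  probability-below : ∀ σ r n → seq (probability b₀ b₁ (below σ r)) n ≡ distribution (seq b₁ n) σ
  probability-below []       r n = refl
  probability-below (0F ∷ σ) r n
    rewrite probability-skip r r (below σ) n _ (λ k → probability-below σ k n)
          | probability-skip r (suc r) (below σ) n _ (λ k → probability-below σ k n) =
    solve 3 (λ a b p → a :* p :+ (b :* con 0ℚ :+ (con 1ℚ :- a :- b) :* p) := (con 1ℚ :- b) :* p)
      refl (seq b₀ n) (seq b₁ n) (distribution (seq b₁ n) σ)
  probability-below (1F ∷ σ) r n
    rewrite probability-skip r r (below σ) n _ (λ k → probability-below σ k n) =
    solve 3 (λ a b p → a :* con 1ℚ :+ (b :* p :+ (con 1ℚ :- a :- b) :* con 1ℚ) := (con 1ℚ :- b) :+ b :* p)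
      refl (seq b₀ n) (seq b₁ n) (distribution (seq b₁ n) σ)

  capacity-seq : ∀ σ n → seq (capacity b₀ b₁ σ) n ≡ distribution (seq b₁ n) σ
  capacity-seq σ = probability-below σ 0

module _ {b₀ b₁ : ℝ} (μ : BorelProbabilityMeasure) (μ-d : IsMeasureOf (d b₀ b₁) μ) where

  measure-below : ∀ σ → measure μ (event (below σ 0) []) ≈ capacity b₀ b₁ σ
  measure-below σ = ≈-trans {measure μ (event (below σ 0) [])} {1ℝ * capacity b₀ b₁ σ} {capacity b₀ b₁ σ}
    (measure-event {b₀} {b₁} μ μ-d (below σ 0) [])
    (≈-pointwise {1ℝ * capacity b₀ b₁ σ} {capacity b₀ b₁ σ} λ n → ℚₚ.*-identityˡ (seq (capacity b₀ b₁ σ) n))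

-- Integers as rationals

κ : ℤ → ℚ
κ i = i / 1

ι : ℕ → ℚ
ι n = κ (+ n)

private
  toℚᵘ-/ : ∀ i n → toℚᵘ (i / suc n) ℚᵘ.≃ mkℚᵘ i n
  toℚᵘ-/ i n = ℚₚ.toℚᵘ-fromℚᵘ (mkℚᵘ i n)

κ-+ : ∀ i j → κ (i ℤ.+ j) ≡ κ i ℚ.+ κ j
κ-+ i j = ℚₚ.toℚᵘ-injective (begin
  toℚᵘ (κ (i ℤ.+ j))              ≈⟨ toℚᵘ-/ (i ℤ.+ j) 0 ⟩
  mkℚᵘ (i ℤ.+ j) 0                ≈⟨ *≡* (cong (ℤ._* + 1) (sym (cong₂ ℤ._+_ (ℤₚ.*-identityʳ i) (ℤₚ.*-identityʳ j)))) ⟩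
  mkℚᵘ i 0 ℚᵘ.+ mkℚᵘ j 0          ≈⟨ ℚᵘₚ.+-cong (ℚᵘₚ.≃-sym (toℚᵘ-/ i 0)) (ℚᵘₚ.≃-sym (toℚᵘ-/ j 0)) ⟩
  toℚᵘ (κ i) ℚᵘ.+ toℚᵘ (κ j)      ≈⟨ ℚᵘₚ.≃-sym (ℚₚ.toℚᵘ-homo-+ (κ i) (κ j)) ⟩
  toℚᵘ (κ i ℚ.+ κ j)              ∎)
  where open ℚᵘₚ.≃-Reasoning

κ-* : ∀ i j → κ (i ℤ.* j) ≡ κ i ℚ.* κ j
κ-* i j = ℚₚ.toℚᵘ-injective (begin
  toℚᵘ (κ (i ℤ.* j))              ≈⟨ toℚᵘ-/ (i ℤ.* j) 0 ⟩
  mkℚᵘ i 0 ℚᵘ.* mkℚᵘ j 0          ≈⟨ ℚᵘₚ.*-cong (ℚᵘₚ.≃-sym (toℚᵘ-/ i 0)) (ℚᵘₚ.≃-sym (toℚᵘ-/ j 0)) ⟩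
  toℚᵘ (κ i) ℚᵘ.* toℚᵘ (κ j)      ≈⟨ ℚᵘₚ.≃-sym (ℚₚ.toℚᵘ-homo-* (κ i) (κ j)) ⟩
  toℚᵘ (κ i ℚ.* κ j)              ∎)
  where open ℚᵘₚ.≃-Reasoning

κ-⊖ : ∀ m n → κ (m ⊖ n) ≡ ι m ℚ.- ι n
κ-⊖ m n = begin
  κ (m ⊖ n)                        ≡⟨ solve 2 (λ x y → x := (x :+ y) :- y) refl (κ (m ⊖ n)) (ι n) ⟩
  (κ (m ⊖ n) ℚ.+ ι n) ℚ.- ι n      ≡⟨ cong (ℚ._- ι n) (sym (κ-+ (m ⊖ n) (+ n))) ⟩
  κ (m ⊖ n ℤ.+ + n) ℚ.- ι n        ≡⟨ cong (λ i → κ i ℚ.- ι n) (trans (ℤₚ.+-comm (m ⊖ n) (+ n)) (ℤₚ.distribʳ-⊖-+-pos n m n)) ⟩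
  κ (n ℕ.+ m ⊖ n) ℚ.- ι n          ≡⟨ cong (λ i → κ i ℚ.- ι n) (trans (ℤₚ.⊖-≥ (ℕₚ.m≤m+n n m)) (cong +_ (ℕₚ.m+n∸m≡n n m))) ⟩
  ι m ℚ.- ι n                      ∎
  where open ≡-Reasoning

/-* : ∀ i n → i / suc n ℚ.* ι (suc n) ≡ κ i
/-* i n = ℚₚ.toℚᵘ-injective (begin
  toℚᵘ (i / suc n ℚ.* ι (suc n))            ≈⟨ ℚₚ.toℚᵘ-homo-* (i / suc n) (ι (suc n)) ⟩
  toℚᵘ (i / suc n) ℚᵘ.* toℚᵘ (ι (suc n))    ≈⟨ ℚᵘₚ.*-cong (toℚᵘ-/ i n) (toℚᵘ-/ (+ suc n) 0) ⟩
  mkℚᵘ i n ℚᵘ.* mkℚᵘ (+ suc n) 0            ≈⟨ *≡* (trans (ℤₚ.*-identityʳ _) (cong (λ k → i ℤ.* + k) (sym (ℕₚ.*-identityʳ (suc n))))) ⟩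
  mkℚᵘ i 0                                  ≈⟨ ℚᵘₚ.≃-sym (toℚᵘ-/ i 0) ⟩
  toℚᵘ (κ i)                                ∎)
  where open ℚᵘₚ.≃-Reasoning

ι-+ : ∀ m n → ι (m ℕ.+ n) ≡ ι m ℚ.+ ι n
ι-+ m n = κ-+ (+ m) (+ n)

ι-* : ∀ m n → ι (m ℕ.* n) ≡ ι m ℚ.* ι n
ι-* m n = trans (cong κ (ℤₚ.pos-* m n)) (κ-* (+ m) (+ n))

0≤ι : ∀ n → 0ℚ ℚ.≤ ι n
0≤ι n = ℚₚ.nonNegative⁻¹ (ι n) {{ℚₚ.normalize-nonNeg n 1}}

0<ι : ∀ n → 0ℚ ℚ.< ι (suc n)
0<ι n = ℚₚ.positive⁻¹ (ι (suc n)) {{ℚₚ.normalize-pos (suc n) 1}}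

ι-mono-≤ : ∀ {m n} → m ℕ.≤ n → ι m ℚ.≤ ι n
ι-mono-≤ {m} {n} m≤n = ≤-by (ι (n ℕ.∸ m)) (0≤ι (n ℕ.∸ m))
  (trans (cong (ℚ._- ι m) (trans (cong ι (sym (ℕₚ.m+[n∸m]≡n m≤n))) (ι-+ m (n ℕ.∸ m))))
         (solve 2 (λ m k → (m :+ k) :- m := k) refl (ι m) (ι (n ℕ.∸ m))))

ι-mono-< : ∀ {m n} → m ℕ.< n → ι m ℚ.< ι n
ι-mono-< {m} m<n = ℚₚ.<-≤-trans
  (subst₂ ℚ._<_ (ℚₚ.+-identityˡ (ι m)) (sym (ι-+ 1 m)) (ℚₚ.+-monoˡ-< (ι m) {0ℚ} {ι 1} (0<ι 0)))
  (ι-mono-≤ m<n)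

ι-cancel-≤ : ∀ {m n} → ι m ℚ.≤ ι n → m ℕ.≤ n
ι-cancel-≤ {m} {n} le with m ℕₚ.≤? n
... | yes p = p
... | no ¬p = contradiction (ℚₚ.<-≤-trans (ι-mono-< (ℕₚ.≰⇒> ¬p)) le) (ℚₚ.<-irrefl refl)

archimedean : ∀ {r} → 0ℚ ℚ.< r → ∃ λ n → 1ℚ ℚ.≤ ι n ℚ.* r
archimedean {r} 0<r = ↧ₙ r , subst (1ℚ ℚ.≤_) numerator (large r (positive 0<r))
  where
  numerator : κ (↥ r) ≡ ι (↧ₙ r) ℚ.* r
  numerator = sym (trans (ℚₚ.*-comm (ι (↧ₙ r)) r)
    (trans (cong (ℚ._* ι (↧ₙ r)) (sym (ℚₚ.↥p/↧p≡p r))) (/-* (↥ r) (ℚ.denominator-1 r))))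
  large : ∀ r → ℚ.Positive r → 1ℚ ℚ.≤ κ (↥ r)
  large (mkℚ (+ suc n) _ _) _ = ι-mono-≤ (s≤s (z≤n {n}))

0<2⁻ : ∀ n → 0ℚ ℚ.< 2⁻ n
0<2⁻ n = ℚₚ.positive⁻¹ (2⁻ n) {{ℚₚ.normalize-pos 1 (2 ℕ.^ n) {{ℕₚ.m^n≢0 2 n}}}}

2⁻-* : ∀ n → 2⁻ n ℚ.* ι (2 ℕ.^ n) ≡ 1ℚ
2⁻-* n = go (2 ℕ.^ n) {{ℕₚ.m^n≢0 2 n}}
  where
  go : ∀ k .{{_ : ℕ.NonZero k}} → + 1 / k ℚ.* ι k ≡ 1ℚ
  go (suc k) = /-* (+ 1) k

2⁻-suc : ∀ n → 2⁻ suc n ℚ.+ 2⁻ suc n ≡ 2⁻ n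
2⁻-suc n = begin
  h ℚ.+ h                      ≡⟨ sym (ℚₚ.*-identityʳ (h ℚ.+ h)) ⟩
  (h ℚ.+ h) ℚ.* 1ℚ             ≡⟨ cong ((h ℚ.+ h) ℚ.*_) (sym (2⁻-* n)) ⟩
  (h ℚ.+ h) ℚ.* (g ℚ.* w)      ≡⟨ solve 3 (λ h g w → (h :+ h) :* (g :* w) := g :* (h :* (w :+ w))) refl h g w ⟩
  g ℚ.* (h ℚ.* (w ℚ.+ w))      ≡⟨ cong (λ z → g ℚ.* (h ℚ.* z)) (sym (trans (ι-+ (2 ℕ.^ n) (2 ℕ.^ n ℕ.+ 0)) (cong (λ k → w ℚ.+ ι k) (ℕₚ.+-identityʳ (2 ℕ.^ n))))) ⟩
  g ℚ.* (h ℚ.* ι (2 ℕ.^ suc n)) ≡⟨ cong (g ℚ.*_) (2⁻-* (suc n)) ⟩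
  g ℚ.* 1ℚ                     ≡⟨ ℚₚ.*-identityʳ g ⟩
  g                            ∎
  where
  open ≡-Reasoning
  g h w : ℚ
  g = 2⁻ n
  h = 2⁻ suc n
  w = ι (2 ℕ.^ n)

n≤2^n : ∀ n → n ℕ.≤ 2 ℕ.^ n
n≤2^n zero    = z≤n
n≤2^n (suc n) = ℕₚ.≤-trans (ℕₚ.+-mono-≤ (ℕₚ.m^n>0 2 n) (n≤2^n n))
  (ℕₚ.≤-reflexive (cong (2 ℕ.^ n ℕ.+_) (sym (ℕₚ.+-identityʳ (2 ℕ.^ n)))))

ι*2⁻≤1 : ∀ n → ι n ℚ.* 2⁻ n ℚ.≤ 1ℚ
ι*2⁻≤1 n = subst (ι n ℚ.* 2⁻ n ℚ.≤_) (trans (ℚₚ.*-comm (ι (2 ℕ.^ n)) (2⁻ n)) (2⁻-* n))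
  (ℚₚ.*-monoʳ-≤-nonNeg (2⁻ n) {{nonNegative (ℚₚ.<⇒≤ (0<2⁻ n))}} (ι-mono-≤ (n≤2^n n)))

*-monoˡ : ∀ r {p q} → 0ℚ ℚ.≤ r → p ℚ.≤ q → r ℚ.* p ℚ.≤ r ℚ.* q
*-monoˡ r 0≤r = ℚₚ.*-monoˡ-≤-nonNeg r {{nonNegative 0≤r}}

*-monoʳ : ∀ r {p q} → 0ℚ ℚ.≤ r → p ℚ.≤ q → p ℚ.* r ℚ.≤ q ℚ.* r
*-monoʳ r 0≤r = ℚₚ.*-monoʳ-≤-nonNeg r {{nonNegative 0≤r}}

≤-archimedean : ∀ {x k δ} → 0ℚ ℚ.≤ x → 0ℚ ℚ.≤ δ → x ℚ.* k ℚ.≤ 1ℚ → 1ℚ ℚ.≤ k ℚ.* δ → x ℚ.≤ δ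
≤-archimedean {x} {k} {δ} 0≤x 0≤δ xk≤1 1≤kδ = begin
  x                  ≡⟨ sym (ℚₚ.*-identityʳ x) ⟩
  x ℚ.* 1ℚ           ≤⟨ *-monoˡ x 0≤x 1≤kδ ⟩
  x ℚ.* (k ℚ.* δ)    ≡⟨ sym (ℚₚ.*-assoc x k δ) ⟩
  (x ℚ.* k) ℚ.* δ    ≤⟨ *-monoʳ δ 0≤δ xk≤1 ⟩
  1ℚ ℚ.* δ           ≡⟨ ℚₚ.*-identityˡ δ ⟩
  δ                  ∎
  where open ℚₚ.≤-Reasoning

2⁻-small : ∀ {δ} → 0ℚ ℚ.< δ → ∃ λ n → ∀ m → n ℕ.≤ m → 2⁻ m ℚ.≤ δ
2⁻-small {δ} 0<δ = let n , 1≤nδ = archimedean 0<δ in n , λ m n≤m → ≤-archimedean (ℚₚ.<⇒≤ (0<2⁻ m)) (ℚₚ.<⇒≤ 0<δ)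
  (subst (ℚ._≤ 1ℚ) (ℚₚ.*-comm (ι m) (2⁻ m)) (ι*2⁻≤1 m))
  (ℚₚ.≤-trans 1≤nδ (*-monoʳ δ (ℚₚ.<⇒≤ 0<δ) (ι-mono-≤ n≤m)))

infixr 8 _^ℚ_

_^ℚ_ : ℚ → ℕ → ℚ
x ^ℚ zero  = 1ℚ
x ^ℚ suc n = x ℚ.* x ^ℚ n

0≤^ : ∀ {x} n → 0ℚ ℚ.≤ x → 0ℚ ℚ.≤ x ^ℚ n
0≤^ zero    0≤x = 0≤ι 1
0≤^ (suc n) 0≤x = 0≤* 0≤x (0≤^ n 0≤x)

-- Bernoulli's inequality without division. Passing from `n` to `n + 1` lowers the product by
-- exactly `(1 - e)^n (n + 1) e²`.
bernoulli : ∀ {e} n → 0ℚ ℚ.≤ e → 0ℚ ℚ.≤ 1ℚ ℚ.- e → (1ℚ ℚ.- e) ^ℚ n ℚ.* (1ℚ ℚ.+ ι n ℚ.* e) ℚ.≤ 1ℚ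
bernoulli {e} zero    0≤e 0≤1-e = ℚₚ.≤-reflexive (solve 1 (λ e → con 1ℚ :* (con 1ℚ :+ con 0ℚ :* e) := con 1ℚ) refl e)
bernoulli {e} (suc n) 0≤e 0≤1-e = ℚₚ.≤-trans
  (≤-by (x ℚ.* (ι (suc n) ℚ.* (e ℚ.* e))) (0≤* (0≤^ n 0≤1-e) (0≤* (0≤ι (suc n)) (0≤* 0≤e 0≤e)))
    (trans (cong (λ k → x ℚ.* (1ℚ ℚ.+ ι n ℚ.* e) ℚ.- (1ℚ ℚ.- e) ℚ.* x ℚ.* (1ℚ ℚ.+ k ℚ.* e)) (ι-+ 1 n))
      (trans
        (solve 3 (λ x e k → x :* (con 1ℚ :+ k :* e) :- (con 1ℚ :- e) :* x :* (con 1ℚ :+ (con 1ℚ :+ k) :* e) :=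
                          x :* ((con 1ℚ :+ k) :* (e :* e))) refl x e (ι n))
        (cong (λ k → x ℚ.* (k ℚ.* (e ℚ.* e))) (sym (ι-+ 1 n))))))
  (bernoulli n 0≤e 0≤1-e)
  where
  x : ℚ
  x = (1ℚ ℚ.- e) ^ℚ n

^-small : ∀ {e δ} → 0ℚ ℚ.< e → 0ℚ ℚ.≤ 1ℚ ℚ.- e → 0ℚ ℚ.< δ → ∃ λ n → (1ℚ ℚ.- e) ^ℚ n ℚ.≤ δ
^-small {e} {δ} 0<e 0≤1-e 0<δ = let n , 1≤neδ = archimedean (0<* 0<e 0<δ) in n , ≤-archimedean (0≤^ n 0≤1-e) (ℚₚ.<⇒≤ 0<δ) (bernoulli n (ℚₚ.<⇒≤ 0<e) 0≤1-e)
  (ℚₚ.≤-trans 1≤neδ (≤-by δ (ℚₚ.<⇒≤ 0<δ)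
    (solve 3 (λ k e d → (con 1ℚ :+ k :* e) :* d :- k :* (e :* d) := d) refl (ι n) e δ)))

-- The distribution function

-- The probability of the cylinder of a string in the Bernoulli process, that is, the increase of
-- the distribution function across that cylinder.
mass : ℚ → String → ℚ
mass b []       = 1ℚ
mass b (0F ∷ σ) = (1ℚ ℚ.- b) ℚ.* mass b σ
mass b (1F ∷ σ) = b ℚ.* mass b σ

module _ (b : ℚ) where

  mass-∷ʳ-0 : ∀ σ → mass b (σ ∷ʳ 0F) ≡ (1ℚ ℚ.- b) ℚ.* mass b σ
  mass-∷ʳ-0 []       = refl
  mass-∷ʳ-0 (0F ∷ σ) = cong ((1ℚ ℚ.- b) ℚ.*_) (mass-∷ʳ-0 σ)
  mass-∷ʳ-0 (1F ∷ σ) = trans (cong (b ℚ.*_) (mass-∷ʳ-0 σ))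
    (solve 2 (λ b m → b :* ((con 1ℚ :- b) :* m) := (con 1ℚ :- b) :* (b :* m)) refl b (mass b σ))

  mass-∷ʳ-1 : ∀ σ → mass b (σ ∷ʳ 1F) ≡ b ℚ.* mass b σ
  mass-∷ʳ-1 []       = refl
  mass-∷ʳ-1 (1F ∷ σ) = cong (b ℚ.*_) (mass-∷ʳ-1 σ)
  mass-∷ʳ-1 (0F ∷ σ) = trans (cong ((1ℚ ℚ.- b) ℚ.*_) (mass-∷ʳ-1 σ))
    (solve 2 (λ b m → (con 1ℚ :- b) :* (b :* m) := b :* ((con 1ℚ :- b) :* m)) refl b (mass b σ))

  distribution-∷ʳ-0 : ∀ σ → distribution b (σ ∷ʳ 0F) ≡ distribution b σ
  distribution-∷ʳ-0 []       = ℚₚ.*-zeroʳ (1ℚ ℚ.- b)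
  distribution-∷ʳ-0 (0F ∷ σ) = cong ((1ℚ ℚ.- b) ℚ.*_) (distribution-∷ʳ-0 σ)
  distribution-∷ʳ-0 (1F ∷ σ) = cong (λ g → (1ℚ ℚ.- b) ℚ.+ b ℚ.* g) (distribution-∷ʳ-0 σ)

  distribution-∷ʳ-1 : ∀ σ → distribution b (σ ∷ʳ 1F) ≡ distribution b σ ℚ.+ (1ℚ ℚ.- b) ℚ.* mass b σ
  distribution-∷ʳ-1 []       = solve 1 (λ b → con 1ℚ :- b :+ b :* con 0ℚ := con 0ℚ :+ (con 1ℚ :- b) :* con 1ℚ) refl b
  distribution-∷ʳ-1 (0F ∷ σ) = trans (cong ((1ℚ ℚ.- b) ℚ.*_) (distribution-∷ʳ-1 σ))
    (solve 3 (λ b g m → (con 1ℚ :- b) :* (g :+ (con 1ℚ :- b) :* m) :=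
                        (con 1ℚ :- b) :* g :+ (con 1ℚ :- b) :* ((con 1ℚ :- b) :* m)) refl b (distribution b σ) (mass b σ))
  distribution-∷ʳ-1 (1F ∷ σ) = trans (cong (λ g → (1ℚ ℚ.- b) ℚ.+ b ℚ.* g) (distribution-∷ʳ-1 σ))
    (solve 3 (λ b g m → (con 1ℚ :- b) :+ b :* (g :+ (con 1ℚ :- b) :* m) :=
                        ((con 1ℚ :- b) :+ b :* g) :+ (con 1ℚ :- b) :* (b :* m)) refl b (distribution b σ) (mass b σ))

Probability : ℚ → Set
Probability b = 0ℚ ℚ.≤ b × 0ℚ ℚ.≤ 1ℚ ℚ.- b

distribution-bounds : ∀ {b} → Probability b → ∀ σ → Probability (distribution b σ)
distribution-bounds p          []       = ℚₚ.≤-refl , 0≤ι 1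
distribution-bounds {b} (p , q) (0F ∷ σ) with distribution-bounds (p , q) σ
... | u , v = 0≤* q u , subst (0ℚ ℚ.≤_)
  (solve 2 (λ b g → b :+ (con 1ℚ :- b) :* (con 1ℚ :- g) := con 1ℚ :- (con 1ℚ :- b) :* g) refl b (distribution b σ))
  (0≤+ p (0≤* q v))
distribution-bounds {b} (p , q) (1F ∷ σ) with distribution-bounds (p , q) σ
... | u , v = 0≤+ q (0≤* p u) , subst (0ℚ ℚ.≤_)
  (solve 2 (λ b g → b :* (con 1ℚ :- g) := con 1ℚ :- (con 1ℚ :- b :+ b :* g)) refl b (distribution b σ))
  (0≤* p v)

-- Each digit averages two values in the unit interval, so a change of the parameter by `e`
-- contributes at most `e` per digit; averaging does not enlarge the error inherited from the tail.
distribution-lipschitz : ∀ {a b e} → Probability a → Probability b → 0ℚ ℚ.≤ e →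
  a ℚ.≤ b ℚ.+ e → b ℚ.≤ a ℚ.+ e → ∀ σ →
  distribution a σ ℚ.≤ distribution b σ ℚ.+ ι (length σ) ℚ.* e
distribution-lipschitz {a} {b} {e} pa pb 0≤e a≤b b≤a [] =
  ℚₚ.≤-reflexive (solve 1 (λ e → con 0ℚ := con 0ℚ :+ con 0ℚ :* e) refl e)
distribution-lipschitz {a} {b} {e} (p , q) pb 0≤e a≤b b≤a (0F ∷ σ) = ≤-by
  (((1ℚ ℚ.- a) ℚ.* (B ℚ.+ m ℚ.* e ℚ.- A) ℚ.+ a ℚ.* (m ℚ.* e)) ℚ.+ ((a ℚ.+ e ℚ.- b) ℚ.* B ℚ.+ e ℚ.* (1ℚ ℚ.- B)))
  (0≤+ (0≤+ (0≤* q (0≤- (distribution-lipschitz (p , q) pb 0≤e a≤b b≤a σ))) (0≤* p (0≤* (0≤ι (length σ)) 0≤e)))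
       (0≤+ (0≤* (0≤- b≤a) (proj₁ (distribution-bounds pb σ))) (0≤* 0≤e (proj₂ (distribution-bounds pb σ)))))
  (trans (cong (λ k → (1ℚ ℚ.- b) ℚ.* B ℚ.+ k ℚ.* e ℚ.- (1ℚ ℚ.- a) ℚ.* A) (ι-+ 1 (length σ)))
    (solve 6 (λ a b e A B m →
      (con 1ℚ :- b) :* B :+ (con 1ℚ :+ m) :* e :- (con 1ℚ :- a) :* A :=
      ((con 1ℚ :- a) :* (B :+ m :* e :- A) :+ a :* (m :* e)) :+ ((a :+ e :- b) :* B :+ e :* (con 1ℚ :- B)))
      refl a b e A B m))
  where
  A B m : ℚ
  A = distribution a σ
  B = distribution b σ
  m = ι (length σ)
distribution-lipschitz {a} {b} {e} (p , q) pb 0≤e a≤b b≤a (1F ∷ σ) = ≤-by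
  ((a ℚ.* (B ℚ.+ m ℚ.* e ℚ.- A) ℚ.+ (1ℚ ℚ.- a) ℚ.* (m ℚ.* e)) ℚ.+ ((a ℚ.+ e ℚ.- b) ℚ.* (1ℚ ℚ.- B) ℚ.+ e ℚ.* B))
  (0≤+ (0≤+ (0≤* p (0≤- (distribution-lipschitz (p , q) pb 0≤e a≤b b≤a σ))) (0≤* q (0≤* (0≤ι (length σ)) 0≤e)))
       (0≤+ (0≤* (0≤- b≤a) (proj₂ (distribution-bounds pb σ))) (0≤* 0≤e (proj₁ (distribution-bounds pb σ)))))
  (trans (cong (λ k → (1ℚ ℚ.- b) ℚ.+ b ℚ.* B ℚ.+ k ℚ.* e ℚ.- ((1ℚ ℚ.- a) ℚ.+ a ℚ.* A)) (ι-+ 1 (length σ)))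
    (solve 6 (λ a b e A B m →
      (con 1ℚ :- b) :+ b :* B :+ (con 1ℚ :+ m) :* e :- ((con 1ℚ :- a) :+ a :* A) :=
      (a :* (B :+ m :* e :- A) :+ (con 1ℚ :- a) :* (m :* e)) :+ ((a :+ e :- b) :* (con 1ℚ :- B) :+ e :* B))
      refl a b e A B m))
  where
  A B m : ℚ
  A = distribution a σ
  B = distribution b σ
  m = ι (length σ)

mass-bounds : ∀ {b e} → Probability b → 0ℚ ℚ.≤ 1ℚ ℚ.- e → b ℚ.≤ 1ℚ ℚ.- e → 1ℚ ℚ.- b ℚ.≤ 1ℚ ℚ.- e → ∀ σ →
              0ℚ ℚ.≤ mass b σ × mass b σ ℚ.≤ (1ℚ ℚ.- e) ^ℚ length σ
mass-bounds pb 0≤c b≤c b≥c [] = 0≤ι 1 , ℚₚ.≤-refl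
mass-bounds {b} {e} (p , q) 0≤c b≤c b≥c (i ∷ σ) with mass-bounds {b} {e} (p , q) 0≤c b≤c b≥c σ
mass-bounds {b} {e} (p , q) 0≤c b≤c b≥c (0F ∷ σ) | u , v =
  0≤* q u , ℚₚ.≤-trans (*-monoʳ (mass b σ) u b≥c) (*-monoˡ (1ℚ ℚ.- e) 0≤c v)
mass-bounds {b} {e} (p , q) 0≤c b≤c b≥c (1F ∷ σ) | u , v =
  0≤* p u , ℚₚ.≤-trans (*-monoʳ (mass b σ) u b≤c) (*-monoˡ (1ℚ ℚ.- e) 0≤c v)

-- Greedy expansion of `γ`: the interval that starts at `distribution b σ` and has length `mass b σ`
-- is cut in the ratio `1 - b` to `b`, and the part containing `γ` is kept.
expansion : ∀ b {γ} → 0ℚ ℚ.≤ γ → γ ℚ.< 1ℚ → ∀ m → ∃ λ σ →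
            length σ ≡ m × distribution b σ ℚ.≤ γ × γ ℚ.< distribution b σ ℚ.+ mass b σ
expansion b {γ} 0≤γ γ<1 zero = [] , refl , 0≤γ , γ<1
expansion b {γ} 0≤γ γ<1 (suc m) with expansion b 0≤γ γ<1 m
... | σ , refl , lo , hi with γ ℚₚ.<? distribution b σ ℚ.+ (1ℚ ℚ.- b) ℚ.* mass b σ
...   | yes l = σ ∷ʳ 0F , length-∷ʳ σ 0F
        , subst (ℚ._≤ γ) (sym (distribution-∷ʳ-0 b σ)) lo
        , subst₂ (λ g m → γ ℚ.< g ℚ.+ m) (sym (distribution-∷ʳ-0 b σ)) (sym (mass-∷ʳ-0 b σ)) l
...   | no ¬l = σ ∷ʳ 1F , length-∷ʳ σ 1F
        , subst (ℚ._≤ γ) (sym (distribution-∷ʳ-1 b σ)) (ℚₚ.≮⇒≥ ¬l)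
        , subst (γ ℚ.<_) (trans
            (solve 3 (λ b g m → g :+ m := (g :+ (con 1ℚ :- b) :* m) :+ b :* m) refl b (distribution b σ) (mass b σ))
            (sym (cong₂ ℚ._+_ (distribution-∷ʳ-1 b σ) (mass-∷ʳ-1 b σ)))) hi

-- Density of the capacities of initial segments

Balanced : ℝ → Set
Balanced b = ∃ λ e → 0ℚ ℚ.< e × Eventually λ n → e ℚ.≤ seq b n × e ℚ.≤ 1ℚ ℚ.- seq b n

-- One bound serves both digits: `1 - b₁` exceeds `b₀`, hence is at least `b₁`. The comparison of
-- `b₁` with `b₀` is taken with tolerance `ε`, the gap in `b₀ + b₁ < 1`, so that the two cancel.
-- Bounded away from 0 and 1, the digit probabilities make cylinder masses shrink geometrically.
balanced : ∀ {b₀ b₁} → 0ℝ < b₁ → b₁ ≤ b₀ → b₀ + b₁ < 1ℝ → Balanced b₁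
balanced {b₀} {b₁} (e , 0<e , pos) b₁≤b₀ (ε , 0<ε , lt) = e , 0<e , map₃ᵉ
  (λ n p q r → subst (ℚ._≤ seq b₁ n) (ℚₚ.+-identityˡ e) p
    , ≤-by (((1ℚ ℚ.- (seq b₀ n ℚ.+ seq b₁ n ℚ.+ ε)) ℚ.+ (seq b₀ n ℚ.+ ε ℚ.- seq b₁ n)) ℚ.+ (seq b₁ n ℚ.- (0ℚ ℚ.+ e)))
        (0≤+ (0≤+ (0≤- r) (0≤- q)) (0≤- p))
        (solve 4 (λ a b e ε → (con 1ℚ :- b) :- e :=
          ((con 1ℚ :- (a :+ b :+ ε)) :+ (a :+ ε :- b)) :+ (b :- (con 0ℚ :+ e))) refl (seq b₀ n) (seq b₁ n) e ε))
  pos (b₁≤b₀ ε 0<ε) lt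

module _ {b₀ b₁ : ℝ} (bal : Balanced b₁) where

  -- The string is found for the rational parameter at a single late index `N`, by expanding a
  -- target between the bounds. Since `b₁` and `x` hardly move after `N`, the same string works at
  -- all later indices.
  capacity-dense : ∀ {x y} → 0ℝ ≤ x → x < y → x < 1ℝ →
                   ∃ λ σ → x < capacity b₀ b₁ σ × capacity b₀ b₁ σ < y
  capacity-dense {x} {y} 0≤x (ε₁ , 0<ε₁ , x<y) (ε₂ , 0<ε₂ , x<1) =
      σ , (δ , 0<δ , N , λ n N≤n → subst (seq x n ℚ.+ δ ℚ.≤_) (sym (capacity-seq b₀ b₁ σ n)) (lower n N≤n))
        , (δ , 0<δ , N , λ n N≤n → subst (λ g → g ℚ.+ δ ℚ.≤ seq y n) (sym (capacity-seq b₀ b₁ σ n)) (upper n N≤n))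
    where
    ε e δ η : ℚ
    ε = ε₁ ℚ.⊓ ε₂
    e = proj₁ bal
    0<e : 0ℚ ℚ.< e
    0<e = proj₁ (proj₂ bal)
    0<ε : 0ℚ ℚ.< ε
    0<ε with ℚₚ.⊓-sel ε₁ ε₂
    ... | inj₁ p = subst (0ℚ ℚ.<_) (sym p) 0<ε₁
    ... | inj₂ p = subst (0ℚ ℚ.<_) (sym p) 0<ε₂
    -- An eighth of the smaller gap: the errors in `lower` use up four units and those in `upper` at
    -- most seven.
    δ = ε ℚ.* ½ ℚ.* ½ ℚ.* ½
    0<δ : 0ℚ ℚ.< δ
    0<δ = halve (halve (halve 0<ε))
    8δ≡ε : (δ ℚ.+ δ ℚ.+ (δ ℚ.+ δ)) ℚ.+ (δ ℚ.+ δ ℚ.+ (δ ℚ.+ δ)) ≡ ε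
    8δ≡ε = solve 1 (λ e → let d = e :* con ½ :* con ½ :* con ½ in
      (d :+ d :+ (d :+ d)) :+ (d :+ d :+ (d :+ d)) := e) refl ε
    8δ≤ε₁ : (δ ℚ.+ δ ℚ.+ (δ ℚ.+ δ)) ℚ.+ (δ ℚ.+ δ ℚ.+ (δ ℚ.+ δ)) ℚ.≤ ε₁
    8δ≤ε₁ = ℚₚ.≤-trans (ℚₚ.≤-reflexive 8δ≡ε) (ℚₚ.p⊓q≤p ε₁ ε₂)
    8δ≤ε₂ : (δ ℚ.+ δ ℚ.+ (δ ℚ.+ δ)) ℚ.+ (δ ℚ.+ δ ℚ.+ (δ ℚ.+ δ)) ℚ.≤ ε₂
    8δ≤ε₂ = ℚₚ.≤-trans (ℚₚ.≤-reflexive 8δ≡ε) (ℚₚ.p⊓q≤q ε₁ ε₂)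

    eventually : Eventually λ n → (0ℚ ℚ.≤ seq x n ℚ.+ δ × seq x n ℚ.+ ε₁ ℚ.≤ seq y n) ×
                                  (seq x n ℚ.+ ε₂ ℚ.≤ 1ℚ × (e ℚ.≤ seq b₁ n × e ℚ.≤ 1ℚ ℚ.- seq b₁ n))
    eventually = map₂ᵉ (λ _ → _,_) (map₂ᵉ (λ _ → _,_) (0≤x δ 0<δ) x<y) (map₂ᵉ (λ _ → _,_) x<1 (proj₂ (proj₂ bal)))

    0≤1-e : 0ℚ ℚ.≤ 1ℚ ℚ.- e
    0≤1-e = let n , _ , _ , p , q = witness eventually in ≤-by ((seq b₁ n ℚ.- e) ℚ.+ (1ℚ ℚ.- seq b₁ n ℚ.- e) ℚ.+ e)
      (0≤+ (0≤+ (0≤- p) (0≤- q)) (ℚₚ.<⇒≤ 0<e))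
      (solve 2 (λ b e → con 1ℚ :- e :- con 0ℚ := (b :- e) :+ (con 1ℚ :- b :- e) :+ e) refl (seq b₁ n) e)

    m : ℕ
    m = proj₁ (^-small 0<e 0≤1-e 0<δ)
    -- At strings of length `m` the distribution function is `m`-Lipschitz in the parameter, and `m`
    -- times this is at most `δ`.
    η = δ ℚ.* 2⁻ m
    0<η : 0ℚ ℚ.< η
    0<η = 0<* 0<δ (0<2⁻ m)
    mη≤δ : ι m ℚ.* η ℚ.≤ δ
    mη≤δ = subst₂ ℚ._≤_
      (solve 3 (λ m d h → d :* (m :* h) := m :* (d :* h)) refl (ι m) δ (2⁻ m)) (ℚₚ.*-identityʳ δ)
      (*-monoˡ δ (ℚₚ.<⇒≤ 0<δ) (ι*2⁻≤1 m))

    L M N : ℕ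
    L = proj₁ eventually
    M = proj₁ (close x δ 0<δ) ℕ.⊔ proj₁ (close b₁ η 0<η)
    N = L ℕ.⊔ M

    facts : ∀ n → N ℕ.≤ n → _
    facts n N≤n = proj₂ eventually n (ℕₚ.m⊔n≤o⇒m≤o L M N≤n)

    close-x : ∀ n k → N ℕ.≤ n → N ℕ.≤ k → seq x n ℚ.≤ seq x k ℚ.+ δ
    close-x n k N≤n N≤k = proj₂ (close x δ 0<δ) n k
      (ℕₚ.m⊔n≤o⇒m≤o (proj₁ (close x δ 0<δ)) _ (ℕₚ.m⊔n≤o⇒n≤o L M N≤n))
      (ℕₚ.m⊔n≤o⇒m≤o (proj₁ (close x δ 0<δ)) _ (ℕₚ.m⊔n≤o⇒n≤o L M N≤k))

    close-b : ∀ n k → N ℕ.≤ n → N ℕ.≤ k → seq b₁ n ℚ.≤ seq b₁ k ℚ.+ η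
    close-b n k N≤n N≤k = proj₂ (close b₁ η 0<η) n k
      (ℕₚ.m⊔n≤o⇒n≤o (proj₁ (close x δ 0<δ)) _ (ℕₚ.m⊔n≤o⇒n≤o L M N≤n))
      (ℕₚ.m⊔n≤o⇒n≤o (proj₁ (close x δ 0<δ)) _ (ℕₚ.m⊔n≤o⇒n≤o L M N≤k))

    prob : ∀ n → N ℕ.≤ n → Probability (seq b₁ n)
    prob n N≤n = let _ , _ , p , q = facts n N≤n in
      ℚₚ.≤-trans (ℚₚ.<⇒≤ 0<e) p , ℚₚ.≤-trans (ℚₚ.<⇒≤ 0<e) q

    b γ X : ℚ
    b = seq b₁ N
    X = seq x N
    -- Aiming four units above `x` leaves one each for the mass of the last cylinder, the drift of
    -- `b₁`, the drift of `x` and the strictness of the lower inequality.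
    γ = X ℚ.+ (δ ℚ.+ δ ℚ.+ (δ ℚ.+ δ))

    0≤γ : 0ℚ ℚ.≤ γ
    0≤γ = ≤-by ((X ℚ.+ δ ℚ.- 0ℚ) ℚ.+ (δ ℚ.+ (δ ℚ.+ δ)))
      (0≤+ (0≤- (proj₁ (proj₁ (facts N ℕₚ.≤-refl)))) (0≤+ (ℚₚ.<⇒≤ 0<δ) (0≤+ (ℚₚ.<⇒≤ 0<δ) (ℚₚ.<⇒≤ 0<δ))))
      (solve 2 (λ x d → (x :+ (d :+ d :+ (d :+ d))) :- con 0ℚ := (x :+ d :- con 0ℚ) :+ (d :+ (d :+ d))) refl X δ)

    γ<1 : γ ℚ.< 1ℚ
    γ<1 = ℚₚ.<-≤-trans
      (subst (ℚ._< γ ℚ.+ δ) (ℚₚ.+-identityʳ γ) (ℚₚ.+-monoʳ-< γ {0ℚ} {δ} 0<δ))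
      (≤-by ((1ℚ ℚ.- (X ℚ.+ ε₂)) ℚ.+ ((ε₂ ℚ.- ((δ ℚ.+ δ ℚ.+ (δ ℚ.+ δ)) ℚ.+ (δ ℚ.+ δ ℚ.+ (δ ℚ.+ δ)))) ℚ.+ (δ ℚ.+ (δ ℚ.+ δ))))
        (0≤+ (0≤- (proj₁ (proj₂ (facts N ℕₚ.≤-refl))))
          (0≤+ (0≤- 8δ≤ε₂) (0≤+ (ℚₚ.<⇒≤ 0<δ) (0≤+ (ℚₚ.<⇒≤ 0<δ) (ℚₚ.<⇒≤ 0<δ)))))
        (solve 3 (λ x d e → con 1ℚ :- (x :+ (d :+ d :+ (d :+ d)) :+ d) :=
          (con 1ℚ :- (x :+ e)) :+ ((e :- ((d :+ d :+ (d :+ d)) :+ (d :+ d :+ (d :+ d)))) :+ (d :+ (d :+ d)))) refl X δ ε₂))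

    σ : String
    σ = proj₁ (expansion b 0≤γ γ<1 m)

    |σ|≡m : length σ ≡ m
    |σ|≡m = proj₁ (proj₂ (expansion b 0≤γ γ<1 m))

    mass≤δ : mass b σ ℚ.≤ δ
    mass≤δ = let _ , _ , p , q = facts N ℕₚ.≤-refl in
      ℚₚ.≤-trans (proj₂ (mass-bounds {b} {e} (prob N ℕₚ.≤-refl) 0≤1-e
        (≤-by (1ℚ ℚ.- b ℚ.- e) (0≤- q) (solve 2 (λ b e → con 1ℚ :- e :- b := con 1ℚ :- b :- e) refl b e))
        (≤-by (b ℚ.- e) (0≤- p) (solve 2 (λ b e → con 1ℚ :- e :- (con 1ℚ :- b) := b :- e) refl b e)) σ))
      (subst (λ k → (1ℚ ℚ.- e) ^ℚ k ℚ.≤ δ) (sym |σ|≡m) (proj₂ (^-small 0<e 0≤1-e 0<δ)))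

    drift : ∀ a c → Probability a → Probability c → a ℚ.≤ c ℚ.+ η → c ℚ.≤ a ℚ.+ η →
            distribution a σ ℚ.≤ distribution c σ ℚ.+ δ
    drift a c pa pc a≤c c≤a = ℚₚ.≤-trans (distribution-lipschitz pa pc (ℚₚ.<⇒≤ 0<η) a≤c c≤a σ)
      (ℚₚ.+-monoʳ-≤ (distribution c σ) (subst (λ k → ι k ℚ.* η ℚ.≤ δ) (sym |σ|≡m) mη≤δ))

    lower : ∀ n → N ℕ.≤ n → seq x n ℚ.+ δ ℚ.≤ distribution (seq b₁ n) σ
    lower n N≤n = ≤-by
      (((g ℚ.+ δ ℚ.- G) ℚ.+ (G ℚ.+ mass b σ ℚ.- γ)) ℚ.+ ((δ ℚ.- mass b σ) ℚ.+ (X ℚ.+ δ ℚ.- seq x n)))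
      (0≤+ (0≤+ (0≤- (drift b (seq b₁ n) (prob N ℕₚ.≤-refl) (prob n N≤n) (close-b N n ℕₚ.≤-refl N≤n) (close-b n N N≤n ℕₚ.≤-refl)))
                (0≤- (ℚₚ.<⇒≤ (proj₂ (proj₂ (proj₂ (expansion b 0≤γ γ<1 m)))))))
           (0≤+ (0≤- mass≤δ) (0≤- (close-x n N N≤n ℕₚ.≤-refl))))
      (solve 6 (λ g G mass x X d →
        g :- (x :+ d) :=
        ((g :+ d :- G) :+ (G :+ mass :- (X :+ (d :+ d :+ (d :+ d))))) :+ ((d :- mass) :+ (X :+ d :- x)))
        refl g G (mass b σ) (seq x n) X δ)
      where
      g G : ℚ
      g = distribution (seq b₁ n) σ
      G = distribution b σ

    upper : ∀ n → N ℕ.≤ n → distribution (seq b₁ n) σ ℚ.+ δ ℚ.≤ seq y n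
    upper n N≤n = ≤-by
      ((((G ℚ.+ δ ℚ.- g) ℚ.+ (γ ℚ.- G)) ℚ.+ ((seq x n ℚ.+ δ ℚ.- X) ℚ.+ (seq y n ℚ.- (seq x n ℚ.+ ε₁)))) ℚ.+
        ((ε₁ ℚ.- ((δ ℚ.+ δ ℚ.+ (δ ℚ.+ δ)) ℚ.+ (δ ℚ.+ δ ℚ.+ (δ ℚ.+ δ)))) ℚ.+ δ))
      (0≤+ (0≤+ (0≤+ (0≤- (drift (seq b₁ n) b (prob n N≤n) (prob N ℕₚ.≤-refl) (close-b n N N≤n ℕₚ.≤-refl) (close-b N n ℕₚ.≤-refl N≤n)))
                     (0≤- (proj₁ (proj₂ (proj₂ (expansion b 0≤γ γ<1 m))))))
                (0≤+ (0≤- (close-x N n ℕₚ.≤-refl N≤n)) (0≤- (proj₂ (proj₁ (facts n N≤n))))))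
           (0≤+ (0≤- 8δ≤ε₁) (ℚₚ.<⇒≤ 0<δ)))
      (solve 7 (λ g G y x X d e →
        y :- (g :+ d) :=
        (((G :+ d :- g) :+ ((X :+ (d :+ d :+ (d :+ d))) :- G)) :+ ((x :+ d :- X) :+ (y :- (x :+ e)))) :+
        ((e :- ((d :+ d :+ (d :+ d)) :+ (d :+ d :+ (d :+ d)))) :+ d))
        refl g G (seq y n) (seq x n) X δ ε₁)
      where
      g G : ℚ
      g = distribution (seq b₁ n) σ
      G = distribution b σ

-- Computing the distribution function

distribution-padded : ∀ b σ k → distribution b (σ ++ replicate k 0F) ≡ distribution b σ
distribution-padded b []       zero    = refl
distribution-padded b []       (suc k) =
  trans (cong ((1ℚ ℚ.- b) ℚ.*_) (distribution-padded b [] k)) (ℚₚ.*-zeroʳ (1ℚ ℚ.- b))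
distribution-padded b (0F ∷ σ) k = cong ((1ℚ ℚ.- b) ℚ.*_) (distribution-padded b σ k)
distribution-padded b (1F ∷ σ) k = cong (λ g → (1ℚ ℚ.- b) ℚ.+ b ℚ.* g) (distribution-padded b σ k)

applyUpTo-padded : ∀ σ (s : Cantor) → (∀ j → s j ≡ (σ ▹ zeros) j) → ∀ n → length σ ℕ.≤ n →
                   ∃ λ k → applyUpTo s n ≡ σ ++ replicate k 0F
applyUpTo-padded []      s e zero    _       = 0 , refl
applyUpTo-padded []      s e (suc n) _       =
  let k , p = applyUpTo-padded [] (s ∘ suc) (e ∘ suc) n z≤n in suc k , cong₂ _∷_ (e 0) p
applyUpTo-padded (i ∷ σ) s e (suc n) (s≤s l) =
  let k , p = applyUpTo-padded σ (s ∘ suc) (e ∘ suc) n l in k , cong₂ _∷_ (e 0) p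

-- Trailing zeros do not change the initial segment, so a single number can
-- serve both as a string and as a precision.
padded-code : ∀ σ k → ∃ λ w → k ℕ.≤ w × (∀ b → distribution b (bits w) ≡ distribution b σ)
padded-code σ k = w , ℕₚ.≤-trans k≤ (length≤codeString τ) , λ b →
    trans (cong (distribution b) (proj₂ padded))
      (trans (distribution-padded b τ (proj₁ padded)) (distribution-padded b σ k))
  where
  τ : String
  τ = σ ++ replicate k 0F
  w : ℕ
  w = codeString τ
  k≤ : k ℕ.≤ length τ
  k≤ = subst (k ℕ.≤_) (sym (trans (Listₚ.length-++ σ) (cong (length σ ℕ.+_) (Listₚ.length-replicate k)))) (ℕₚ.m≤n+m k (length σ))
  padded : ∃ λ j → bits w ≡ τ ++ replicate j 0F
  padded = applyUpTo-padded τ (digit w) (digit-codeString τ) w (length≤codeString τ)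

-- Numerators of mass and distribution for b = u / v

module _ (u v : ℕ) (s : Cantor) where

  -- The common denominator is `v ^ i`. The recursion appends digits, as primitive recursion in the
  -- length requires, whereas `mass` and `distribution` recurse from the front.
  massNumerator : ℕ → ℕ
  massNumerator zero    = 1
  massNumerator (suc i) = choose (toℕ (s i)) (u ℕ.* massNumerator i) ((v ℕ.∸ u) ℕ.* massNumerator i)

  distributionNumerator : ℕ → ℕ
  distributionNumerator zero    = 0
  distributionNumerator (suc i) = distributionNumerator i ℕ.* v ℕ.+ toℕ (s i) ℕ.* ((v ℕ.∸ u) ℕ.* massNumerator i)

  module _ {b : ℚ} (bv≡u : b ℚ.* ι v ≡ ι u) (u≤v : u ℕ.≤ v) where

    private
      [1-b]v : (1ℚ ℚ.- b) ℚ.* ι v ≡ ι (v ℕ.∸ u)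
      [1-b]v = trans (solve 2 (λ b v → (con 1ℚ :- b) :* v := v :- b :* v) refl b (ι v))
        (trans (cong (λ z → ι v ℚ.- z) bv≡u)
          (trans (cong (ℚ._- ι u) (trans (cong ι (sym (ℕₚ.m∸n+n≡m u≤v))) (ι-+ (v ℕ.∸ u) u)))
            (solve 2 (λ d u → (d :+ u) :- u := d) refl (ι (v ℕ.∸ u)) (ι u))))

      scale : ∀ x n p y → x ℚ.* ι v ≡ ι n → y ≡ ι p → ι (n ℕ.* p) ≡ x ℚ.* (ι v ℚ.* y)
      scale x n p y e f = trans (ι-* n p) (trans (cong₂ ℚ._*_ (sym e) (sym f)) (ℚₚ.*-assoc x (ι v) y))

    massNumerator-correct : ∀ i → mass b (applyUpTo s i) ℚ.* ι (v ℕ.^ i) ≡ ι (massNumerator i)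
    massNumerator-correct zero    = refl
    massNumerator-correct (suc i) = trans
      (cong₂ ℚ._*_ (cong (mass b) (sym (Listₚ.applyUpTo-∷ʳ s i))) (ι-* v (v ℕ.^ i)))
      (go (s i))
      where
      σ : String
      σ = applyUpTo s i
      m : ℕ
      m = massNumerator i
      go : ∀ c → mass b (σ ∷ʳ c) ℚ.* (ι v ℚ.* ι (v ℕ.^ i)) ≡ ι (choose (toℕ c) (u ℕ.* m) ((v ℕ.∸ u) ℕ.* m))
      go 0F = trans (trans (cong (ℚ._* (ι v ℚ.* ι (v ℕ.^ i))) (mass-∷ʳ-0 b σ))
          (solve 4 (λ b m v p → ((con 1ℚ :- b) :* m) :* (v :* p) := (con 1ℚ :- b) :* (v :* (m :* p))) refl
            b (mass b σ) (ι v) (ι (v ℕ.^ i))))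
        (trans (sym (scale (1ℚ ℚ.- b) (v ℕ.∸ u) m _ [1-b]v (massNumerator-correct i)))
          (cong ι (sym (choose-0 (u ℕ.* m) ((v ℕ.∸ u) ℕ.* m)))))
      go 1F = trans (trans (cong (ℚ._* (ι v ℚ.* ι (v ℕ.^ i))) (mass-∷ʳ-1 b σ))
          (solve 4 (λ b m v p → (b :* m) :* (v :* p) := b :* (v :* (m :* p))) refl
            b (mass b σ) (ι v) (ι (v ℕ.^ i))))
        (trans (sym (scale b u m _ bv≡u (massNumerator-correct i)))
          (cong ι (sym (choose-1 (u ℕ.* m) ((v ℕ.∸ u) ℕ.* m)))))

    distributionNumerator-correct : ∀ i → distribution b (applyUpTo s i) ℚ.* ι (v ℕ.^ i) ≡ ι (distributionNumerator i)
    distributionNumerator-correct zero    = refl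
    distributionNumerator-correct (suc i) = trans
      (cong₂ ℚ._*_ (cong (distribution b) (sym (Listₚ.applyUpTo-∷ʳ s i))) (ι-* v (v ℕ.^ i)))
      (go (s i))
      where
      σ : String
      σ = applyUpTo s i
      n m : ℕ
      n = distributionNumerator i
      m = massNumerator i
      ι-n : distribution b σ ℚ.* (ι v ℚ.* ι (v ℕ.^ i)) ≡ ι (n ℕ.* v)
      ι-n = trans (solve 3 (λ g v p → g :* (v :* p) := (g :* p) :* v) refl (distribution b σ) (ι v) (ι (v ℕ.^ i)))
        (trans (cong (ℚ._* ι v) (distributionNumerator-correct i)) (sym (ι-* n v)))
      go : ∀ c → distribution b (σ ∷ʳ c) ℚ.* (ι v ℚ.* ι (v ℕ.^ i)) ≡ ι (n ℕ.* v ℕ.+ toℕ c ℕ.* ((v ℕ.∸ u) ℕ.* m))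
      go 0F = trans (cong (ℚ._* (ι v ℚ.* ι (v ℕ.^ i))) (distribution-∷ʳ-0 b σ))
        (trans ι-n (cong ι (sym (ℕₚ.+-identityʳ (n ℕ.* v)))))
      go 1F = trans (trans (cong (ℚ._* (ι v ℚ.* ι (v ℕ.^ i))) (distribution-∷ʳ-1 b σ))
          (solve 5 (λ b g m v p → (g :+ (con 1ℚ :- b) :* m) :* (v :* p) :=
                                  g :* (v :* p) :+ (con 1ℚ :- b) :* (v :* (m :* p))) refl
            b (distribution b σ) (mass b σ) (ι v) (ι (v ℕ.^ i))))
        (trans (cong₂ ℚ._+_ ι-n (sym (scale (1ℚ ℚ.- b) (v ℕ.∸ u) m _ [1-b]v (massNumerator-correct i))))
          (trans (sym (ι-+ (n ℕ.* v) ((v ℕ.∸ u) ℕ.* m)))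
            (cong (λ k → ι (n ℕ.* v ℕ.+ k)) (sym (ℕₚ.*-identityˡ ((v ℕ.∸ u) ℕ.* m))))))

distributionNumeratorᶜ : ∀ {k} {u v w : Vec ℕ k → ℕ} → Computable u → Computable v → Computable w →
  Computable (λ xs → distributionNumerator (u xs) (v xs) (digit (w xs)) (w xs))
distributionNumeratorᶜ uᶜ vᶜ wᶜ = compᶜ
  {f = λ xs → distributionNumerator (lookup xs 1F) (lookup xs 2F) (digit (lookup xs 3F)) (lookup xs 0F)}
  (recᶜ _ (constᶜ 0)
    (varᶜ 1F *ᶜ varᶜ 3F +ᶜ digitᶜ (varᶜ 4F) (varᶜ 0F) *ᶜ ((varᶜ 3F ∸ᶜ varᶜ 2F) *ᶜ massᶜ))
    (λ _ → refl) (λ _ _ → refl))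
  (wᶜ ∷ uᶜ ∷ vᶜ ∷ wᶜ ∷ [])
  where
  massᶜ : Computable {5} (λ xs → massNumerator (lookup xs 2F) (lookup xs 3F) (digit (lookup xs 4F)) (lookup xs 0F))
  massᶜ = compᶜ
    {f = λ xs → massNumerator (lookup xs 1F) (lookup xs 2F) (digit (lookup xs 3F)) (lookup xs 0F)}
    (recᶜ _ (constᶜ 1)
      (chooseᶜ (digitᶜ (varᶜ 4F) (varᶜ 0F)) (varᶜ 2F *ᶜ varᶜ 1F) ((varᶜ 3F ∸ᶜ varᶜ 2F) *ᶜ varᶜ 1F))
      (λ _ → refl) (λ _ _ → refl))
    (varᶜ 0F ∷ varᶜ 2F ∷ varᶜ 3F ∷ varᶜ 4F ∷ [])

-- Rational inequalities decided by natural numbers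

cross : ∀ {x y K} L R → 0ℚ ℚ.< K → (y ℚ.- x) ℚ.* K ≡ ι R ℚ.- ι L → x ℚ.≤ y ⇔ L ℕ.≤ R
cross {x} {y} {K} L R 0<K e = mk⇔
  (λ x≤y → ι-cancel-≤ (≤-by ((y ℚ.- x) ℚ.* K) (0≤* (0≤- x≤y) (ℚₚ.<⇒≤ 0<K)) (sym e)))
  (λ L≤R → ℚₚ.*-cancelʳ-≤-pos K {{positive 0<K}} (≤-by (ι R ℚ.- ι L) (0≤- (ι-mono-≤ L≤R))
    (trans (solve 3 (λ x y k → y :* k :- x :* k := (y :- x) :* k) refl x y K) e)))

⊖/-* : ∀ a b c → (a ⊖ b) / suc c ℚ.* ι (suc c) ≡ ι a ℚ.- ι b
⊖/-* a b c = trans (/-* (a ⊖ b) c) (κ-⊖ a b)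

-- Programs handle only naturals, so both inequalities are multiplied by the common denominator
-- `C * (W * d)`. The terms with `b` are moved to the other side, because subtraction of naturals
-- would truncate.
module Margins (a b c n d w : ℕ) {g : ℚ} (0<d : 0ℚ ℚ.< ι d) (gd≡n : g ℚ.* ι d ≡ ι n) where

  private
    C W : ℕ
    C = suc c
    W = 2 ℕ.^ w
    r e : ℚ
    r = (a ⊖ b) / suc c
    e = 2⁻ w
    0<K : 0ℚ ℚ.< ι C ℚ.* (ι W ℚ.* ι d)
    0<K = 0<* (0<ι c) (0<* (ℚₚ.<-≤-trans (0<ι 0) (ι-mono-≤ (ℕₚ.m^n>0 2 w))) 0<d)
    a≡ : ι a ≡ r ℚ.* ι C ℚ.+ ι b
    a≡ = trans (solve 2 (λ a b → a := (a :- b) :+ b) refl (ι a) (ι b)) (cong (ℚ._+ ι b) (sym (⊖/-* a b c)))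

  3e : ℚ
  3e = e ℚ.+ e ℚ.+ e

  lowerLeft lowerRight upperLeft upperRight : ℕ
  lowerLeft  = (a ℕ.* W ℕ.+ 3 ℕ.* C) ℕ.* d
  lowerRight = n ℕ.* (C ℕ.* W) ℕ.+ b ℕ.* (W ℕ.* d)
  upperLeft  = (n ℕ.* W ℕ.+ 3 ℕ.* d) ℕ.* C ℕ.+ b ℕ.* (W ℕ.* d)
  upperRight = a ℕ.* (W ℕ.* d)

  private
    ι-**  : ∀ x y z → ι (x ℕ.* (y ℕ.* z)) ≡ ι x ℚ.* (ι y ℚ.* ι z)
    ι-** x y z = trans (ι-* x (y ℕ.* z)) (cong (ι x ℚ.*_) (ι-* y z))

    ι-sum : ∀ x y z t → ι ((x ℕ.* y ℕ.+ 3 ℕ.* z) ℕ.* t) ≡ (ι x ℚ.* ι y ℚ.+ ι 3 ℚ.* (1ℚ ℚ.* ι z)) ℚ.* ι t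
    ι-sum x y z t = trans (ι-* (x ℕ.* y ℕ.+ 3 ℕ.* z) t) (cong (ℚ._* ι t)
      (trans (ι-+ (x ℕ.* y) (3 ℕ.* z)) (cong₂ ℚ._+_ (ι-* x y)
        (trans (ι-* 3 z) (cong (ι 3 ℚ.*_) (sym (ℚₚ.*-identityˡ (ι z))))))))

  lower : r ℚ.+ 3e ℚ.≤ g ⇔ lowerLeft ℕ.≤ lowerRight
  lower = cross {r ℚ.+ 3e} {g} lowerLeft lowerRight 0<K (begin
    (g ℚ.- (r ℚ.+ 3e)) ℚ.* (ι C ℚ.* (ι W ℚ.* ι d))
      ≡⟨ solve 7 (λ g r e b C W D →
           (g :- (r :+ (e :+ e :+ e))) :* (C :* (W :* D)) :=
           ((g :* D) :* (C :* W) :+ b :* (W :* D)) :- ((r :* C :+ b) :* W :+ con (ι 3) :* ((e :* W) :* C)) :* D)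
           refl g r e (ι b) (ι C) (ι W) (ι d) ⟩
    ((g ℚ.* ι d) ℚ.* (ι C ℚ.* ι W) ℚ.+ ι b ℚ.* (ι W ℚ.* ι d)) ℚ.- ((r ℚ.* ι C ℚ.+ ι b) ℚ.* ι W ℚ.+ ι 3 ℚ.* ((e ℚ.* ι W) ℚ.* ι C)) ℚ.* ι d
      ≡⟨ cong₂ (λ y z → (y ℚ.* (ι C ℚ.* ι W) ℚ.+ ι b ℚ.* (ι W ℚ.* ι d)) ℚ.- ((r ℚ.* ι C ℚ.+ ι b) ℚ.* ι W ℚ.+ ι 3 ℚ.* (z ℚ.* ι C)) ℚ.* ι d)
           gd≡n (2⁻-* w) ⟩
    (ι n ℚ.* (ι C ℚ.* ι W) ℚ.+ ι b ℚ.* (ι W ℚ.* ι d)) ℚ.- ((r ℚ.* ι C ℚ.+ ι b) ℚ.* ι W ℚ.+ ι 3 ℚ.* (1ℚ ℚ.* ι C)) ℚ.* ι d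
      ≡⟨ cong (λ y → (ι n ℚ.* (ι C ℚ.* ι W) ℚ.+ ι b ℚ.* (ι W ℚ.* ι d)) ℚ.- (y ℚ.* ι W ℚ.+ ι 3 ℚ.* (1ℚ ℚ.* ι C)) ℚ.* ι d) (sym a≡) ⟩
    (ι n ℚ.* (ι C ℚ.* ι W) ℚ.+ ι b ℚ.* (ι W ℚ.* ι d)) ℚ.- (ι a ℚ.* ι W ℚ.+ ι 3 ℚ.* (1ℚ ℚ.* ι C)) ℚ.* ι d
      ≡⟨ sym (cong₂ ℚ._-_ (trans (ι-+ (n ℕ.* (C ℕ.* W)) (b ℕ.* (W ℕ.* d))) (cong₂ ℚ._+_ (ι-** n C W) (ι-** b W d))) (ι-sum a W C d)) ⟩
    ι lowerRight ℚ.- ι lowerLeft ∎)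
    where open ≡-Reasoning

  upper : g ℚ.+ 3e ℚ.≤ r ⇔ upperLeft ℕ.≤ upperRight
  upper = cross {g ℚ.+ 3e} {r} upperLeft upperRight 0<K (begin
    (r ℚ.- (g ℚ.+ 3e)) ℚ.* (ι C ℚ.* (ι W ℚ.* ι d))
      ≡⟨ solve 7 (λ g r e b C W D →
           (r :- (g :+ (e :+ e :+ e))) :* (C :* (W :* D)) :=
           (r :* C :+ b) :* (W :* D) :- (((g :* D) :* W :+ con (ι 3) :* ((e :* W) :* D)) :* C :+ b :* (W :* D)))
           refl g r e (ι b) (ι C) (ι W) (ι d) ⟩
    (r ℚ.* ι C ℚ.+ ι b) ℚ.* (ι W ℚ.* ι d) ℚ.- (((g ℚ.* ι d) ℚ.* ι W ℚ.+ ι 3 ℚ.* ((e ℚ.* ι W) ℚ.* ι d)) ℚ.* ι C ℚ.+ ι b ℚ.* (ι W ℚ.* ι d))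
      ≡⟨ cong₂ (λ y z → (r ℚ.* ι C ℚ.+ ι b) ℚ.* (ι W ℚ.* ι d) ℚ.- ((y ℚ.* ι W ℚ.+ ι 3 ℚ.* (z ℚ.* ι d)) ℚ.* ι C ℚ.+ ι b ℚ.* (ι W ℚ.* ι d)))
           gd≡n (2⁻-* w) ⟩
    (r ℚ.* ι C ℚ.+ ι b) ℚ.* (ι W ℚ.* ι d) ℚ.- ((ι n ℚ.* ι W ℚ.+ ι 3 ℚ.* (1ℚ ℚ.* ι d)) ℚ.* ι C ℚ.+ ι b ℚ.* (ι W ℚ.* ι d))
      ≡⟨ cong (λ y → y ℚ.* (ι W ℚ.* ι d) ℚ.- ((ι n ℚ.* ι W ℚ.+ ι 3 ℚ.* (1ℚ ℚ.* ι d)) ℚ.* ι C ℚ.+ ι b ℚ.* (ι W ℚ.* ι d))) (sym a≡) ⟩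
    ι a ℚ.* (ι W ℚ.* ι d) ℚ.- ((ι n ℚ.* ι W ℚ.+ ι 3 ℚ.* (1ℚ ℚ.* ι d)) ℚ.* ι C ℚ.+ ι b ℚ.* (ι W ℚ.* ι d))
      ≡⟨ sym (cong₂ ℚ._-_ (ι-** a W d) (trans (ι-+ ((n ℕ.* W ℕ.+ 3 ℕ.* d) ℕ.* C) (b ℕ.* (W ℕ.* d)))
           (cong₂ ℚ._+_ (ι-sum n W d C) (ι-** b W d)))) ⟩
    ι upperRight ℚ.- ι upperLeft ∎)
    where open ≡-Reasoning

-- Truncating an approximation to the unit interval

module Clamp (a b c : ℕ) where

  private
    r : ℚ
    r = (a ⊖ b) / suc c

  -- `C ∸ (C ∸ k)` is the minimum of `C` and `k`, and `a ∸ b` already cuts off negative values. The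
  -- parameter must lie in the unit interval for the numerators and the Lipschitz bound to apply.
  clampedNumerator : ℕ
  clampedNumerator = suc c ℕ.∸ (suc c ℕ.∸ (a ℕ.∸ b))

  clamped≤ : clampedNumerator ℕ.≤ suc c
  clamped≤ = ℕₚ.m∸n≤m (suc c) (suc c ℕ.∸ (a ℕ.∸ b))

  clamp : ℚ
  clamp = + clampedNumerator / suc c

  clamp-* : clamp ℚ.* ι (suc c) ≡ ι clampedNumerator
  clamp-* = /-* (+ clampedNumerator) c

  private
    scaled : ∀ {x y} → x ℚ.* ι (suc c) ℚ.≤ y ℚ.* ι (suc c) → x ℚ.≤ y
    scaled = ℚₚ.*-cancelʳ-≤-pos (ι (suc c)) {{positive (0<ι c)}}

  clamp-probability : Probability clamp
  clamp-probability =
      scaled {0ℚ} {clamp} (subst₂ ℚ._≤_ (sym (ℚₚ.*-zeroˡ (ι (suc c)))) (sym clamp-*) (0≤ι clampedNumerator))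
    , 0≤- {clamp} {1ℚ} (scaled {clamp} {1ℚ} (subst₂ ℚ._≤_ (sym clamp-*) (sym (ℚₚ.*-identityˡ (ι (suc c)))) (ι-mono-≤ clamped≤)))

  -- Together with `clamp-≥`, this keeps the approximation as good as it was: a point of the unit
  -- interval does not get farther away by clamping.
  clamp-≤ : ∀ {y} → 0ℚ ℚ.≤ y → r ℚ.≤ y → clamp ℚ.≤ y
  clamp-≤ {y} 0≤y r≤y with ℕₚ.≤-total a b
  ... | inj₁ a≤b = ℚₚ.≤-trans (ℚₚ.≤-reflexive zero-clamp) 0≤y
    where
    zero-clamp : clamp ≡ 0ℚ
    zero-clamp = trans (cong (λ n → + n / suc c)
      (trans (cong (λ k → suc c ℕ.∸ (suc c ℕ.∸ k)) (ℕₚ.m≤n⇒m∸n≡0 a≤b)) (ℕₚ.n∸n≡0 (suc c)))) (ℚₚ.0/n≡0 (suc c))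
  ... | inj₂ b≤a = ℚₚ.≤-trans (scaled {clamp} {r} (subst₂ ℚ._≤_ (sym clamp-*) (sym (/-* (a ⊖ b) c))
      (subst (λ i → ι clampedNumerator ℚ.≤ κ i) (sym (ℤₚ.⊖-≥ b≤a)) (ι-mono-≤ small)))) r≤y
    where
    small : clampedNumerator ℕ.≤ a ℕ.∸ b
    small = ℕₚ.m≤n+o⇒m∸n≤o (suc c) (suc c ℕ.∸ (a ℕ.∸ b)) (subst (suc c ℕ.≤_) (ℕₚ.+-comm (a ℕ.∸ b) _) (ℕₚ.m≤n+m∸n (suc c) (a ℕ.∸ b)))

  clamp-≥ : ∀ {y} → y ℚ.≤ 1ℚ → y ℚ.≤ r → y ℚ.≤ clamp
  clamp-≥ {y} y≤1 y≤r with ℕₚ.≤-total (a ℕ.∸ b) (suc c)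
  ... | inj₁ d≤c = ℚₚ.≤-trans y≤r (scaled {r} {clamp} (subst₂ ℚ._≤_ (sym (⊖/-* a b c)) (sym clamp-*)
      (≤-by (ι clampedNumerator ℚ.+ ι b ℚ.- ι a)
        (0≤- (subst (ι a ℚ.≤_) (ι-+ clampedNumerator b) (ι-mono-≤ large)))
        (solve 3 (λ u a b → u :- (a :- b) := u :+ b :- a) refl (ι clampedNumerator) (ι a) (ι b)))))
    where
    large : a ℕ.≤ clampedNumerator ℕ.+ b
    large = subst (λ u → a ℕ.≤ u ℕ.+ b) (sym (ℕₚ.m∸[m∸n]≡n d≤c)) (subst (a ℕ.≤_) (ℕₚ.+-comm b (a ℕ.∸ b)) (ℕₚ.m≤n+m∸n a b))
  ... | inj₂ c≤d = ℚₚ.≤-trans y≤1 (scaled {1ℚ} {clamp} (subst₂ ℚ._≤_ (sym (ℚₚ.*-identityˡ (ι (suc c)))) (sym clamp-*)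
      (ι-mono-≤ (ℕₚ.≤-reflexive (sym (cong (suc c ℕ.∸_) (ℕₚ.m≤n⇒m∸n≡0 c≤d)))))))

-- Searching for an initial segment of prescribed capacity

near-≤ : ∀ {p x ε δ} → ∣ fromℚ p - x ∣≤ ε → 0ℚ ℚ.< δ → Eventually λ j →
         p ℚ.≤ seq x j ℚ.+ ε ℚ.+ δ × seq x j ℚ.≤ p ℚ.+ ε ℚ.+ δ
near-≤ {δ = δ} (lo , hi) 0<δ = map₂ᵉ (λ _ → _,_) (lo δ 0<δ) (hi δ 0<δ)

ι*2⁻[w+w]≤2⁻w : ∀ w → ι w ℚ.* 2⁻ (w ℕ.+ w) ℚ.≤ 2⁻ w
ι*2⁻[w+w]≤2⁻w w = ℚₚ.≤-trans (*-monoʳ h (ℚₚ.<⇒≤ (0<2⁻ (w ℕ.+ w))) (ι-mono-≤ (n≤2^n w))) (ℚₚ.≤-reflexive (begin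
  W ℚ.* h                   ≡⟨ sym (ℚₚ.*-identityʳ (W ℚ.* h)) ⟩
  (W ℚ.* h) ℚ.* 1ℚ          ≡⟨ cong ((W ℚ.* h) ℚ.*_) (sym (2⁻-* w)) ⟩
  (W ℚ.* h) ℚ.* (g ℚ.* W)   ≡⟨ solve 3 (λ w h g → (w :* h) :* (g :* w) := g :* (h :* (w :* w))) refl W h g ⟩
  g ℚ.* (h ℚ.* (W ℚ.* W))   ≡⟨ cong (λ z → g ℚ.* (h ℚ.* z)) (sym (trans (cong ι (ℕₚ.^-distribˡ-+-* 2 w w)) (ι-* (2 ℕ.^ w) (2 ℕ.^ w)))) ⟩
  g ℚ.* (h ℚ.* ι (2 ℕ.^ (w ℕ.+ w)))  ≡⟨ cong (g ℚ.*_) (2⁻-* (w ℕ.+ w)) ⟩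
  g ℚ.* 1ℚ                  ≡⟨ ℚₚ.*-identityʳ g ⟩
  g                         ∎))
  where
  open ≡-Reasoning
  g h W : ℚ
  g = 2⁻ w
  h = 2⁻ (w ℕ.+ w)
  W = ι (2 ℕ.^ w)

module Search
  (b₀ b₁ : ℝ) (bal : Balanced b₁) (b₁ᶜ : Computableℝ b₁)
  (lo hi : ℕ → ℝ) (loᶜ : ComputableSeqℝ lo) (hiᶜ : ComputableSeqℝ hi)
  (0≤lo : ∀ n → 0ℝ ≤ lo n) (lo<hi : ∀ n → lo n < hi n) (lo<1 : ∀ n → lo n < 1ℝ)
  where

  private
    module B (w : ℕ) where
      a b c : Vec ℕ 1 → ℕ
      a = proj₁ (proj₁ (proj₂ b₁ᶜ))
      b = proj₁ (proj₂ (proj₁ (proj₂ b₁ᶜ)))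
      c = proj₁ (proj₂ (proj₂ (proj₁ (proj₂ b₁ᶜ))))
      xs : Vec ℕ 1
      -- The doubling makes up for the Lipschitz constant `w`, as `w` times `2⁻ (w + w)` is at most
      -- `2⁻ w`. The extra bit pays for the slack with which an approximation bound is read off a
      -- Cauchy sequence.
      xs = suc (w ℕ.+ w) ∷ []
      open Clamp (a xs) (b xs) (c xs) public
      numerator denominator : ℕ
      numerator   = distributionNumerator clampedNumerator (suc (c xs)) (digit w) w
      denominator = suc (c xs) ℕ.^ w
      value′ : ℚ
      value′ = distribution clamp (bits w)
      value-* : value′ ℚ.* ι denominator ≡ ι numerator
      value-* = distributionNumerator-correct clampedNumerator (suc (c xs)) (digit w) clamp-* clamped≤ w
      0<denominator : 0ℚ ℚ.< ι denominator
      0<denominator = ℚₚ.<-≤-trans (0<ι 0) (ι-mono-≤ (ℕₚ.m^n>0 (suc (c xs)) w))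
      near : ∣ fromℚ ((a xs ⊖ b xs) / suc (c xs)) - b₁ ∣≤ 2⁻ suc (w ℕ.+ w)
      near = subst (λ r → ∣ fromℚ r - b₁ ∣≤ 2⁻ suc (w ℕ.+ w))
        (proj₂ (proj₂ (proj₂ (proj₂ (proj₂ (proj₂ (proj₁ (proj₂ b₁ᶜ))))))) xs) (proj₂ (proj₂ b₁ᶜ) (suc (w ℕ.+ w)))

    module Terms {x : ℕ → ℝ} (xᶜ : ComputableSeqℝ x) where
      a b c : Vec ℕ 2 → ℕ
      a = proj₁ (proj₁ (proj₂ xᶜ))
      b = proj₁ (proj₂ (proj₁ (proj₂ xᶜ)))
      c = proj₁ (proj₂ (proj₂ (proj₁ (proj₂ xᶜ))))
      approximation : ℕ → ℕ → ℚ
      approximation n w = (a (n ∷ w ∷ []) ⊖ b (n ∷ w ∷ [])) / suc (c (n ∷ w ∷ []))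
      near : ∀ n w → ∣ fromℚ (approximation n w) - x n ∣≤ 2⁻ w
      near n w = subst (λ r → ∣ fromℚ r - x n ∣≤ 2⁻ w)
        (proj₂ (proj₂ (proj₂ (proj₂ (proj₂ (proj₂ (proj₁ (proj₂ xᶜ))))))) (n ∷ w ∷ [])) (proj₂ (proj₂ xᶜ) n w)
      module M (n w : ℕ) = Margins (a (n ∷ w ∷ [])) (b (n ∷ w ∷ [])) (c (n ∷ w ∷ []))
        (B.numerator w) (B.denominator w) w {B.value′ w} (B.0<denominator w) (B.value-* w)

    module Lo = Terms {lo} loᶜ
    module Hi = Terms {hi} hiᶜ

    -- At stage w the endpoints are known up to 2·2⁻ʷ and the value of the
    -- distribution function up to 2⁻ʷ, hence the margin 3·2⁻ʷ.
    test : Vec ℕ 2 → ℕ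
    test xs = (Lo.M.lowerLeft n w ℕ.∸ Lo.M.lowerRight n w) ℕ.+ (Hi.M.upperLeft n w ℕ.∸ Hi.M.upperRight n w)
      where
      w = lookup xs 0F
      n = lookup xs 1F

    testᶜ : Computable test
    testᶜ = ((la *ᶜ W +ᶜ constᶜ 3 *ᶜ sucᶜ lc) *ᶜ D ∸ᶜ (N *ᶜ (sucᶜ lc *ᶜ W) +ᶜ lb *ᶜ (W *ᶜ D)))
         +ᶜ (((N *ᶜ W +ᶜ constᶜ 3 *ᶜ D) *ᶜ sucᶜ hc +ᶜ hb *ᶜ (W *ᶜ D)) ∸ᶜ ha *ᶜ (W *ᶜ D))
      where
      w = varᶜ {2} 0F
      n = varᶜ {2} 1F
      W = constᶜ 2 ^ᶜ w
      at : ∀ {f : Vec ℕ 2 → ℕ} → Computable f → Computable {2} (λ xs → f (lookup xs 1F ∷ lookup xs 0F ∷ []))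
      at fᶜ = compᶜ fᶜ (n ∷ w ∷ [])
      precise : ∀ {f : Vec ℕ 1 → ℕ} → Computable f → Computable {2} (λ xs → f (suc (lookup xs 0F ℕ.+ lookup xs 0F) ∷ []))
      precise fᶜ = compᶜ fᶜ (sucᶜ (w +ᶜ w) ∷ [])
      la = at (proj₁ (proj₂ (proj₂ (proj₂ (proj₁ (proj₂ loᶜ))))))
      lb = at (proj₁ (proj₂ (proj₂ (proj₂ (proj₂ (proj₁ (proj₂ loᶜ)))))))
      lc = at (proj₁ (proj₂ (proj₂ (proj₂ (proj₂ (proj₂ (proj₁ (proj₂ loᶜ))))))))
      ha = at (proj₁ (proj₂ (proj₂ (proj₂ (proj₁ (proj₂ hiᶜ))))))
      hb = at (proj₁ (proj₂ (proj₂ (proj₂ (proj₂ (proj₁ (proj₂ hiᶜ)))))))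
      hc = at (proj₁ (proj₂ (proj₂ (proj₂ (proj₂ (proj₂ (proj₁ (proj₂ hiᶜ))))))))
      ba = precise (proj₁ (proj₂ (proj₂ (proj₂ (proj₁ (proj₂ b₁ᶜ))))))
      bb = precise (proj₁ (proj₂ (proj₂ (proj₂ (proj₂ (proj₁ (proj₂ b₁ᶜ)))))))
      v  = sucᶜ (precise (proj₁ (proj₂ (proj₂ (proj₂ (proj₂ (proj₂ (proj₁ (proj₂ b₁ᶜ)))))))))
      u  = v ∸ᶜ (v ∸ᶜ (ba ∸ᶜ bb))
      D  = v ^ᶜ w
      N  = distributionNumeratorᶜ u v w

    tol : ℕ → ℚ
    tol w = 2⁻ w

    test-⇔ : ∀ w n → test (w ∷ n ∷ []) ≡ 0 ⇔
      (Lo.approximation n w ℚ.+ (tol w ℚ.+ tol w ℚ.+ tol w) ℚ.≤ B.value′ w ×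
       B.value′ w ℚ.+ (tol w ℚ.+ tol w ℚ.+ tol w) ℚ.≤ Hi.approximation n w)
    test-⇔ w n = mk⇔
      (λ e → from (Lo.M.lower n w) (ℕₚ.m∸n≡0⇒m≤n (ℕₚ.m+n≡0⇒m≡0 _ e))
           , from (Hi.M.upper n w) (ℕₚ.m∸n≡0⇒m≤n (ℕₚ.m+n≡0⇒n≡0 (Lo.M.lowerLeft n w ℕ.∸ Lo.M.lowerRight n w) e)))
      (λ (p , q) → cong₂ ℕ._+_ (ℕₚ.m≤n⇒m∸n≡0 (to (Lo.M.lower n w) p)) (ℕₚ.m≤n⇒m∸n≡0 (to (Hi.M.upper n w) q)))

    -- The approximation of b₁ used at stage w has error 2⁻⁽²ʷ⁺¹⁾, and the
    -- distribution function at strings of length w is w-Lipschitz.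
    value-near : ∀ w → Eventually λ j →
      B.value′ w ℚ.≤ distribution (seq b₁ j) (bits w) ℚ.+ tol w ×
      distribution (seq b₁ j) (bits w) ℚ.≤ B.value′ w ℚ.+ tol w
    value-near w = map₂ᵉ bound (near-≤ {x = b₁} (B.near w) (0<2⁻ (suc (w ℕ.+ w)))) (proj₂ (proj₂ bal))
      where
      h η : ℚ
      h = 2⁻ suc (w ℕ.+ w)
      η = 2⁻ (w ℕ.+ w)
      0≤η : 0ℚ ℚ.≤ η
      0≤η = ℚₚ.<⇒≤ (0<2⁻ (w ℕ.+ w))
      merge : ∀ x → x ℚ.+ h ℚ.+ h ≡ x ℚ.+ η
      merge x = trans (ℚₚ.+-assoc x h h) (cong (x ℚ.+_) (2⁻-suc (w ℕ.+ w)))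
      r : ℚ
      r = (B.a w (B.xs w) ⊖ B.b w (B.xs w)) / suc (B.c w (B.xs w))
      shift : ∀ {p q} → q ℚ.≤ p ℚ.+ η → q ℚ.- η ℚ.≤ p
      shift {p} {q} l = ≤-by (p ℚ.+ η ℚ.- q) (0≤- l) (solve 3 (λ p q h → p :- (q :- h) := p :+ h :- q) refl p q η)
      unshift : ∀ {p q} → q ℚ.- η ℚ.≤ p → q ℚ.≤ p ℚ.+ η
      unshift {p} {q} l = ≤-by (p ℚ.- (q ℚ.- η)) (0≤- l) (solve 3 (λ p q h → p :+ h :- q := p :- (q :- h)) refl p q η)
      lipschitz : ∀ {x y} → Probability x → Probability y → x ℚ.≤ y ℚ.+ η → y ℚ.≤ x ℚ.+ η →
                  distribution x (bits w) ℚ.≤ distribution y (bits w) ℚ.+ tol w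
      lipschitz {x} {y} px py x≤y y≤x = ℚₚ.≤-trans (distribution-lipschitz px py 0≤η x≤y y≤x (bits w))
        (ℚₚ.+-monoʳ-≤ (distribution y (bits w)) (subst (λ k → ι k ℚ.* η ℚ.≤ tol w)
          (sym (Listₚ.length-applyUpTo (digit w) w)) (ι*2⁻[w+w]≤2⁻w w)))
      bound : ∀ j → r ℚ.≤ seq b₁ j ℚ.+ h ℚ.+ h × seq b₁ j ℚ.≤ r ℚ.+ h ℚ.+ h →
              proj₁ bal ℚ.≤ seq b₁ j × proj₁ bal ℚ.≤ 1ℚ ℚ.- seq b₁ j →
              B.value′ w ℚ.≤ distribution (seq b₁ j) (bits w) ℚ.+ tol w ×
              distribution (seq b₁ j) (bits w) ℚ.≤ B.value′ w ℚ.+ tol w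
      bound j (p , q) (u , v) = lipschitz (B.clamp-probability w) pb above below′
                              , lipschitz pb (B.clamp-probability w) below′ above
        where
        pb : Probability (seq b₁ j)
        pb = ℚₚ.≤-trans (ℚₚ.<⇒≤ (proj₁ (proj₂ bal))) u , ℚₚ.≤-trans (ℚₚ.<⇒≤ (proj₁ (proj₂ bal))) v
        above : B.clamp w ℚ.≤ seq b₁ j ℚ.+ η
        above = B.clamp-≤ w (0≤+ (proj₁ pb) 0≤η) (subst (r ℚ.≤_) (merge (seq b₁ j)) p)
        below′ : seq b₁ j ℚ.≤ B.clamp w ℚ.+ η
        below′ = unshift (B.clamp-≥ w
          (≤-by ((1ℚ ℚ.- seq b₁ j) ℚ.+ η) (0≤+ (proj₂ pb) 0≤η)
            (solve 2 (λ b h → con 1ℚ :- (b :- h) := (con 1ℚ :- b) :+ h) refl (seq b₁ j) η))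
          (shift (subst (seq b₁ j ℚ.≤_) (merge r) q)))

    cap : String → ℝ
    cap = capacity b₀ b₁

    sound : ∀ w n → test (w ∷ n ∷ []) ≡ 0 → lo n ≤ cap (bits w) × cap (bits w) ≤ hi n
    sound w n e =
        ≤-pointwise {lo n} {cap (bits w)} (map₂ᵉ
          (λ j p q → subst (seq (lo n) j ℚ.≤_) (sym (capacity-seq b₀ b₁ (bits w) j))
            (≤-by ((L ℚ.+ t ℚ.+ t ℚ.- seq (lo n) j) ℚ.+ ((V ℚ.- (L ℚ.+ (t ℚ.+ t ℚ.+ t))) ℚ.+ (G j ℚ.+ t ℚ.- V)))
              (0≤+ (0≤- (proj₂ p)) (0≤+ (0≤- (proj₁ margins)) (0≤- (proj₁ q))))
              (solve 5 (λ x g L V t → g :- x :=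
                (L :+ t :+ t :- x) :+ ((V :- (L :+ (t :+ t :+ t))) :+ (g :+ t :- V))) refl (seq (lo n) j) (G j) L V t)))
          (near-≤ {x = lo n} (Lo.near n w) (0<2⁻ w)) (value-near w))
      , ≤-pointwise {cap (bits w)} {hi n} (map₂ᵉ
          (λ j p q → subst (ℚ._≤ seq (hi n) j) (sym (capacity-seq b₀ b₁ (bits w) j))
            (≤-by ((seq (hi n) j ℚ.+ t ℚ.+ t ℚ.- H) ℚ.+ ((H ℚ.- (V ℚ.+ (t ℚ.+ t ℚ.+ t))) ℚ.+ (V ℚ.+ t ℚ.- G j)))
              (0≤+ (0≤- (proj₁ p)) (0≤+ (0≤- (proj₂ margins)) (0≤- (proj₂ q))))
              (solve 5 (λ x g H V t → x :- g :=
                (x :+ t :+ t :- H) :+ ((H :- (V :+ (t :+ t :+ t))) :+ (V :+ t :- g))) refl (seq (hi n) j) (G j) H V t)))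
          (near-≤ {x = hi n} (Hi.near n w) (0<2⁻ w)) (value-near w))
      where
      t L H V : ℚ
      t = tol w
      L = Lo.approximation n w
      H = Hi.approximation n w
      V = B.value′ w
      G : ℕ → ℚ
      G j = distribution (seq b₁ j) (bits w)
      margins = to (test-⇔ w n) e

    -- Six units: three for the margin of the test, two for the endpoint and one for the
    -- distribution function. A gap this wide on both sides makes the test succeed.
    tolerance : ℕ → ℚ
    tolerance w = tol w ℚ.+ tol w ℚ.+ tol w ℚ.+ (tol w ℚ.+ tol w ℚ.+ tol w)

    passes : ∀ n w {x y g δ₁ δ₂} → tolerance w ℚ.≤ δ₁ → tolerance w ℚ.≤ δ₂ →
             Lo.approximation n w ℚ.≤ x ℚ.+ tol w ℚ.+ tol w → y ℚ.≤ Hi.approximation n w ℚ.+ tol w ℚ.+ tol w →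
             B.value′ w ℚ.≤ g ℚ.+ tol w → g ℚ.≤ B.value′ w ℚ.+ tol w →
             x ℚ.+ δ₁ ℚ.≤ g → g ℚ.+ δ₂ ℚ.≤ y → test (w ∷ n ∷ []) ≡ 0
    passes n w {x} {y} {g} {δ₁} {δ₂} t≤δ₁ t≤δ₂ L≤x y≤H V≤g g≤V x<g g<y = from (test-⇔ w n)
      ( ≤-by (((x ℚ.+ t ℚ.+ t ℚ.- L) ℚ.+ (g ℚ.- (x ℚ.+ δ₁))) ℚ.+ ((V ℚ.+ t ℚ.- g) ℚ.+ (δ₁ ℚ.- tolerance w)))
          (0≤+ (0≤+ (0≤- L≤x) (0≤- x<g)) (0≤+ (0≤- g≤V) (0≤- t≤δ₁)))
          (solve 6 (λ x g L V t d → V :- (L :+ (t :+ t :+ t)) :=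
            ((x :+ t :+ t :- L) :+ (g :- (x :+ d))) :+ ((V :+ t :- g) :+ (d :- (t :+ t :+ t :+ (t :+ t :+ t)))))
            refl x g L V t δ₁)
      , ≤-by (((H ℚ.+ t ℚ.+ t ℚ.- y) ℚ.+ (y ℚ.- (g ℚ.+ δ₂))) ℚ.+ ((g ℚ.+ t ℚ.- V) ℚ.+ (δ₂ ℚ.- tolerance w)))
          (0≤+ (0≤+ (0≤- y≤H) (0≤- g<y)) (0≤+ (0≤- V≤g) (0≤- t≤δ₂)))
          (solve 6 (λ y g H V t d → H :- (V :+ (t :+ t :+ t)) :=
            ((H :+ t :+ t :- y) :+ (y :- (g :+ d))) :+ ((g :+ t :- V) :+ (d :- (t :+ t :+ t :+ (t :+ t :+ t)))))
            refl y g H V t δ₂))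
      where
      t L H V : ℚ
      t = tol w
      L = Lo.approximation n w
      H = Hi.approximation n w
      V = B.value′ w

    tolerance-small : ∀ {δ} → 0ℚ ℚ.< δ → ∃ λ k → ∀ w → k ℕ.≤ w → tolerance w ℚ.≤ δ
    tolerance-small {δ} 0<δ = proj₁ small , λ w k≤w → bound (tol w) (proj₂ small w k≤w)
      where
      small : ∃ λ k → ∀ w → k ℕ.≤ w → 2⁻ w ℚ.≤ δ ℚ.* ½ ℚ.* ½ ℚ.* ½
      small = 2⁻-small (halve (halve (halve 0<δ)))
      bound : ∀ t → t ℚ.≤ δ ℚ.* ½ ℚ.* ½ ℚ.* ½ → t ℚ.+ t ℚ.+ t ℚ.+ (t ℚ.+ t ℚ.+ t) ℚ.≤ δ
      bound t t≤ = ≤-by (s ℚ.+ s ℚ.+ s ℚ.+ (s ℚ.+ s ℚ.+ s) ℚ.+ δ ℚ.* ½ ℚ.* ½)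
        (0≤+ (0≤+ (0≤+ (0≤+ 0≤s 0≤s) 0≤s) (0≤+ (0≤+ 0≤s 0≤s) 0≤s)) (ℚₚ.<⇒≤ (halve (halve 0<δ))))
        (solve 2 (λ e t → let s = e :* con ½ :* con ½ :* con ½ :- t in
          e :- (t :+ t :+ t :+ (t :+ t :+ t)) :=
          s :+ s :+ s :+ (s :+ s :+ s) :+ e :* con ½ :* con ½) refl δ t)
        where
        s : ℚ
        s = δ ℚ.* ½ ℚ.* ½ ℚ.* ½ ℚ.- t
        0≤s : 0ℚ ℚ.≤ s
        0≤s = 0≤- t≤

    -- The stage is the code of the string, so a suitable `σ` may come too early for its gaps to be
    -- visible. Padding it with zeros yields a stage as late as desired with the same capacity.
    complete-for : ∀ n σ → lo n < cap σ → cap σ < hi n → ∃ λ w → test (w ∷ n ∷ []) ≡ 0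
    complete-for n σ (δ₁ , 0<δ₁ , lo<cap) (δ₂ , 0<δ₂ , cap<hi) = w , proj₂ (witness (map₃ᵉ
        (λ j (p , q) (u , v) (r , s) → passes n w {seq (lo n) j} {seq (hi n) j} {distribution (seq b₁ j) (bits w)} {δ₁} {δ₂}
          (proj₂ small₁ w (ℕₚ.m⊔n≤o⇒m≤o (proj₁ small₁) (proj₁ small₂) (proj₁ (proj₂ code))))
          (proj₂ small₂ w (ℕₚ.m⊔n≤o⇒n≤o (proj₁ small₁) (proj₁ small₂) (proj₁ (proj₂ code))))
          p q u v
          (subst (seq (lo n) j ℚ.+ δ₁ ℚ.≤_) (value-code j) r)
          (subst (λ z → z ℚ.+ δ₂ ℚ.≤ seq (hi n) j) (value-code j) s))
        (map₂ᵉ (λ _ p q → proj₁ p , proj₂ q) (near-≤ {x = lo n} (Lo.near n w) (0<2⁻ w)) (near-≤ {x = hi n} (Hi.near n w) (0<2⁻ w)))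
        (value-near w)
        (map₂ᵉ (λ _ → _,_) lo<cap cap<hi)))
      where
      small₁ : ∃ λ k → ∀ w → k ℕ.≤ w → tolerance w ℚ.≤ δ₁
      small₁ = tolerance-small 0<δ₁
      small₂ : ∃ λ k → ∀ w → k ℕ.≤ w → tolerance w ℚ.≤ δ₂
      small₂ = tolerance-small 0<δ₂
      code : ∃ λ w → proj₁ small₁ ℕ.⊔ proj₁ small₂ ℕ.≤ w × (∀ b → distribution b (bits w) ≡ distribution b σ)
      code = padded-code σ (proj₁ small₁ ℕ.⊔ proj₁ small₂)
      w : ℕ
      w = proj₁ code
      value-code : ∀ j → seq (cap σ) j ≡ distribution (seq b₁ j) (bits w)
      value-code j = trans (capacity-seq b₀ b₁ σ j) (sym (proj₂ (proj₂ code) (seq b₁ j)))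

    complete : ∀ n → ∃ λ w → test (w ∷ n ∷ []) ≡ 0
    complete n = let σ , lo<cap , cap<hi = capacity-dense {b₀} {b₁} bal {lo n} {hi n} (0≤lo n) (lo<hi n) (lo<1 n) in
      complete-for n σ lo<cap cap<hi

  between : ∃ λ (w : ℕ → ℕ) → Computable {1} (λ xs → w (lookup xs 0F)) ×
            (∀ n → lo n ≤ capacity b₀ b₁ (bits (w n)) × capacity b₀ b₁ (bits (w n)) ≤ hi n)
  between = search (searchᶜ testᶜ λ { (n ∷ []) → complete n })
    where
    search : (∃ λ m → Computable m × (∀ xs → test (m xs ∷ xs) ≡ 0)) → _
    search (m , mᶜ , zero-at-m) = (λ n → m (n ∷ [])) , compᶜ mᶜ (varᶜ 0F ∷ [])
      , λ n → sound (m (n ∷ [])) n (zero-at-m (n ∷ []))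

-- Operations on computable sequences of reals

computableℝ-reindex : ∀ {x} → ComputableSeqℝ x → ∀ (f : ℕ → ℕ) → Computable {1} (λ xs → f (lookup xs 0F)) →
                      ComputableSeqℝ (λ n → x (f n))
computableℝ-reindex (r , (a , b , c , aᶜ , bᶜ , cᶜ , e) , near) f fᶜ =
    (λ xs → r (at xs))
  , ((λ xs → a (at xs)) , (λ xs → b (at xs)) , (λ xs → c (at xs))
    , compᶜ aᶜ reindex , compᶜ bᶜ reindex , compᶜ cᶜ reindex , λ xs → e (at xs))
  , λ n → near (f n)
  where
  at : Vec ℕ 2 → Vec ℕ 2
  at xs = f (lookup xs 0F) ∷ lookup xs 1F ∷ []
  reindex : Allⱽ (Computable {2}) ((λ xs → f (lookup xs 0F)) ∷ (λ xs → lookup xs 1F) ∷ [])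
  reindex = compᶜ fᶜ (varᶜ 0F ∷ []) ∷ varᶜ 1F ∷ []

fraction-+ : ∀ a b c n → (a ⊖ b) / suc c ℚ.+ 2⁻ n ≡
  (a ℕ.* 2 ℕ.^ n ℕ.+ suc c ⊖ b ℕ.* 2 ℕ.^ n) / suc (ℕ.pred (suc c ℕ.* 2 ℕ.^ n))
fraction-+ a b c n = cancel (suc (ℕ.pred (suc c ℕ.* W))) (ℕ.s≤s ℕ.z≤n) (begin
  (r ℚ.+ h) ℚ.* ι (suc (ℕ.pred (suc c ℕ.* W)))
    ≡⟨ cong ((r ℚ.+ h) ℚ.*_) (trans (cong ι (ℕₚ.suc-pred (suc c ℕ.* W) {{ℕₚ.m*n≢0 (suc c) W {{_}} {{ℕₚ.m^n≢0 2 n}}}})) (ι-* (suc c) W)) ⟩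
  (r ℚ.+ h) ℚ.* (ι (suc c) ℚ.* ι W)
    ≡⟨ solve 4 (λ r h c w → (r :+ h) :* (c :* w) := (r :* c) :* w :+ (h :* w) :* c) refl r h (ι (suc c)) (ι W) ⟩
  (r ℚ.* ι (suc c)) ℚ.* ι W ℚ.+ (h ℚ.* ι W) ℚ.* ι (suc c)
    ≡⟨ cong₂ (λ x y → x ℚ.* ι W ℚ.+ y ℚ.* ι (suc c)) (⊖/-* a b c) (2⁻-* n) ⟩
  (ι a ℚ.- ι b) ℚ.* ι W ℚ.+ 1ℚ ℚ.* ι (suc c)
    ≡⟨ solve 4 (λ a b w c → (a :- b) :* w :+ con 1ℚ :* c := (a :* w :+ c) :- b :* w) refl (ι a) (ι b) (ι W) (ι (suc c)) ⟩
  (ι a ℚ.* ι W ℚ.+ ι (suc c)) ℚ.- ι b ℚ.* ι W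
    ≡⟨ sym (cong₂ ℚ._-_ (trans (ι-+ (a ℕ.* W) (suc c)) (cong (ℚ._+ ι (suc c)) (ι-* a W))) (ι-* b W)) ⟩
  ι (a ℕ.* W ℕ.+ suc c) ℚ.- ι (b ℕ.* W)
    ≡⟨ sym (⊖/-* (a ℕ.* W ℕ.+ suc c) (b ℕ.* W) (ℕ.pred (suc c ℕ.* W))) ⟩
  (a ℕ.* W ℕ.+ suc c ⊖ b ℕ.* W) / suc (ℕ.pred (suc c ℕ.* W)) ℚ.* ι (suc (ℕ.pred (suc c ℕ.* W))) ∎)
  where
  open ≡-Reasoning
  W : ℕ
  W = 2 ℕ.^ n
  r h : ℚ
  r = (a ⊖ b) / suc c
  h = 2⁻ n
  cancel : ∀ k {x y} → 0 ℕ.< k → x ℚ.* ι k ≡ y ℚ.* ι k → x ≡ y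
  cancel (suc k) _ e = ℚₚ.≤-antisym
    (ℚₚ.*-cancelʳ-≤-pos (ι (suc k)) {{positive (0<ι k)}} (ℚₚ.≤-reflexive e))
    (ℚₚ.*-cancelʳ-≤-pos (ι (suc k)) {{positive (0<ι k)}} (ℚₚ.≤-reflexive (sym e)))

computableℝ-+2⁻ : ∀ {x} → ComputableSeqℝ x → ComputableSeqℝ (λ n → x n + fromℚ (2⁻ n))
computableℝ-+2⁻ {x} (r , (a , b , c , aᶜ , bᶜ , cᶜ , e) , near) =
    (λ xs → r xs ℚ.+ 2⁻ lookup xs 0F)
  , ( _ , _ , _
    , aᶜ *ᶜ W +ᶜ sucᶜ cᶜ , bᶜ *ᶜ W , predᶜ (sucᶜ cᶜ *ᶜ W)
    , λ xs → trans (cong (ℚ._+ 2⁻ lookup xs 0F) (e xs)) (fraction-+ (a xs) (b xs) (c xs) (lookup xs 0F)))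
  , λ n k →
      (λ ε 0<ε → map₁ᵉ (λ j → add (r (n ∷ k ∷ [])) (seq (x n) j) (2⁻ n) (2⁻ k) ε) (proj₁ (near n k) ε 0<ε))
    , (λ ε 0<ε → map₁ᵉ (λ j → add (seq (x n) j) (r (n ∷ k ∷ [])) (2⁻ n) (2⁻ k) ε) (proj₂ (near n k) ε 0<ε))
  where
  W : Computable {2} (λ xs → 2 ℕ.^ lookup xs 0F)
  W = constᶜ 2 ^ᶜ varᶜ 0F
  add : ∀ p q h η ε → p ℚ.≤ q ℚ.+ η ℚ.+ ε → p ℚ.+ h ℚ.≤ q ℚ.+ h ℚ.+ η ℚ.+ ε
  add p q h η ε le = ≤-by (q ℚ.+ η ℚ.+ ε ℚ.- p) (0≤- le)
    (solve 5 (λ p q h η ε → q :+ h :+ η :+ ε :- (p :+ h) := q :+ η :+ ε :- p) refl p q h η ε)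

-- The capacity of initial segments

module _ {b₀ b₁ : ℝ} (μ : BorelProbabilityMeasure) (μ-d : IsMeasureOf (d b₀ b₁) μ) where

  hasCapacity-Below : ∀ {Q} σ → Q ≐ Below σ → HasCapacity μ Q (capacity b₀ b₁ σ)
  hasCapacity-Below {Q} σ (Q⊆ , ⊆Q) =
      event (below σ 0) []
    , ( (λ {x} e → proj₁ codes {x} (⊆Q (proj₁ (event-below σ) {x} e)))
      , (λ {x} c → proj₂ (event-below σ) {x} (Q⊆ (proj₂ codes {x} c))))
    , measure-below {b₀} {b₁} μ μ-d σ
    where
    codes : (λ x → path x 0 ∈ Q) ≐ CodesMeeting Q
    codes = CodesMeeting-initial Q λ y≤z z∈Q → ⊆Q (Below-initial σ y≤z (Q⊆ z∈Q))

  hasCapacity-whole : ∀ {Q r} → (∀ x → x ∈ Q) → r ≈ 1ℝ → HasCapacity μ Q r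
  hasCapacity-whole {Q} {r} all r≈1 =
      cyl []
    , ( (λ {x} _ → proj₁ (CodesMeeting-initial Q λ _ _ → all _) {x} (all _)) , (λ _ → refl))
    , ≈-trans {measure μ (cyl [])} {1ℝ} {r} (total μ) (≈-sym {r} {1ℝ} r≈1)

  module _ (em : ExcludedMiddle 0ℓ) where

    capacity≤measure : ∀ σ B → (∀ x → path x 0 ∈ Below σ → x ∈ ⟦ B ⟧) → capacity b₀ b₁ σ ≤ measure μ B
    capacity≤measure σ B sub = ≤-trans {capacity b₀ b₁ σ} {measure μ (event (below σ 0) [])} {measure μ B}
      (proj₂ (measure-below {b₀} {b₁} μ μ-d σ))
      (measure-mono μ em (event (below σ 0) []) B λ {x} e → sub x (proj₁ (event-below σ) {x} e))

    measure≤capacity : ∀ σ B → (∀ x → x ∈ ⟦ B ⟧ → path x 0 ∈ Below σ) → measure μ B ≤ capacity b₀ b₁ σ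
    measure≤capacity σ B sub = ≤-trans {measure μ B} {measure μ (event (below σ 0) [])} {capacity b₀ b₁ σ}
      (measure-mono μ em B (event (below σ 0) []) λ {x} e → proj₂ (event-below σ) {x} (sub x e))
      (proj₁ (measure-below {b₀} {b₁} μ μ-d σ))

    capacity-mono : ∀ σ τ → Below σ ⊆ Below τ → capacity b₀ b₁ σ ≤ capacity b₀ b₁ τ
    capacity-mono σ τ sub = ≤-trans {capacity b₀ b₁ σ} {measure μ (event (below τ 0) [])} {capacity b₀ b₁ τ}
      (capacity≤measure σ (event (below τ 0) []) λ x b → proj₂ (event-below τ) {x} (sub b))
      (proj₁ (measure-below {b₀} {b₁} μ μ-d τ))

    module _ (bal : Balanced b₁) {q : ℝ} (q≤1 : q ≤ 1ℝ) (σ : ℕ → String)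
             (q≤σ : ∀ n → q ≤ capacity b₀ b₁ (σ n))
             (σ≤q : ∀ ε → 0ℚ ℚ.< ε → ∃ λ n → capacity b₀ b₁ (σ n) ≤ q + fromℚ ε) where

      private
        P : Pred Cantor 0ℓ
        P x = ∀ n → x ∈ Below (σ n)

        B : Borel
        B = compl (union λ n → compl (event (below (σ n) 0) []))

        B⇒path : ∀ x → x ∈ ⟦ B ⟧ → path x 0 ∈ P
        B⇒path x b n with em {x ∈ ⟦ event (below (σ n) 0) [] ⟧}
        ... | yes e = proj₁ (event-below (σ n)) {x} e
        ... | no ¬e = contradiction (n , ¬e) b

        path⇒B : ∀ x → path x 0 ∈ P → x ∈ ⟦ B ⟧
        path⇒B x p (n , ¬e) = ¬e (proj₂ (event-below (σ n)) {x} (p n))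

        B≤q : measure μ B ≤ q
        B≤q = ≤-slack {measure μ B} {q} λ ε 0<ε → let n , le = σ≤q ε 0<ε in
          ≤-trans {measure μ B} {capacity b₀ b₁ (σ n)} {q + fromℚ ε}
            (measure≤capacity (σ n) B λ x b → B⇒path x b n) le

        B≮q : ¬ measure μ B < q
        B≮q B<q = between-is-absurd (capacity-dense {b₀} {b₁} bal {measure μ B} {q} (nonneg μ B) B<q
          (<-≤-trans {measure μ B} {q} {1ℝ} B<q q≤1))
          where
          between-is-absurd : ¬ (∃ λ τ → measure μ B < capacity b₀ b₁ τ × capacity b₀ b₁ τ < q)
          between-is-absurd (τ , B<τ , τ<q) =
            ≤⇒≯ {capacity b₀ b₁ τ} {measure μ B} (capacity≤measure τ B λ x b → path⇒B x λ n → τ⊆σ n b) B<τ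
            where
            -- The opposite inclusion would give `q ≤ capacity b₀ b₁ (σ n) ≤ capacity b₀ b₁ τ < q`.
            τ⊆σ : ∀ n → Below τ ⊆ Below (σ n)
            τ⊆σ n with Below-total τ (σ n)
            ... | inj₁ sub = sub
            ... | inj₂ sub = contradiction τ<q (≤⇒≯ {q} {capacity b₀ b₁ τ}
                    (≤-trans {q} {capacity b₀ b₁ (σ n)} {capacity b₀ b₁ τ} (q≤σ n) (capacity-mono (σ n) τ sub)))

        q≤B : q ≤ measure μ B
        q≤B with em {q ≤ measure μ B}
        ... | yes le = le
        ... | no ¬le = contradiction (≰⇒> em {q} {measure μ B} ¬le) B≮q

      hasCapacity-⋂ : HasCapacity μ P q
      hasCapacity-⋂ = B
        , ( (λ {x} b → proj₁ codes {x} (B⇒path x b)) , (λ {x} c → path⇒B x (proj₂ codes {x} c)))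
        , B≤q , q≤B
        where
        codes : (λ x → path x 0 ∈ P) ≐ CodesMeeting P
        codes = CodesMeeting-initial P λ y≤z z∈P n → Below-initial (σ n) y≤z (z∈P n)

-- Realizing right-c.e. reals as capacities

whole-effectivelyClosed : EffectivelyClosed (λ _ → ⊤)
whole-effectivelyClosed = (λ _ → ⊤) , (λ _ _ _ → tt)
  , (proj₁ (constᶜ {1} 1) , λ σ → inj₁ (tt , proj₂ (constᶜ {1} 1) (codeString σ ∷ [])))
  , (λ _ _ → tt) , (λ _ → tt)

whole : Clopen
whole = [] ∷ []

prepend : Clopen → (ℕ → Clopen) → ℕ → Clopen
prepend A F zero    = A
prepend A F (suc n) = F n

prepend-computable : ∀ A {F} → ComputableClopenSeq F → ComputableClopenSeq (prepend A F)
prepend-computable A {F} (e , h) = proj₁ codeᶜ , λ n → proj₂ codeᶜ (n ∷ [])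
  where
  codeᶜ : Computable {1} (λ xs → codeList (map codeString (prepend A F (lookup xs 0F))))
  -- A case distinction on 0 or successor is a primitive recursion whose step ignores the previous
  -- value.
  codeᶜ = recᶜ _ {h = λ xs → codeList (map codeString (F (lookup xs 0F)))}
    (constᶜ (codeList (map codeString A)))
    (compᶜ {f = λ xs → codeList (map codeString (F (lookup xs 0F)))} (e , λ { (n ∷ []) → h n }) (varᶜ 0F ∷ []))
    (λ _ → refl) (λ _ _ → refl)

module _ {q : ℝ} {qs : ℕ → ℝ} (dec : ∀ n → qs (suc n) ≤ qs n) (qs⟶q : qs ⟶ q) where

  antitone : ∀ m k → qs (k ℕ.+ m) ≤ qs m
  antitone m zero    = ≤-refl {qs m}
  antitone m (suc k) = ≤-trans {qs (suc (k ℕ.+ m))} {qs (k ℕ.+ m)} {qs m} (dec (k ℕ.+ m)) (antitone m k)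

  limit≤ : ∀ m → q ≤ qs m
  limit≤ m = ≤-slack {q} {qs m} λ ε 0<ε → let N , near = qs⟶q ε 0<ε in
    ≤-trans {q} {qs (N ℕ.+ m) + fromℚ ε} {qs m + fromℚ ε} (proj₂ (near (N ℕ.+ m) (ℕₚ.m≤m+n N m)))
      (+-mono-≤ {qs (N ℕ.+ m)} {qs m} {fromℚ ε} {fromℚ ε} (antitone m N) (≤-refl {fromℚ ε}))

  eventually≤ : ∀ ε → 0ℚ ℚ.< ε → ∃ λ N → ∀ k → qs (k ℕ.+ N) ≤ q + fromℚ ε
  eventually≤ ε 0<ε = let N , near = qs⟶q ε 0<ε in N , λ k → proj₁ (near (k ℕ.+ N) (ℕₚ.m≤n+m N k))

  eventually<1 : q < 1ℝ → ∃ λ N → ∀ k → qs (k ℕ.+ N) < 1ℝ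
  eventually<1 (ε , 0<ε , q<1) = let N , le = eventually≤ (ε ℚ.* ½) (halve 0<ε) in N , λ k →
    ≤-<-trans {qs (k ℕ.+ N)} {q + fromℚ (ε ℚ.* ½)} {1ℝ} (le k)
      (ε ℚ.* ½ , halve 0<ε , map₁ᵉ (λ j → subst (ℚ._≤ 1ℚ)
        (solve 2 (λ x e → x :+ e := (x :+ e :* con ½) :+ e :* con ½) refl (seq q j) ε)) q<1)

module _
  (em : ExcludedMiddle 0ℓ) {b₀ b₁ : ℝ} (b₁ᶜ : Computableℝ b₁) (bal : Balanced b₁)
  (μ : BorelProbabilityMeasure) (μ-d : IsMeasureOf (d b₀ b₁) μ)
  {q : ℝ} (0≤q : 0ℝ ≤ q) (q≤1 : q ≤ 1ℝ)
  where

  Realized : (ℕ → ℝ) → (ℕ → ℝ) → Set₁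
  Realized lo hi = Σ (Pred Cantor 0ℓ) λ P → EffectivelyClosed P × HasCapacity μ P q × Σ (ℕ → Clopen) λ F →
    ComputableClopenSeq F × P ≐ ⋂ ℕ (λ n → ⟦ F n ⟧ᶜ) ×
    (∀ n → ∃ λ t → HasCapacity μ ⟦ F n ⟧ᶜ t × lo n ≤ t × t ≤ hi n)

  -- The windows are left open here because they are consecutive terms of `qs` only when the
  -- sandwich is claimed. The lower ends keep the capacities above `q`, and the upper ends force
  -- them down to it.
  realize : (lo hi : ℕ → ℝ) → ComputableSeqℝ lo → ComputableSeqℝ hi →
            (∀ n → q ≤ lo n) → (∀ n → lo n < hi n) → (∀ n → lo n < 1ℝ) →
            (∀ ε → 0ℚ ℚ.< ε → ∃ λ n → hi n ≤ q + fromℚ ε) → Realized lo hi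
  realize lo hi loᶜ hiᶜ q≤lo lo<hi lo<1 hi≤q = use (Search.between b₀ b₁ bal b₁ᶜ lo hi loᶜ hiᶜ
      (λ n → ≤-trans {0ℝ} {q} {lo n} 0≤q (q≤lo n)) lo<hi lo<1)
    where
    use : (∃ λ (w : ℕ → ℕ) → Computable {1} (λ xs → w (lookup xs 0F)) ×
            (∀ n → lo n ≤ capacity b₀ b₁ (bits (w n)) × capacity b₀ b₁ (bits (w n)) ≤ hi n)) → Realized lo hi
    use (w , wᶜ , within) =
        (λ x → ∀ n → x ∈ Below (bits (w n)))
      , segments-effectivelyClosed w wᶜ
      , hasCapacity-⋂ {b₀} {b₁} μ μ-d em bal {q} q≤1 (λ n → bits (w n))
          (λ n → ≤-trans {q} {lo n} {cap n} (q≤lo n) (proj₁ (within n)))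
          (λ ε 0<ε → let n , le = hi≤q ε 0<ε in n , ≤-trans {cap n} {hi n} {q + fromℚ ε} (proj₂ (within n)) le)
      , segments w wᶜ
      , segments-computable w wᶜ
      , ((λ p n → proj₂ (segments-≐ w wᶜ n) (p n)) , (λ p n → proj₁ (segments-≐ w wᶜ n) (p n)))
      , λ n → cap n , hasCapacity-Below {b₀} {b₁} μ μ-d (bits (w n)) (segments-≐ w wᶜ n) , within n
      where
      cap : ℕ → ℝ
      cap n = capacity b₀ b₁ (bits (w n))

  module _ (qs : ℕ → ℝ) (qsᶜ : ComputableSeqℝ qs) (dec : ∀ n → qs (suc n) ≤ qs n) (qs⟶q : qs ⟶ q) where

    private
      Goal : Set₁
      Goal = Σ (Pred Cantor 0ℓ) λ P → EffectivelyClosed P × HasCapacity μ P q × Σ (ℕ → Clopen) λ F →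
        ComputableClopenSeq F × P ≐ ⋂ ℕ (λ n → ⟦ F n ⟧ᶜ) ×
        ((∀ n → qs (suc n) < qs n) → qs 1 ≤ 1ℝ →
          ∀ n → ∃ λ t → HasCapacity μ ⟦ F n ⟧ᶜ t × qs (suc n) ≤ t × t ≤ qs n)

      tail : ∀ k → ComputableSeqℝ (λ n → qs (k ℕ.+ n))
      tail k = computableℝ-reindex {qs} qsᶜ (k ℕ.+_) (constᶜ k +ᶜ varᶜ 0F)

      tail≤ : ∀ k ε → 0ℚ ℚ.< ε → ∃ λ n → qs (k ℕ.+ n) ≤ q + fromℚ ε
      tail≤ k ε 0<ε = let N , le = eventually≤ {q} {qs} dec qs⟶q ε 0<ε in N , le k

      strict-<1 : (∀ n → qs (suc n) < qs n) → qs 1 < 1ℝ → Goal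
      strict-<1 strict q₁<1 =
        let P , Pᶜ , cP , F , Fᶜ , P≐ , t = realize (λ n → qs (suc n)) qs (tail 1) qsᶜ
              (λ n → limit≤ {q} {qs} dec qs⟶q (suc n)) strict
              (λ n → ≤-<-trans {qs (suc n)} {qs 1} {1ℝ}
                (subst (λ k → qs k ≤ qs 1) (ℕₚ.+-comm n 1) (antitone {q} {qs} dec qs⟶q 1 n)) q₁<1)
              (tail≤ 0)
        in P , Pᶜ , cP , F , Fᶜ , P≐ , λ _ _ → t

      -- Here `qs 1` equals 1, and the first window has a lower end that the search does not admit.
      -- The whole space, of capacity 1, serves as the first set, and the search supplies the others
      -- from the next window on.
      strict-≥1 : (∀ n → qs (suc n) < qs n) → qs 1 ≤ 1ℝ → 1ℝ ≤ qs 1 → Goal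
      strict-≥1 strict q₁≤1 1≤q₁ =
        let P , Pᶜ , cP , F , Fᶜ , P≐ , t = realize (λ n → qs (2 ℕ.+ n)) (λ n → qs (suc n)) (tail 2) (tail 1)
              (λ n → limit≤ {q} {qs} dec qs⟶q (2 ℕ.+ n)) (λ n → strict (suc n))
              (λ n → <-≤-trans {qs (2 ℕ.+ n)} {qs (suc n)} {1ℝ} (strict (suc n))
                (≤-trans {qs (suc n)} {qs 1} {1ℝ}
                  (subst (λ k → qs k ≤ qs 1) (ℕₚ.+-comm n 1) (antitone {q} {qs} dec qs⟶q 1 n)) q₁≤1))
              (tail≤ 1)
        in P , Pᶜ , cP , prepend whole F , prepend-computable whole {F} Fᶜ
           , ( (λ p → λ { zero → here refl ; (suc n) → proj₁ P≐ p n })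
             , (λ p → proj₂ P≐ λ n → p (suc n)))
           , λ _ _ → λ { zero    → 1ℝ , hasCapacity-whole {b₀} {b₁} μ μ-d {r = 1ℝ} (λ _ → here refl) (≈-refl {1ℝ}) , q₁≤1
                                   , ≤-trans {1ℝ} {qs 1} {qs 0} 1≤q₁ (dec 0)
                       ; (suc n) → t n }

      -- The conditions on the sandwich fail, so only the capacity `q` of the intersection is at
      -- stake. Raising the upper ends by `2⁻ n` creates the gaps, and starting at `N` keeps the
      -- lower ends below 1.
      <1 : ¬ ((∀ n → qs (suc n) < qs n) × qs 1 ≤ 1ℝ) → q < 1ℝ → Goal
      <1 ¬strict q<1 =
        let N , qs<1 = eventually<1 {q} {qs} dec qs⟶q q<1
            P , Pᶜ , cP , F , Fᶜ , P≐ , _ = realize (λ n → qs (N ℕ.+ n)) (λ n → qs (N ℕ.+ n) + fromℚ (2⁻ n))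
              (tail N) (computableℝ-+2⁻ {λ n → qs (N ℕ.+ n)} (tail N))
              (λ n → limit≤ {q} {qs} dec qs⟶q (N ℕ.+ n))
              (λ n → 2⁻ n , 0<2⁻ n , always λ _ → ℚₚ.≤-refl)
              (λ n → subst (λ k → qs k < 1ℝ) (ℕₚ.+-comm n N) (qs<1 n))
              (small N)
        in P , Pᶜ , cP , F , Fᶜ , P≐ , λ strict q₁≤1 → contradiction (strict , q₁≤1) ¬strict
        where
        small : ∀ N ε → 0ℚ ℚ.< ε → ∃ λ n → qs (N ℕ.+ n) + fromℚ (2⁻ n) ≤ q + fromℚ ε
        small N ε 0<ε =
          let M , le = eventually≤ {q} {qs} dec qs⟶q (ε ℚ.* ½) (halve 0<ε)
              K , 2⁻≤ = 2⁻-small (halve 0<ε)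
              n = K ℕ.+ M
          in n , ≤-trans {qs (N ℕ.+ n) + fromℚ (2⁻ n)} {(q + fromℚ (ε ℚ.* ½)) + fromℚ (ε ℚ.* ½)} {q + fromℚ ε}
               (+-mono-≤ {qs (N ℕ.+ n)} {q + fromℚ (ε ℚ.* ½)} {fromℚ (2⁻ n)} {fromℚ (ε ℚ.* ½)}
                 (subst (λ k → qs k ≤ q + fromℚ (ε ℚ.* ½)) (ℕₚ.+-assoc N K M) (le (N ℕ.+ K)))
                 (≤-pointwise {fromℚ (2⁻ n)} {fromℚ (ε ℚ.* ½)} (always λ _ → 2⁻≤ n (ℕₚ.m≤m+n K M))))
               (proj₁ (≈-pointwise {(q + fromℚ (ε ℚ.* ½)) + fromℚ (ε ℚ.* ½)} {q + fromℚ ε} λ j →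
                 solve 2 (λ x e → (x :+ e :* con ½) :+ e :* con ½ := x :+ e) refl (seq q j) ε))

      ≥1 : ¬ ((∀ n → qs (suc n) < qs n) × qs 1 ≤ 1ℝ) → 1ℝ ≤ q → Goal
      ≥1 ¬strict 1≤q = (λ _ → ⊤) , whole-effectivelyClosed
        , hasCapacity-whole {b₀} {b₁} μ μ-d {r = q} (λ _ → tt) (q≤1 , 1≤q)
        , (λ _ → whole) , (proj₁ (constᶜ {1} 1) , λ n → proj₂ (constᶜ {1} 1) (n ∷ []))
        , ((λ _ _ → here refl) , (λ _ → tt))
        , λ strict q₁≤1 → contradiction (strict , q₁≤1) ¬strict

      ≤-or-> : ∀ x y → (x ≤ y → Goal) → (y < x → Goal) → Goal
      ≤-or-> x y f g with em {x ≤ y}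
      ... | yes x≤y = f x≤y
      ... | no  x≰y = g (≰⇒> em {x} {y} x≰y)

      -- The distinction is not effective and need not be: the theorem asks for the existence of
      -- programs, and each case exhibits one.
      decide : Dec ((∀ n → qs (suc n) < qs n) × qs 1 ≤ 1ℝ) → Goal
      decide (yes (strict , q₁≤1)) = ≤-or-> 1ℝ (qs 1) (strict-≥1 strict q₁≤1) (strict-<1 strict)
      decide (no ¬strict)          = ≤-or-> 1ℝ q (≥1 ¬strict) (<1 ¬strict)

    capacity-realized : Goal
    capacity-realized = decide em

theorem4p3 : ExcludedMiddle 0ℓ →
    (b₀ b₁ : ℝ) → Computableℝ b₀ → Computableℝ b₁ →
    0ℝ < b₁ → b₁ ≤ b₀ → 0ℝ < b₀ + b₁ → b₀ + b₁ < 1ℝ →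
    (μ : BorelProbabilityMeasure) → IsMeasureOf (d b₀ b₁) μ →
    (q : ℝ) → 0ℝ ≤ q → q ≤ 1ℝ →
    (qs : ℕ → ℝ) → ComputableSeqℝ qs → (∀ n → qs (suc n) ≤ qs n) → qs ⟶ q →
    Σ (Pred Cantor 0ℓ) λ P →
    EffectivelyClosed P
    × HasCapacity μ P q
    × Σ (ℕ → Clopen) λ F →
    ComputableClopenSeq F
    × P ≐ ⋂ ℕ (λ n → ⟦ F n ⟧ᶜ)
    × ((∀ n → qs (suc n) < qs n) → qs 1 ≤ 1ℝ →
    ∀ n → ∃ λ t → HasCapacity μ ⟦ F n ⟧ᶜ t × qs (suc n) ≤ t × t ≤ qs n)
theorem4p3 em b₀ b₁ _ b₁ᶜ 0<b₁ b₁≤b₀ _ b₀+b₁<1 μ μ-d q 0≤q q≤1 qs qsᶜ dec qs⟶q =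
  capacity-realized em {b₀} {b₁} b₁ᶜ (balanced {b₀} {b₁} 0<b₁ b₁≤b₀ b₀+b₁<1) μ μ-d {q} 0≤q q≤1 qs qsᶜ dec qs⟶q
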